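{- Let $(G,\sigma)$ be a 2-edge-connected cubic signed graph with even negativeness $\epsilon(G,\sigma)$. Then $\mathrm{scc}(G,\sigma)<\frac{23}{9}|E(G)|$.
   Context: A signed graph $(G,\sigma)$ is a graph $G$ with a map $\sigma:E(G)\to\{ -1,+1\}$; an edge $e$ is negative if $\sigma(e)=-1$, positive otherwise. A cycle is a connected 2-regular subgraph; it is positive if it contains an even number of negative edges, negative otherwise. A barbell is a pair of edge-disjoint negative cycles joined by a path (possibly of length zero). A circuit is a positive cycle or a barbell. A circuit cover is a family of circuits whose union contains every edge; its length is the sum of the numbers of edges of its members. $\mathrm{scc}(G,\sigma)$ is the minimum length of a circuit cover. For an edge cut $S$ (a minimal set of edges whose removal disconnects $G$), switching at $S$ multiplies the signs of the edges in $S$ by $-1$; two signatures are equivalent if one is obtained from the other in this way. The negativeness $\epsilon(G,\sigma)$ is the minimum number of negative edges over all signatures equivalent to $\sigma$. -}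

module Defs where

open import Data.Nat using (ℕ; zero; suc; _+_; _*_; _≤_; _<_)
open import Data.Nat.Divisibility using (_∣_)
open import Data.Bool using (Bool; true; false; if_then_else_; _∧_; _∨_; _xor_)
open import Data.Fin using (Fin; zero; suc; _≟_)
open import Data.Product using (Σ; ∃; ∃-syntax; _×_; _,_; proj₁; proj₂)
open import Data.Sum using (_⊎_)
open import Data.List using (List; map)
open import Data.Nat.ListAction using (sum)
open import Data.List.Relation.Unary.All using (All)
open import Data.List.Relation.Unary.Any using (Any)
open import Relation.Nullary using (¬_)
open import Relation.Nullary.Decidable using (⌊_⌋)
open import Relation.Binary.PropositionalEquality using (_≡_; _≢_)
open import Relation.Binary.Construct.Closure.ReflexiveTransitive using (Star)

-- Finite multigraph (parallel edges and loops allowed by the data type):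
-- vertices Fin n, edges Fin m, each edge has an (unordered) pair of ends.
record Graph : Set where
  field
    n    : ℕ
    m    : ℕ
    ends : Fin m → Fin n × Fin n
open Graph public

sumFin : ∀ {k} → (Fin k → ℕ) → ℕ
sumFin {zero}  f = 0
sumFin {suc k} f = f zero + sumFin (λ i → f (suc i))

-- edge sets (subgraphs given by their edge set)
EdgeSet : Graph → Set
EdgeSet G = Fin (m G) → Bool

b2n : Bool → ℕ
b2n true  = 1
b2n false = 0

size : (G : Graph) → EdgeSet G → ℕ
size G S = sumFin (λ e → b2n (S e))

-- number of ends of edge e at vertex v (a loop counts twice)
endCount : (G : Graph) → Fin (m G) → Fin (n G) → ℕ
endCount G e v = b2n ⌊ proj₁ (ends G e) ≟ v ⌋ + b2n ⌊ proj₂ (ends G e) ≟ v ⌋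

deg : (G : Graph) → EdgeSet G → Fin (n G) → ℕ
deg G S v = sumFin (λ e → if S e then endCount G e v else 0)

-- v is a vertex of the subgraph spanned by S
Inc : (G : Graph) → EdgeSet G → Fin (n G) → Set
Inc G S v = 0 < deg G S v

Joins : (G : Graph) → Fin (m G) → Fin (n G) → Fin (n G) → Set
Joins G e u w = (proj₁ (ends G e) ≡ u × proj₂ (ends G e) ≡ w)
              ⊎ (proj₁ (ends G e) ≡ w × proj₂ (ends G e) ≡ u)

data Walk (G : Graph) (S : EdgeSet G) : Fin (n G) → Fin (n G) → Set where
  nil  : ∀ {u} → Walk G S u u
  cons : ∀ {u w v} (e : Fin (m G)) → S e ≡ true → Joins G e u w
       → Walk G S w v → Walk G S u v

ConnectedSub : (G : Graph) → EdgeSet G → Set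
ConnectedSub G S = ∀ u v → Inc G S u → Inc G S v → Walk G S u v

allEdges : (G : Graph) → EdgeSet G
allEdges G e = true

deleteEdge : (G : Graph) → Fin (m G) → EdgeSet G
deleteEdge G e f = if ⌊ e ≟ f ⌋ then false else true

Cubic : Graph → Set
Cubic G = ∀ v → deg G (allEdges G) v ≡ 3

TwoEdgeConnected : Graph → Set
TwoEdgeConnected G =
  (∀ u v → Walk G (allEdges G) u v) ×
  (∀ e u v → Walk G (deleteEdge G e) u v)

-- signature: σ e ≡ true means e is negative
Signature : Graph → Set
Signature G = Fin (m G) → Bool

negCount : (G : Graph) → Signature G → EdgeSet G → ℕ
negCount G σ S = sumFin (λ e → b2n (S e ∧ σ e))

IsCycle : (G : Graph) → EdgeSet G → Set
IsCycle G C =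
  (∃[ e ] C e ≡ true) × ConnectedSub G C ×
  (∀ v → deg G C v ≡ 0 ⊎ deg G C v ≡ 2)

PositiveCycle : (G : Graph) → Signature G → EdgeSet G → Set
PositiveCycle G σ C = IsCycle G C × 2 ∣ negCount G σ C

NegativeCycle : (G : Graph) → Signature G → EdgeSet G → Set
NegativeCycle G σ C = IsCycle G C × ¬ (2 ∣ negCount G σ C)

IsPath : (G : Graph) → EdgeSet G → Fin (n G) → Fin (n G) → Set
IsPath G P u v =
  (u ≡ v × (∀ e → P e ≡ false)) ⊎
  (u ≢ v × ConnectedSub G P × deg G P u ≡ 1 × deg G P v ≡ 1 ×
   (∀ x → x ≢ u → x ≢ v → deg G P x ≡ 0 ⊎ deg G P x ≡ 2))

Disjoint : (G : Graph) → EdgeSet G → EdgeSet G → Set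
Disjoint G A B = ∀ e → A e ≡ true → B e ≡ false

IsBarbell : (G : Graph) → Signature G → EdgeSet G → Set
IsBarbell G σ B =
  Σ (EdgeSet G) λ C₁ → Σ (EdgeSet G) λ C₂ → Σ (EdgeSet G) λ P →
  Σ (Fin (n G)) λ u → Σ (Fin (n G)) λ v →
    NegativeCycle G σ C₁ × NegativeCycle G σ C₂ × IsPath G P u v ×
    Disjoint G C₁ C₂ × Disjoint G C₁ P × Disjoint G C₂ P ×
    Inc G C₁ u × Inc G C₂ v ×
    (∀ x → Inc G C₁ x → Inc G C₂ x → x ≡ u × u ≡ v) ×
    (∀ x → Inc G P x → Inc G C₁ x → x ≡ u) ×
    (∀ x → Inc G P x → Inc G C₂ x → x ≡ v) ×
    (∀ e → B e ≡ (C₁ e ∨ C₂ e ∨ P e))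

IsCircuit : (G : Graph) → Signature G → EdgeSet G → Set
IsCircuit G σ C = PositiveCycle G σ C ⊎ IsBarbell G σ C

IsCircuitCover : (G : Graph) → Signature G → List (EdgeSet G) → Set
IsCircuitCover G σ F =
  All (IsCircuit G σ) F × (∀ e → Any (λ C → C e ≡ true) F)

coverLength : (G : Graph) → List (EdgeSet G) → ℕ
coverLength G F = sum (map (size G) F)

-- switching at the edge cut δ(X) (edges with exactly one end in X)
switch : (G : Graph) → (Fin (n G) → Bool) → Signature G → Signature G
switch G X σ e = σ e xor (X (proj₁ (ends G e)) xor X (proj₂ (ends G e)))

SwitchStep : (G : Graph) → Signature G → Signature G → Set
SwitchStep G σ τ = ∃[ X ] (∀ e → τ e ≡ switch G X σ e)

Equivalent : (G : Graph) → Signature G → Signature G → Set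
Equivalent G = Star (SwitchStep G)

IsNegativeness : (G : Graph) → Signature G → ℕ → Set
IsNegativeness G σ k =
  (∃[ τ ] (Equivalent G σ τ × negCount G τ (allEdges G) ≡ k)) ×
  (∀ τ → Equivalent G σ τ → k ≤ negCount G τ (allEdges G))

{-# OPTIONS --safe #-}

-- Switch to an equivalent signature with the least number of negative edges. By minimality at most half
-- of every cut is negative, so the positive edges contain a spanning tree T, and the negative edges N,
-- being even in number, extend inside T ∪ N to an even edge set H with an even number of negative edges.
-- A bridge of the positive part lies in a cut with exactly one negative edge, hence in H. The remaining
-- positive edges form a bridgeless graph E₀, so it is enough to cover H and E₀ separately.
--
-- E₀ is covered by cycles of total length at most 5/3 |E₀|: Seymour's 6-flow theorem gives an even set C
-- and a Z₃-flow f without zeros outside C, and each of f, f + g, f - g, for an orientation g of C, lifts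
-- to an integer flow with values in {0, ±1, ±2} and thus yields three even sets A, B, D covering the
-- support twice. Averaging over the eighteen covers {C, A, B}, {A, B, C △ D}, … gives the constant.
--
-- H is covered by circuits of total length at most 4/3 |T ∪ N|: negative cycles of H are paired by paths
-- through T, which traverse other cycles of H along arcs. Three such pairings α, β, γ have total length
-- at most 4 |T ∪ N|: on a cycle met by several paths α and β use complementary arcs, while γ uses every
-- arc once and every path twice, and then need not use the cycle itself. Altogether
-- 9 · length ≤ 12 (n - 1 + |N|) + 15 |E₀| < 12 n + 15 m = 23 m.

module Submission where

open import Defs
open import Algebra.Bundles using (CommutativeRing; CommutativeMonoid)
open import Data.Bool using (Bool; true; false; if_then_else_; _∧_; _∨_; _xor_; not)
open import Data.Bool.Properties using (xor-∧-commutativeRing; ∧-zeroʳ; ∧-identityʳ; ∨-zeroʳ; ∨-identityʳ; xor-same; xor-comm; xor-identityʳ; ∧-distribˡ-xor; ∧-distribʳ-xor)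
open import Data.Empty using (⊥; ⊥-elim)
open import Data.Fin using (Fin; zero; suc; _≟_)
open import Data.Fin.Properties using (all?; any?)
open import Data.Integer using (ℤ)
import Data.Integer as ℤ
import Data.Integer.Properties as ℤP
open import Data.List using (List; []; _∷_; _++_; map; concat)
open import Data.List.Properties using (map-++; concat-++)
open import Data.List.Relation.Unary.All using (All; []; _∷_)
import Data.List.Relation.Unary.All as All
import Data.List.Relation.Unary.All.Properties as AllP
open import Data.List.Relation.Unary.Any using (Any; here; there)
import Data.List.Relation.Unary.Any.Properties as AnyP
open import Data.Nat using (ℕ; zero; suc; _+_; _*_; _≤_; _<_; z≤n; s≤s; s≤s⁻¹; _≤?_)
open import Data.Nat.Divisibility using (_∣_; divides)
open import Data.Nat.ListAction using (sum)
open import Data.Nat.ListAction.Properties using (sum-++)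
import Data.Nat.Properties as NP
open import Data.Nat.Properties using (≤-refl; ≤-trans; ≤-reflexive; <⇒≱; +-mono-≤; +-mono-≤-<; m≤m+n; m≤n+m; m≤n⇒m≤1+n; n<1+n; ≤-<-trans)
open import Data.Nat.Solver using (module +-*-Solver)
open import Data.Product using (Σ; ∃; ∃-syntax; _×_; _,_; proj₁; proj₂)
open import Data.Sum using (_⊎_; inj₁; inj₂; [_,_]′)
open import Function using (_∘_; case_of_)
open import Level using (0ℓ)
open import Relation.Binary.Construct.Closure.ReflexiveTransitive using (ε; _◅_; _◅◅_)
open import Relation.Binary.PropositionalEquality using (_≡_; _≢_; refl; sym; trans; cong; cong₂; subst; isEquivalence)
open import Relation.Nullary using (yes; no; Dec)
open import Relation.Nullary.Decidable using (⌊_⌋; from-yes; _→-dec_; _⊎-dec_; _×-dec_; ¬?)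
open +-*-Solver using (solve; _:+_; _:*_; _:=_; con)

-- Booleans and finite sums

-- Pairing negative cycles is a global task, while the induction is local: deleting a core (one
-- vertex, or the vertices of one cycle of `H`) leaves components containing an odd or an even
-- number of negative edges of `H`. Even ones are covered on their own; an odd one hands over
-- unfinished barbells, called tadpoles: one in α, one in β, two in γ. Hence an edge leading to such
-- a component costs 1 + 1 + 2 = 4. An edge of a cycle of `H` has the same budget: at most 1 as part
-- of an arc in α or β, 1 in γ, and 2 for the cycle itself, which α and β use once each; a negative
-- cycle with nothing attached serves as the tadpole in all four places. Either of the two
-- complementary arc systems may be nearly the whole cycle, so neither pairing is controlled alone;
-- only the sum of the three is. Maximum degree three enters twice: a vertex of a cycle has a single
-- further edge, so at most one component attaches there, and two vertices of a connected bridgeless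
-- piece lie on a common cycle, which the 6-flow induction needs.

true≢false : true ≡ false → ⊥
true≢false ()

split-bool : (b : Bool) → (b ≡ true) ⊎ (b ≡ false)
split-bool true  = inj₁ refl
split-bool false = inj₂ refl

cases : ∀ {A : Set} (b : Bool) → (b ≡ true → A) → (b ≡ false → A) → A
cases true  t f = t refl
cases false t f = f refl

∧-true : ∀ {a b} → a ∧ b ≡ true → (a ≡ true) × (b ≡ true)
∧-true {true} {true} p = refl , refl

∧-intro : ∀ {a b} → a ≡ true → b ≡ true → a ∧ b ≡ true
∧-intro refl refl = refl

∨-true : ∀ {a b} → a ∨ b ≡ true → (a ≡ true) ⊎ (b ≡ true)
∨-true {true}  p = inj₁ refl
∨-true {false} p = inj₂ p

∨-introˡ : ∀ {a b} → a ≡ true → a ∨ b ≡ true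
∨-introˡ refl = refl

∨-introʳ : ∀ {a b} → b ≡ true → a ∨ b ≡ true
∨-introʳ {a} refl = ∨-zeroʳ a

∨-false : ∀ {a b} → a ∨ b ≡ false → (a ≡ false) × (b ≡ false)
∨-false {false} {false} p = refl , refl

∨-false-intro : ∀ {a b} → a ≡ false → b ≡ false → a ∨ b ≡ false
∨-false-intro refl refl = refl

not-true : ∀ {a} → not a ≡ true → a ≡ false
not-true {false} p = refl

not-intro : ∀ {a} → a ≡ false → not a ≡ true
not-intro refl = refl

xor-eq : ∀ {a b} → a xor b ≡ false → a ≡ b
xor-eq {true}  {true}  p = refl
xor-eq {false} {false} p = refl

b2n-mono : ∀ {a b} → (a ≡ true → b ≡ true) → b2n a ≤ b2n b
b2n-mono {false} f = z≤n
b2n-mono {true}  f rewrite f refl = ≤-refl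

b2n-∨ : ∀ a b → b2n (a ∨ b) ≤ b2n a + b2n b
b2n-∨ true  b = s≤s z≤n
b2n-∨ false b = ≤-refl

⌊≟⌋-refl : ∀ {k} (x : Fin k) → ⌊ x ≟ x ⌋ ≡ true
⌊≟⌋-refl x with x ≟ x
... | yes _ = refl
... | no ¬p = ⊥-elim (¬p refl)

⌊≟⌋-≢ : ∀ {k} {x y : Fin k} → x ≢ y → ⌊ x ≟ y ⌋ ≡ false
⌊≟⌋-≢ {x = x} {y} ne with x ≟ y
... | yes p = ⊥-elim (ne p)
... | no _ = refl

⌊≟⌋-true : ∀ {k} {x y : Fin k} → ⌊ x ≟ y ⌋ ≡ true → x ≡ y
⌊≟⌋-true {x = x} {y} p with x ≟ y
... | yes q = q

search : ∀ {k} (p : Fin k → Bool) → (∃[ i ] p i ≡ true) ⊎ (∀ i → p i ≡ false)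
search {zero}  p = inj₂ λ ()
search {suc k} p with split-bool (p zero) | search (p ∘ suc)
... | inj₁ q | _ = inj₁ (zero , q)
... | inj₂ q | inj₁ (i , r) = inj₁ (suc i , r)
... | inj₂ q | inj₂ r = inj₂ λ { zero → q ; (suc i) → r i }

sumFin-cong : ∀ {k} {f g : Fin k → ℕ} → (∀ i → f i ≡ g i) → sumFin f ≡ sumFin g
sumFin-cong {zero}  h = refl
sumFin-cong {suc k} h = cong₂ _+_ (h zero) (sumFin-cong (h ∘ suc))

sumFin-mono : ∀ {k} {f g : Fin k → ℕ} → (∀ i → f i ≤ g i) → sumFin f ≤ sumFin g
sumFin-mono {zero}  h = z≤n
sumFin-mono {suc k} h = +-mono-≤ (h zero) (sumFin-mono (h ∘ suc))

sumFin-+ : ∀ {k} (f g : Fin k → ℕ) → sumFin (λ i → f i + g i) ≡ sumFin f + sumFin g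
sumFin-+ {zero}  f g = refl
sumFin-+ {suc k} f g rewrite sumFin-+ (f ∘ suc) (g ∘ suc) =
  solve 4 (λ a b c d → (a :+ b) :+ (c :+ d) := (a :+ c) :+ (b :+ d)) refl
    (f zero) (g zero) (sumFin (f ∘ suc)) (sumFin (g ∘ suc))

sumFin-* : ∀ {k} c (f : Fin k → ℕ) → sumFin (λ i → c * f i) ≡ c * sumFin f
sumFin-* {zero}  c f = sym (NP.*-zeroʳ c)
sumFin-* {suc k} c f rewrite sumFin-* c (f ∘ suc) = sym (NP.*-distribˡ-+ c (f zero) _)

sumFin-0 : ∀ {k} → sumFin {k} (λ _ → 0) ≡ 0
sumFin-0 {zero}  = refl
sumFin-0 {suc k} = sumFin-0 {k}

sumFin-swap : ∀ {k l} (f : Fin k → Fin l → ℕ) →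
  sumFin (λ i → sumFin (f i)) ≡ sumFin (λ j → sumFin (λ i → f i j))
sumFin-swap {zero}  {l} f = sym (sumFin-0 {l})
sumFin-swap {suc k} {l} f rewrite sumFin-swap (f ∘ suc) =
  sym (sumFin-+ (f zero) (λ j → sumFin (λ i → f (suc i) j)))

term≤sumFin : ∀ {k} (f : Fin k → ℕ) i → f i ≤ sumFin f
term≤sumFin f zero    = m≤m+n _ _
term≤sumFin f (suc i) = ≤-trans (term≤sumFin (f ∘ suc) i) (m≤n+m _ _)

sumFin-pos : ∀ {k} (f : Fin k → ℕ) → 0 < sumFin f → ∃[ i ] 0 < f i
sumFin-pos {suc k} f p with f zero in eq
... | suc x = zero , subst (0 <_) (sym eq) (s≤s z≤n)
... | zero with sumFin-pos (f ∘ suc) p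
...   | i , q = suc i , q

card : ∀ {k} → (Fin k → Bool) → ℕ
card X = sumFin (λ i → b2n (X i))

card-mono : ∀ {k} {X Y : Fin k → Bool} → (∀ i → X i ≡ true → Y i ≡ true) → card X ≤ card Y
card-mono h = sumFin-mono (λ i → b2n-mono (h i))

card-strict : ∀ {k} {X Y : Fin k → Bool} → (∀ i → X i ≡ true → Y i ≡ true) →
  (j : Fin k) → X j ≡ false → Y j ≡ true → card X < card Y
card-strict {suc k} {X} {Y} h zero p q rewrite p | q = s≤s (card-mono (h ∘ suc))
card-strict {suc k} {X} {Y} h (suc j) p q =
  +-mono-≤-< (b2n-mono (h zero)) (card-strict (h ∘ suc) j p q)

card-≤ : ∀ {k} (X : Fin k → Bool) → card X ≤ k
card-≤ {zero}  X = z≤n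
card-≤ {suc k} X with X zero
... | true  = s≤s (card-≤ (X ∘ suc))
... | false = m≤n⇒m≤1+n (card-≤ (X ∘ suc))

card-⊎ : ∀ {k} {X Y Z : Fin k → Bool} →
  (∀ i → X i ≡ true → (Z i ≡ true) × (Y i ≡ false)) → (∀ i → Y i ≡ true → Z i ≡ true) →
  card X + card Y ≤ card Z
card-⊎ {X = X} {Y} {Z} f g =
  subst (_≤ card Z) (sumFin-+ (b2n ∘ X) (b2n ∘ Y)) (sumFin-mono (λ i → go (f i) (g i)))
  where
  go : ∀ {a b c} → (a ≡ true → (c ≡ true) × (b ≡ false)) → (b ≡ true → c ≡ true) → b2n a + b2n b ≤ b2n c
  go {true} {b} h _ with h refl
  ... | refl , refl = ≤-refl
  go {false} {true} _ h rewrite h refl = ≤-refl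
  go {false} {false} _ _ = z≤n

card-⌊≟⌋ : ∀ {k} (i : Fin k) → card (λ j → ⌊ i ≟ j ⌋) ≡ 1
card-⌊≟⌋ {suc k} zero = cong suc (sumFin-0 {k})
card-⌊≟⌋ {suc k} (suc i) = trans (sumFin-cong (λ j → cong b2n (lem j))) (card-⌊≟⌋ i)
  where
  lem : ∀ j → ⌊ suc i ≟ suc j ⌋ ≡ ⌊ i ≟ j ⌋
  lem j with i ≟ j
  ... | yes _ = refl
  ... | no _ = refl

odd : ℕ → Bool
odd zero    = false
odd (suc k) = not (odd k)

odd-+ : ∀ a b → odd (a + b) ≡ odd a xor odd b
odd-+ zero    b = refl
odd-+ (suc a) b rewrite odd-+ a b with odd a | odd b
... | true  | true  = refl
... | true  | false = refl
... | false | _     = refl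

odd-b2n : ∀ b → odd (b2n b) ≡ b
odd-b2n true  = refl
odd-b2n false = refl

odd-*2 : ∀ q → odd (q * 2) ≡ false
odd-*2 zero = refl
odd-*2 (suc q) rewrite odd-*2 q = refl

even-half : ∀ k → odd k ≡ false → ∃[ q ] k ≡ q * 2
even-half zero p = 0 , refl
even-half (suc (suc k)) p with even-half k (trans (not² (odd k)) p)
  where
  not² : ∀ b → b ≡ not (not b)
  not² true = refl
  not² false = refl
... | q , refl = suc q , refl

odd⇔2∣ : ∀ k → (odd k ≡ false → 2 ∣ k) × (2 ∣ k → odd k ≡ false)
odd⇔2∣ k = (λ p → divides (proj₁ (even-half k p)) (proj₂ (even-half k p)))
         , (λ { (divides q refl) → odd-*2 q })

-- The boundary operator over a commutative ring

module RingSum (R : CommutativeRing 0ℓ 0ℓ) where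
  open CommutativeRing R public
    renaming (_+_ to _⊕_; _*_ to _⊛_; -_ to ⊖_; refl to ≈-refl; sym to ≈-sym; trans to ≈-trans)
    hiding (zero; _-_)
  open import Algebra.Properties.Ring ring public
    using (-0#≈0#; -‿involutive) renaming (-‿distribˡ-* to ⊖-distribˡ; -‿distribʳ-* to ⊖-distribʳ; -‿+-comm to ⊖-⊕)
  open import Algebra.Properties.CommutativeSemigroup (CommutativeMonoid.commutativeSemigroup +-commutativeMonoid) public
    using (interchange)
  open import Relation.Binary.Reasoning.Setoid setoid public

  opaque
    ∑ : ∀ {k} → (Fin k → Carrier) → Carrier
    ∑ {zero}  f = 0#
    ∑ {suc k} f = f zero ⊕ ∑ (f ∘ suc)

    ∑-cong : ∀ {k} {f g : Fin k → Carrier} → (∀ i → f i ≈ g i) → ∑ f ≈ ∑ g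
    ∑-cong {zero}  h = ≈-refl
    ∑-cong {suc k} h = +-cong (h zero) (∑-cong (h ∘ suc))

    ∑-⊕ : ∀ {k} (f g : Fin k → Carrier) → ∑ (λ i → f i ⊕ g i) ≈ ∑ f ⊕ ∑ g
    ∑-⊕ {zero}  f g = ≈-sym (+-identityˡ 0#)
    ∑-⊕ {suc k} f g = ≈-trans (+-congˡ (∑-⊕ (f ∘ suc) (g ∘ suc))) (interchange _ _ _ _)

    ∑-0 : ∀ {k} {f : Fin k → Carrier} → (∀ i → f i ≈ 0#) → ∑ f ≈ 0#
    ∑-0 {zero}  h = ≈-refl
    ∑-0 {suc k} h = ≈-trans (+-cong (h zero) (∑-0 (h ∘ suc))) (+-identityˡ 0#)

    ∑-swap : ∀ {k l} (f : Fin k → Fin l → Carrier) → ∑ (λ i → ∑ (f i)) ≈ ∑ (λ j → ∑ (λ i → f i j))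
    ∑-swap {zero}  {l} f = ≈-sym (∑-0 {l} (λ _ → ≈-refl))
    ∑-swap {suc k} f = ≈-trans (+-congˡ (∑-swap (f ∘ suc))) (≈-sym (∑-⊕ (f zero) (λ j → ∑ (λ i → f (suc i) j))))

    ⊛-∑ : ∀ {k} c (f : Fin k → Carrier) → c ⊛ ∑ f ≈ ∑ (λ i → c ⊛ f i)
    ⊛-∑ {zero}  c f = zeroʳ c
    ⊛-∑ {suc k} c f = ≈-trans (distribˡ c _ _) (+-congˡ (⊛-∑ c (f ∘ suc)))

    ∑-⊛ : ∀ {k} c (f : Fin k → Carrier) → ∑ f ⊛ c ≈ ∑ (λ i → f i ⊛ c)
    ∑-⊛ {zero}  c f = zeroˡ c
    ∑-⊛ {suc k} c f = ≈-trans (distribʳ c _ _) (+-congˡ (∑-⊛ c (f ∘ suc)))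

    ∑-single : ∀ {k} {f : Fin k → Carrier} (i : Fin k) → (∀ j → i ≢ j → f j ≈ 0#) → ∑ f ≈ f i
    ∑-single zero    h = ≈-trans (+-congˡ (∑-0 (λ j → h (suc j) (λ ())))) (+-identityʳ _)
    ∑-single (suc i) h = ≈-trans (+-cong (h zero (λ ())) (∑-single i (λ j ne → h (suc j) λ { refl → ne refl }))) (+-identityˡ _)

    ∑-⊖ : ∀ {k} (f : Fin k → Carrier) → ∑ (λ i → ⊖ f i) ≈ ⊖ ∑ f
    ∑-⊖ {zero}  f = ≈-sym -0#≈0#
    ∑-⊖ {suc k} f = ≈-trans (+-congˡ (∑-⊖ (f ∘ suc))) (⊖-⊕ _ _)

  ind : Bool → Carrier
  ind true  = 1#
  ind false = 0#

  δ : ∀ {k} → Fin k → Fin k → Carrier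
  δ x y = ind ⌊ x ≟ y ⌋

  δ-refl : ∀ {k} (x : Fin k) → δ x x ≈ 1#
  δ-refl x rewrite ⌊≟⌋-refl x = ≈-refl

  δ-≢ : ∀ {k} {x y : Fin k} → x ≢ y → δ x y ≈ 0#
  δ-≢ ne rewrite ⌊≟⌋-≢ ne = ≈-refl

  ∑-δ : ∀ {k} (χ : Fin k → Carrier) x → ∑ (λ v → χ v ⊛ δ x v) ≈ χ x
  ∑-δ χ x = ≈-trans (∑-single x (λ j ne → ≈-trans (*-congˡ (δ-≢ ne)) (zeroʳ _)))
                    (≈-trans (*-congˡ (δ-refl x)) (*-identityʳ _))

module Incidence (G : Graph) where
  V E : Set
  V = Fin (n G)
  E = Fin (m G)
  VSet ESet : Set
  VSet = V → Bool
  ESet = E → Bool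
  src tgt : E → V
  src e = proj₁ (ends G e)
  tgt e = proj₂ (ends G e)

  At : E → V → Set
  At e v = (src e ≡ v) ⊎ (tgt e ≡ v)

  crosses touches inside : VSet → ESet
  crosses X e = X (src e) xor X (tgt e)
  touches X e = X (src e) ∨ X (tgt e)
  inside  X e = X (src e) ∧ X (tgt e)

  at? : ∀ e v → (At e v) ⊎ ((src e ≢ v) × (tgt e ≢ v))
  at? e v with src e ≟ v | tgt e ≟ v
  ... | yes p | _ = inj₁ (inj₁ p)
  ... | no p | yes q = inj₁ (inj₂ q)
  ... | no p | no q = inj₂ (p , q)

  joins→at : ∀ {e u w} → Joins G e u w → At e u × At e w
  joins→at (inj₁ (p , q)) = inj₁ p , inj₂ q
  joins→at (inj₂ (p , q)) = inj₂ q , inj₁ p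

  joins-sym : ∀ {e u w} → Joins G e u w → Joins G e w u
  joins-sym (inj₁ p) = inj₂ p
  joins-sym (inj₂ p) = inj₁ p

  joins-ends : ∀ {e u w} → Joins G e u w → ∀ {z} → At e z → (z ≡ u) ⊎ (z ≡ w)
  joins-ends (inj₁ (refl , refl)) (inj₁ refl) = inj₁ refl
  joins-ends (inj₁ (refl , refl)) (inj₂ refl) = inj₂ refl
  joins-ends (inj₂ (refl , refl)) (inj₁ refl) = inj₂ refl
  joins-ends (inj₂ (refl , refl)) (inj₂ refl) = inj₁ refl

  at→joins : ∀ {e u} → At e u → ∃[ w ] Joins G e u w
  at→joins {e} (inj₁ p) = tgt e , inj₁ (p , refl)
  at→joins {e} (inj₂ p) = src e , inj₂ (refl , p)

  touches-at : ∀ X {e v} → At e v → X v ≡ true → touches X e ≡ true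
  touches-at X (inj₁ refl) p = ∨-introˡ p
  touches-at X {e} (inj₂ refl) p = ∨-introʳ {X (src e)} p

  touches→at : ∀ X {e} → touches X e ≡ true → ∃[ v ] At e v × X v ≡ true
  touches→at X {e} p with ∨-true {X (src e)} p
  ... | inj₁ q = src e , inj₁ refl , q
  ... | inj₂ q = tgt e , inj₂ refl , q

  touches-false : ∀ X {e v} → touches X e ≡ false → At e v → X v ≡ false
  touches-false X p (inj₁ refl) = proj₁ (∨-false p)
  touches-false X {e} p (inj₂ refl) = proj₂ (∨-false {X (src e)} p)

  inside-at : ∀ X {e v} → inside X e ≡ true → At e v → X v ≡ true
  inside-at X {e} p (inj₁ refl) = proj₁ (∧-true {X (src e)} p)
  inside-at X {e} p (inj₂ refl) = proj₂ (∧-true {X (src e)} p)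

  inside-intro : ∀ X {e} → (∀ v → At e v → X v ≡ true) → inside X e ≡ true
  inside-intro X {e} h = ∧-intro (h (src e) (inj₁ refl)) (h (tgt e) (inj₂ refl))

  inside-mono : ∀ X Y {e} → (∀ v → X v ≡ true → Y v ≡ true) → inside X e ≡ true → inside Y e ≡ true
  inside-mono X Y h i = inside-intro Y (λ v a → h v (inside-at X i a))

  inside-joins : ∀ X {e u w} → Joins G e u w → X u ≡ true → X w ≡ true → inside X e ≡ true
  inside-joins X (inj₁ (refl , refl)) p q = ∧-intro p q
  inside-joins X (inj₂ (refl , refl)) p q = ∧-intro q p

Loopless MaxDegree3 : Graph → Set
Loopless G = ∀ e → proj₁ (ends G e) ≢ proj₂ (ends G e)
MaxDegree3 G = ∀ v → deg G (allEdges G) v ≤ 3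

-- Phrased through cuts because the 6-flow induction asks for a second edge of the set leaving a
-- given vertex set.
Bridgeless : (G : Graph) → EdgeSet G → Set
Bridgeless G S = ∀ X e → S e ≡ true → crosses X e ≡ true → ∃[ f ] S f ≡ true × crosses X f ≡ true × e ≢ f
  where open Incidence G

-- One operator serves three rings: the Booleans, where vanishing boundary means even degrees, `F₃`
-- for the 6-flow theorem, and the integers for lifted flows.
module Boundary (G : Graph) (R : CommutativeRing 0ℓ 0ℓ) where
  open Incidence G
  open RingSum R

  ι : E → V → Carrier
  ι e v = δ (src e) v ⊕ ⊖ δ (tgt e) v

  ∂ : (E → Carrier) → V → Carrier
  ∂ f v = ∑ (λ e → f e ⊛ ι e v)

  ι-off : ∀ {e v} → src e ≢ v → tgt e ≢ v → ι e v ≈ 0#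
  ι-off p q = ≈-trans (+-cong (δ-≢ p) (≈-trans (-‿cong (δ-≢ q)) -0#≈0#)) (+-identityˡ 0#)

  ∂-local : ∀ {f g} v → (∀ e → At e v → f e ≈ g e) → ∂ f v ≈ ∂ g v
  ∂-local {f} {g} v h = ∑-cong term
    where
    term : ∀ e → f e ⊛ ι e v ≈ g e ⊛ ι e v
    term e with at? e v
    ... | inj₁ q = *-congʳ (h e q)
    ... | inj₂ (p , q) = ≈-trans (*-congˡ (ι-off p q)) (≈-trans (zeroʳ _)
                          (≈-sym (≈-trans (*-congˡ (ι-off p q)) (zeroʳ _))))

  ∂-cong : ∀ {f g} → (∀ e → f e ≈ g e) → ∀ v → ∂ f v ≈ ∂ g v
  ∂-cong h v = ∂-local v (λ e _ → h e)

  ∂-0 : ∀ {f} v → (∀ e → At e v → f e ≈ 0#) → ∂ f v ≈ 0#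
  ∂-0 v h = ≈-trans (∂-local v h) (∑-0 (λ e → zeroˡ _))

  ∂-⊕ : ∀ f g v → ∂ (λ e → f e ⊕ g e) v ≈ ∂ f v ⊕ ∂ g v
  ∂-⊕ f g v = ≈-trans (∑-cong (λ e → distribʳ _ _ _)) (∑-⊕ _ _)

  ∂-⊛ : ∀ c f v → ∂ (λ e → c ⊛ f e) v ≈ c ⊛ ∂ f v
  ∂-⊛ c f v = ≈-trans (∑-cong (λ e → *-assoc _ _ _)) (≈-sym (⊛-∑ c (λ e → f e ⊛ ι e v)))

  ∂-⊖ : ∀ f v → ∂ (λ e → ⊖ f e) v ≈ ⊖ ∂ f v
  ∂-⊖ f v = ≈-trans (∑-cong (λ e → ≈-sym (⊖-distribˡ _ _))) (∑-⊖ _)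

  ∂-∑ : ∀ {k} (g : Fin k → E → Carrier) v → ∂ (λ e → ∑ (λ i → g i e)) v ≈ ∑ (λ i → ∂ (g i) v)
  ∂-∑ g v = ≈-trans (∑-cong (λ e → ∑-⊛ (ι e v) (λ i → g i e))) (∑-swap (λ e i → g i e ⊛ ι e v))

  ∂-single : ∀ e₀ c v → ∂ (λ e → c ⊛ δ e₀ e) v ≈ c ⊛ ι e₀ v
  ∂-single e₀ c v = ≈-trans (∑-single e₀ (λ j ne → ≈-trans (*-congʳ (≈-trans (*-congˡ (δ-≢ ne)) (zeroʳ _))) (zeroˡ _)))
                     (*-congʳ (≈-trans (*-congˡ (δ-refl e₀)) (*-identityʳ _)))

  -- Summation by parts. For the indicator of a vertex set only the edges of its cut survive on the
  -- right; for a constant `χ` the right side vanishes, so every boundary has total zero.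
  ∂-cut : ∀ (χ : V → Carrier) f →
    ∑ (λ v → χ v ⊛ ∂ f v) ≈ ∑ (λ e → f e ⊛ (χ (src e) ⊕ ⊖ χ (tgt e)))
  ∂-cut χ f = begin
    ∑ (λ v → χ v ⊛ ∂ f v)                   ≈⟨ ∑-cong (λ v → ⊛-∑ (χ v) (λ e → f e ⊛ ι e v)) ⟩
    ∑ (λ v → ∑ (λ e → χ v ⊛ (f e ⊛ ι e v))) ≈⟨ ∑-swap (λ v e → χ v ⊛ (f e ⊛ ι e v)) ⟩
    ∑ (λ e → ∑ (λ v → χ v ⊛ (f e ⊛ ι e v))) ≈⟨ ∑-cong edge ⟩
    ∑ (λ e → f e ⊛ (χ (src e) ⊕ ⊖ χ (tgt e))) ∎
    where
    edge : ∀ e → ∑ (λ v → χ v ⊛ (f e ⊛ ι e v)) ≈ f e ⊛ (χ (src e) ⊕ ⊖ χ (tgt e))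
    edge e = begin
      ∑ (λ v → χ v ⊛ (f e ⊛ ι e v))
        ≈⟨ ∑-cong (λ v → ≈-trans (≈-sym (*-assoc _ _ _)) (≈-trans (*-congʳ (*-comm _ _)) (*-assoc _ _ _))) ⟩
      ∑ (λ v → f e ⊛ (χ v ⊛ ι e v))     ≈⟨ ≈-sym (⊛-∑ (f e) (λ v → χ v ⊛ ι e v)) ⟩
      f e ⊛ ∑ (λ v → χ v ⊛ ι e v)       ≈⟨ *-congˡ (∑-cong (λ v → ≈-trans (distribˡ _ _ _) (+-congˡ (≈-sym (⊖-distribʳ _ _))))) ⟩
      f e ⊛ ∑ (λ v → χ v ⊛ δ (src e) v ⊕ ⊖ (χ v ⊛ δ (tgt e) v))
        ≈⟨ *-congˡ (≈-trans (∑-⊕ _ _) (+-cong (∑-δ χ (src e)) (≈-trans (∑-⊖ _) (-‿cong (∑-δ χ (tgt e)))))) ⟩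
      f e ⊛ (χ (src e) ⊕ ⊖ χ (tgt e)) ∎

  -- Summing the boundary over `X` leaves the cut, and there only `e₀`, whose coefficient is 1 or
  -- -1. Over the Booleans this says that an even set never meets a cut in exactly one edge; over
  -- `F₃` it says that the support of a flow has no bridge.
  ∂-bridge : ∀ (X : VSet) f e₀ → (∀ v → X v ≡ true → ∂ f v ≈ 0#) → crosses X e₀ ≡ true →
    (∀ e → crosses X e ≡ true → e₀ ≢ e → f e ≈ 0#) → f e₀ ≈ 0#
  ∂-bridge X f e₀ cv cr others = unit (X (src e₀)) (X (tgt e₀)) cr (≈-trans (≈-sym collapse) total)
    where
    χ : V → Carrier
    χ v = ind (X v)
    total : ∑ (λ e → f e ⊛ (χ (src e) ⊕ ⊖ χ (tgt e))) ≈ 0#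
    total = ≈-trans (≈-sym (∂-cut χ f)) (∑-0 vertex)
      where
      vertex : ∀ v → χ v ⊛ ∂ f v ≈ 0#
      vertex v with X v in eq
      ... | true  = ≈-trans (*-congˡ (cv v eq)) (zeroʳ _)
      ... | false = zeroˡ _
    same : ∀ a b → a xor b ≡ false → ind a ⊕ ⊖ ind b ≈ 0#
    same a b p rewrite xor-eq {a} {b} p = -‿inverseʳ _
    collapse : ∑ (λ e → f e ⊛ (χ (src e) ⊕ ⊖ χ (tgt e))) ≈ f e₀ ⊛ (χ (src e₀) ⊕ ⊖ χ (tgt e₀))
    collapse = ∑-single e₀ other
      where
      other : ∀ e → e₀ ≢ e → f e ⊛ (χ (src e) ⊕ ⊖ χ (tgt e)) ≈ 0#
      other e ne with split-bool (crosses X e)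
      ... | inj₁ p = ≈-trans (*-congʳ (others e p ne)) (zeroˡ _)
      ... | inj₂ p = ≈-trans (*-congˡ (same (X (src e)) (X (tgt e)) p)) (zeroʳ _)
    unit : ∀ a b → a xor b ≡ true → f e₀ ⊛ (ind a ⊕ ⊖ ind b) ≈ 0# → f e₀ ≈ 0#
    unit true false _ h = begin
      f e₀ ≈⟨ ≈-sym (*-identityʳ _) ⟩
      f e₀ ⊛ 1# ≈⟨ *-congˡ (≈-sym (≈-trans (+-congˡ -0#≈0#) (+-identityʳ _))) ⟩
      f e₀ ⊛ (1# ⊕ ⊖ 0#) ≈⟨ h ⟩
      0# ∎
    unit false true _ h = begin
      f e₀ ≈⟨ ≈-sym (-‿involutive _) ⟩
      ⊖ ⊖ f e₀ ≈⟨ -‿cong (≈-trans (-‿cong (≈-sym (*-identityʳ _))) (⊖-distribʳ _ _)) ⟩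
      ⊖ (f e₀ ⊛ (⊖ 1#)) ≈⟨ -‿cong (*-congˡ (≈-sym (+-identityˡ _))) ⟩
      ⊖ (f e₀ ⊛ (0# ⊕ ⊖ 1#)) ≈⟨ -‿cong h ⟩
      ⊖ 0# ≈⟨ -0#≈0# ⟩
      0# ∎

-- Even edge sets, degrees, walks, paths and reachability

BoolRing : CommutativeRing 0ℓ 0ℓ
BoolRing = xor-∧-commutativeRing

module Paths (G : Graph) where
  open Incidence G public
  module ∂₂ = Boundary G BoolRing
  module Σ₂ = RingSum BoolRing

  Even : ESet → Set
  Even S = ∀ v → ∂₂.∂ S v ≡ false

  _∪_ _∖_ _△_ : ∀ {k} → (Fin k → Bool) → (Fin k → Bool) → Fin k → Bool
  (S ∪ T) e = S e ∨ T e
  (S ∖ T) e = S e ∧ not (T e)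
  (S △ T) e = S e xor T e

  ⟦_⟧ : ∀ {k} → Fin k → Fin k → Bool
  ⟦ e ⟧ x = ⌊ e ≟ x ⌋

  _⊆_ : ∀ {k} → (Fin k → Bool) → (Fin k → Bool) → Set
  S ⊆ T = ∀ e → S e ≡ true → T e ≡ true

  opaque
    unfolding RingSum.∑
    odd-sumFin : ∀ {k} (f : Fin k → ℕ) → odd (sumFin f) ≡ Σ₂.∑ (odd ∘ f)
    odd-sumFin {zero}  f = refl
    odd-sumFin {suc k} f = trans (odd-+ (f zero) _) (cong (odd (f zero) xor_) (odd-sumFin (f ∘ suc)))

  ind≡ : ∀ b → Σ₂.ind b ≡ b
  ind≡ true  = refl
  ind≡ false = refl

  -- Negation in `BoolRing` is the identity, so the orientation given by `ends` disappears and the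
  -- boundary is the degree modulo 2; a loop contributes zero to both sides.
  odd-deg : ∀ S v → odd (deg G S v) ≡ ∂₂.∂ S v
  odd-deg S v = trans (odd-sumFin _) (Σ₂.∑-cong term)
    where
    term : ∀ e → odd (if S e then endCount G e v else 0) ≡ (S e ∧ (Σ₂.δ (src e) v xor Σ₂.δ (tgt e) v))
    term e with S e
    ... | false = refl
    ... | true rewrite ind≡ ⌊ src e ≟ v ⌋ | ind≡ ⌊ tgt e ≟ v ⌋ =
      trans (odd-+ (b2n ⌊ src e ≟ v ⌋) _) (cong₂ _xor_ (odd-b2n ⌊ src e ≟ v ⌋) (odd-b2n ⌊ tgt e ≟ v ⌋))

  even-△ : ∀ {S T} → Even S → Even T → Even (S △ T)
  even-△ {S} {T} p q v = trans (∂₂.∂-⊕ S T v) (cong₂ _xor_ (p v) (q v))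

  even-cong : ∀ {S T} → (∀ e → S e ≡ T e) → Even S → Even T
  even-cong h p v = trans (sym (∂₂.∂-cong h v)) (p v)

  ∖-△ : ∀ a b → (b ≡ true → a ≡ true) → a xor b ≡ a ∧ not b
  ∖-△ true  b h = refl
  ∖-△ false true h with h refl
  ... | ()
  ∖-△ false false h = refl

  even-∖ : ∀ {S T} → Even S → Even T → T ⊆ S → Even (S ∖ T)
  even-∖ {S} {T} p q sub = even-cong {S △ T} (λ e → ∖-△ (S e) (T e) (sub e)) (even-△ p q)

  even-bridge : ∀ {S} X e₀ → Even S → S e₀ ≡ true → crosses X e₀ ≡ true →
    ∃[ e ] S e ≡ true × crosses X e ≡ true × e₀ ≢ e
  even-bridge {S} X e₀ ev s cr with search (λ e → S e ∧ (crosses X e ∧ not (⟦ e₀ ⟧ e)))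
  ... | inj₁ (e , p) with ∧-true {S e} p
  ...   | p₁ , p₂ with ∧-true {crosses X e} p₂
  ...     | p₃ , p₄ = e , p₁ , p₃ , λ { refl → true≢false (trans (sym (⌊≟⌋-refl e₀)) (not-true p₄)) }
  even-bridge {S} X e₀ ev s cr | inj₂ none =
    ⊥-elim (true≢false (trans (sym s) (∂₂.∂-bridge X S e₀ (λ v _ → ev v) cr other)))
    where
    other : ∀ e → crosses X e ≡ true → e₀ ≢ e → S e ≡ false
    other e c ne with split-bool (S e)
    ... | inj₂ q = q
    ... | inj₁ q = ⊥-elim (true≢false (trans (sym (∧-intro q (∧-intro c (not-intro (⌊≟⌋-≢ ne))))) (none e)))

  endCount-at : ∀ e v → At e v → 0 < endCount G e v
  endCount-at e v (inj₁ refl) rewrite ⌊≟⌋-refl (src e) = s≤s z≤n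
  endCount-at e v (inj₂ refl) rewrite ⌊≟⌋-refl (tgt e) = m≤n+m 1 _

  endCount-off : ∀ e v → (src e ≢ v) × (tgt e ≢ v) → endCount G e v ≡ 0
  endCount-off e v (p , q) rewrite ⌊≟⌋-≢ p | ⌊≟⌋-≢ q = refl

  endCount-joins : ∀ {e u w} z → Joins G e u w → endCount G e z ≡ b2n ⌊ u ≟ z ⌋ + b2n ⌊ w ≟ z ⌋
  endCount-joins z (inj₁ (refl , refl)) = refl
  endCount-joins {e} z (inj₂ (refl , refl)) = NP.+-comm (b2n ⌊ src e ≟ z ⌋) _

  deg-cong : ∀ {S T} v → (∀ e → At e v → S e ≡ T e) → deg G S v ≡ deg G T v
  deg-cong {S} {T} v h = sumFin-cong term
    where
    term : ∀ e → (if S e then endCount G e v else 0) ≡ (if T e then endCount G e v else 0)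
    term e with at? e v
    ... | inj₁ a rewrite h e a = refl
    ... | inj₂ o rewrite endCount-off e v o with S e | T e
    ...   | true | true = refl
    ...   | true | false = refl
    ...   | false | true = refl
    ...   | false | false = refl

  deg-mono : ∀ {S T} v → S ⊆ T → deg G S v ≤ deg G T v
  deg-mono {S} {T} v h = sumFin-mono term
    where
    term : ∀ e → (if S e then endCount G e v else 0) ≤ (if T e then endCount G e v else 0)
    term e with S e in eq
    ... | false = z≤n
    ... | true rewrite h e eq = ≤-refl

  deg-∪ : ∀ {S T} v → Disjoint G S T → deg G (S ∪ T) v ≡ deg G S v + deg G T v
  deg-∪ {S} {T} v d = trans (sumFin-cong term) (sumFin-+ (λ e → if S e then endCount G e v else 0) _)
    where
    term : ∀ e → (if S e ∨ T e then endCount G e v else 0) ≡ (if S e then endCount G e v else 0) + (if T e then endCount G e v else 0)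
    term e with S e in eq
    ... | false = refl
    ... | true rewrite d e eq = sym (NP.+-identityʳ _)

  deg-⟦⟧ : ∀ e₀ v → deg G ⟦ e₀ ⟧ v ≡ endCount G e₀ v
  deg-⟦⟧ e₀ v = trans (sumFin-cong term) (trans (sumFin-* (endCount G e₀ v) (b2n ∘ ⟦ e₀ ⟧))
                 (trans (cong (endCount G e₀ v *_) (card-⌊≟⌋ e₀)) (NP.*-identityʳ _)))
    where
    term : ∀ e → (if ⟦ e₀ ⟧ e then endCount G e v else 0) ≡ endCount G e₀ v * b2n (⟦ e₀ ⟧ e)
    term e with e₀ ≟ e
    ... | yes refl = sym (NP.*-identityʳ _)
    ... | no _ = sym (NP.*-zeroʳ (endCount G e₀ v))

  deg-0 : ∀ {S} v → (∀ e → At e v → S e ≡ false) → deg G S v ≡ 0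
  deg-0 v h = trans (deg-cong {T = λ _ → false} v h) (sumFin-0 {m G})

  inc : ∀ {S} e v → S e ≡ true → At e v → Inc G S v
  inc {S} e v s a = ≤-trans lem (term≤sumFin (λ e → if S e then endCount G e v else 0) e)
    where
    lem : 0 < (if S e then endCount G e v else 0)
    lem rewrite s = endCount-at e v a

  inc→edge : ∀ {S} v → Inc G S v → ∃[ e ] S e ≡ true × At e v
  inc→edge {S} v i with sumFin-pos _ i
  ... | e , p with S e in eq | at? e v
  ...   | true | inj₁ a = e , eq , a
  ...   | true | inj₂ o = ⊥-elim (NP.<-irrefl refl (subst (0 <_) (endCount-off e v o) p))

  inc-mono : ∀ {S T} v → S ⊆ T → Inc G S v → Inc G T v
  inc-mono v h i = ≤-trans i (deg-mono v h)

  ⟦⟧-disjoint : ∀ {S} e → S e ≡ false → Disjoint G S ⟦ e ⟧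
  ⟦⟧-disjoint {S} e q x p = ⌊≟⌋-≢ λ { refl → true≢false (trans (sym p) q) }

  walk-mono : ∀ {S T u v} → S ⊆ T → Walk G S u v → Walk G T u v
  walk-mono h nil = nil
  walk-mono h (cons e s j w) = cons e (h e s) j (walk-mono h w)

  walk-++ : ∀ {S u v w} → Walk G S u v → Walk G S v w → Walk G S u w
  walk-++ nil q = q
  walk-++ (cons e s j p) q = cons e s j (walk-++ p q)

  walk-sym : ∀ {S u v} → Walk G S u v → Walk G S v u
  walk-sym nil = nil
  walk-sym (cons e s j p) = walk-++ (walk-sym p) (cons e s (joins-sym j) nil)

  closed-joins : ∀ (X : VSet) {e u w} → X (src e) ≡ X (tgt e) → Joins G e u w → X u ≡ X w
  closed-joins X h (inj₁ (refl , refl)) = h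
  closed-joins X h (inj₂ (refl , refl)) = sym h

  joins-closed : ∀ (X : VSet) {e u w} → Joins G e u w → X u ≡ X w → X (src e) ≡ X (tgt e)
  joins-closed X (inj₁ (refl , refl)) h = h
  joins-closed X (inj₂ (refl , refl)) h = sym h

  joins-crosses : ∀ (X : VSet) {e u w} → Joins G e u w → X u ≡ true → X w ≡ false → crosses X e ≡ true
  joins-crosses X (inj₁ (refl , refl)) p q rewrite p | q = refl
  joins-crosses X (inj₂ (refl , refl)) p q rewrite p | q = refl

  walk-closed : ∀ {S u v} (X : VSet) → (∀ e → S e ≡ true → X (src e) ≡ X (tgt e)) → Walk G S u v → X u ≡ X v
  walk-closed X h nil = refl
  walk-closed X h (cons e s j p) = trans (closed-joins X (h e s) j) (walk-closed X h p)

  -- Simple paths, grown at the far end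

  data Spine (u : V) : V → Set
  vis : ∀ {u v} → Spine u v → VSet

  data Spine u where
    []   : Spine u u
    snoc : ∀ {v w} (p : Spine u v) (e : E) → Joins G e v w → vis p w ≡ false → Spine u w

  vis {u} [] = ⟦ u ⟧
  vis (snoc {w = w} p _ _ _) = vis p ∪ ⟦ w ⟧

  edges : ∀ {u v} → Spine u v → ESet
  edges [] _ = false
  edges (snoc p e _ _) = edges p ∪ ⟦ e ⟧

  vis-start : ∀ {u v} (p : Spine u v) → vis p u ≡ true
  vis-start {u} [] = ⌊≟⌋-refl u
  vis-start (snoc p e j f) = ∨-introˡ (vis-start p)

  vis-end : ∀ {u v} (p : Spine u v) → vis p v ≡ true
  vis-end {u} [] = ⌊≟⌋-refl u
  vis-end {v = v} (snoc p e j f) = ∨-introʳ (⌊≟⌋-refl v)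

  edges-inside : ∀ {u v} (p : Spine u v) x → edges p x ≡ true → inside (vis p) x ≡ true
  edges-inside (snoc {v} {w} p e j f) x q with ∨-true {edges p x} q
  ... | inj₁ r = inside-mono (vis p) (vis p ∪ ⟦ w ⟧) (λ _ → ∨-introˡ) (edges-inside p x r)
  ... | inj₂ r rewrite ⌊≟⌋-true {x = e} {x} r = inside-joins (vis p ∪ ⟦ w ⟧) j (∨-introˡ (vis-end p)) (∨-introʳ {vis p w} (⌊≟⌋-refl w))

  edges-fresh : ∀ {u v} (p : Spine u v) {e w} → At e w → vis p w ≡ false → edges p e ≡ false
  edges-fresh p {e} a f with split-bool (edges p e)
  ... | inj₂ q = q
  ... | inj₁ q = ⊥-elim (true≢false (trans (sym (inside-at (vis p) (edges-inside p e q) a)) f))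

  vis-walk : ∀ {u v} (p : Spine u v) z → vis p z ≡ true → Walk G (edges p) u z
  vis-walk [] z q rewrite ⌊≟⌋-true q = nil
  vis-walk (snoc {v} {w} p e j f) z q with ∨-true {vis p z} q
  ... | inj₁ r = walk-mono (λ _ → ∨-introˡ) (vis-walk p z r)
  ... | inj₂ r rewrite sym (⌊≟⌋-true {x = w} {z} r) =
        walk-++ (walk-mono (λ _ → ∨-introˡ) (vis-walk p v (vis-end p))) (cons e (∨-introʳ (⌊≟⌋-refl e)) j nil)

  -- The degree of z in the path P together with a virtual edge joining its ends u and v.
  loopDeg : ESet → V → V → V → ℕ
  loopDeg P u v z = deg G P z + (b2n ⌊ u ≟ z ⌋ + b2n ⌊ v ≟ z ⌋)

  -- The virtual edge closes the path up, so the two ends need no separate case; for the empty path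
  -- it is a loop and gives `u` degree 2.
  spine-deg : ∀ {u v} (p : Spine u v) z → (loopDeg (edges p) u v z ≡ 0) ⊎ (loopDeg (edges p) u v z ≡ 2)
  spine-deg {u} [] z rewrite deg-0 {λ _ → false} z (λ _ _ → refl) with u ≟ z
  ... | yes _ = inj₂ refl
  ... | no _ = inj₁ refl
  spine-deg {u} (snoc {v} {w} p e j f) z
    rewrite deg-∪ {edges p} z (⟦⟧-disjoint e (edges-fresh p (proj₂ (joins→at j)) f))
          | deg-⟦⟧ e z | endCount-joins z j
    with w ≟ z
  ... | no _ = subst (λ k → (k ≡ 0) ⊎ (k ≡ 2))
                 (solve 3 (λ a b c → a :+ (b :+ c) := (a :+ (c :+ con 0)) :+ (b :+ con 0)) refl
                   (deg G (edges p) z) (b2n ⌊ u ≟ z ⌋) (b2n ⌊ v ≟ z ⌋)) (spine-deg p z)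
  ... | yes refl rewrite deg-0 {edges p} w (λ x a → edges-fresh p a f)
                       | ⌊≟⌋-≢ {x = u} {w} (λ { refl → true≢false (trans (sym (vis-start p)) f) })
                       | ⌊≟⌋-≢ {x = v} {w} (λ { refl → true≢false (trans (sym (vis-end p)) f) }) = inj₂ refl

  -- `T` collects the edges of a search tree on `Q`. That it is a tree is recorded only through the
  -- count `small`, which supplies the n - 1 of the final estimate.
  record Reach (S : ESet) (u : V) : Set where
    field
      Q      : VSet
      T      : ESet
      root   : Q u ≡ true
      T⊆S    : T ⊆ S
      small  : card T < card Q
      closed : ∀ e → S e ≡ true → Q (src e) ≡ Q (tgt e)
      spine  : ∀ v → Q v ≡ true → Σ (Spine u v) λ p → (edges p ⊆ T) × (vis p ⊆ Q)

  xor-split : ∀ {e} (X : VSet) → crosses X e ≡ true →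
    ∃[ v ] ∃[ w ] Joins G e v w × X v ≡ true × X w ≡ false
  xor-split {e} X c with X (src e) in p | X (tgt e) in q
  ... | true | false = src e , tgt e , inj₁ (refl , refl) , p , q
  ... | false | true = tgt e , src e , inj₂ (refl , refl) , q , p

  opaque
    reach : ∀ S u → Reach S u
    reach S u = grow (n G) ⟦ u ⟧ (λ _ → false) (⌊≟⌋-refl u) (λ _ ())
        (subst (card {m G} (λ _ → false) <_) (sym (card-⌊≟⌋ u)) (s≤s (≤-reflexive (sumFin-0 {m G}))))
        (m≤m+n _ _) start
      where
      SpineIn : ESet → VSet → Set
      SpineIn T Q = ∀ v → Q v ≡ true → Σ (Spine u v) λ p → (edges p ⊆ T) × (vis p ⊆ Q)
      start : SpineIn (λ _ → false) ⟦ u ⟧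
      start v q rewrite sym (⌊≟⌋-true {x = u} {v} q) = [] , (λ _ ()) , (λ _ r → r)
      grow : ∀ k Q T → Q u ≡ true → T ⊆ S → card T < card Q → n G ≤ k + card Q → SpineIn T Q → Reach S u
      grow k Q T r t c fuel sp with search (λ e → S e ∧ crosses Q e)
      ... | inj₂ none = record
        { Q = Q ; T = T ; root = r ; T⊆S = t ; small = c ; spine = sp
        ; closed = λ e s → xor-eq (cl e s) }
        where
        cl : ∀ e → S e ≡ true → crosses Q e ≡ false
        cl e s with split-bool (crosses Q e)
        ... | inj₂ x = x
        ... | inj₁ x = ⊥-elim (true≢false (trans (sym (∧-intro s x)) (none e)))
      ... | inj₁ (e , h) with ∧-true {S e} h
      ...   | s , x with xor-split Q x
      ...     | v , w , j , qv , qw = next k fuel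
        where
        Q' : VSet
        Q' = Q ∪ ⟦ w ⟧
        T' : ESet
        T' = T ∪ ⟦ e ⟧
        bigger : card Q < card Q'
        bigger = card-strict (λ _ → ∨-introˡ) w qw (∨-introʳ (⌊≟⌋-refl w))
        t' : T' ⊆ S
        t' x h with ∨-true {T x} h
        ... | inj₁ y = t x y
        ... | inj₂ y rewrite sym (⌊≟⌋-true {x = e} {x} y) = s
        c' : card T' < card Q'
        c' = ≤-<-trans (≤-trans (sumFin-mono (λ x → b2n-∨ (T x) (⟦ e ⟧ x)))
               (≤-trans (≤-reflexive (trans (sumFin-+ (b2n ∘ T) (b2n ∘ ⟦ e ⟧)) (trans (cong (card T +_) (card-⌊≟⌋ e)) (NP.+-comm (card T) 1)))) c)) bigger
        sp' : SpineIn T' Q'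
        sp' z q with split-bool (Q z)
        ... | inj₁ y = let (p , a , b) = sp z y in p , (λ x i → ∨-introˡ (a x i)) , (λ x i → ∨-introˡ (b x i))
        ... | inj₂ y with sp v qv
        ...   | p , a , b rewrite sym (⌊≟⌋-true {x = w} {z} (trans (sym (cong (_∨ ⟦ w ⟧ z) y)) q)) =
          snoc p e j fresh , (λ x i → both x i) , (λ x i → bothV x i)
          where
          fresh : vis p w ≡ false
          fresh with split-bool (vis p w)
          ... | inj₂ z = z
          ... | inj₁ z = ⊥-elim (true≢false (trans (sym (b w z)) qw))
          both : (edges p ∪ ⟦ e ⟧) ⊆ T'
          both x i with ∨-true {edges p x} i
          ... | inj₁ k = ∨-introˡ (a x k)
          ... | inj₂ k = ∨-introʳ k
          bothV : (vis p ∪ ⟦ w ⟧) ⊆ Q'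
          bothV x i with ∨-true {vis p x} i
          ... | inj₁ k = ∨-introˡ (b x k)
          ... | inj₂ k = ∨-introʳ k
        next : ∀ k → n G ≤ k + card Q → Reach S u
        next zero f = ⊥-elim (<⇒≱ bigger (≤-trans (card-≤ Q') f))
        next (suc k) f = grow k Q' T' (∨-introˡ r) t' c' (≤-trans f (subst (_≤ k + card Q') (NP.+-suc k (card Q)) (NP.+-monoʳ-≤ k bigger))) sp'

  -- Paths as edge sets inside a vertex set Z; the empty path is allowed when u = v.
  record Path (P : ESet) (u v : V) (Z : VSet) : Set where
    field
      walkTo : ∀ z → Inc G P z → Walk G P u z
      walk   : Walk G P u v
      degs   : ∀ z → (loopDeg P u v z ≡ 0) ⊎ (loopDeg P u v z ≡ 2)
      within : ∀ e → P e ≡ true → inside Z e ≡ true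
      start∈ : Z u ≡ true
      end∈   : Z v ≡ true

  spine-path : ∀ {u v} (p : Spine u v) → Path (edges p) u v (vis p)
  spine-path p = record
    { walkTo = λ z i → let (e , q , a) = inc→edge z i in vis-walk p z (inside-at (vis p) (edges-inside p e q) a)
    ; walk = vis-walk p _ (vis-end p) ; degs = spine-deg p ; within = edges-inside p
    ; start∈ = vis-start p ; end∈ = vis-end p }

  path-⊆ : ∀ {P u v Z Z'} → Z ⊆ Z' → Path P u v Z → Path P u v Z'
  path-⊆ {Z = Z} {Z'} h p = record { walkTo = walkTo ; walk = walk ; degs = degs
    ; within = λ e q → inside-mono Z Z' h (within e q)
    ; start∈ = h _ start∈ ; end∈ = h _ end∈ }
    where open Path p

  path-sym : ∀ {P u v Z} → Path P u v Z → Path P v u Z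
  path-sym {P} {u} {v} p = record
    { walkTo = λ z i → walk-++ (walk-sym walk) (walkTo z i) ; walk = walk-sym walk
    ; degs = λ z → subst (λ k → (deg G P z + k ≡ 0) ⊎ (deg G P z + k ≡ 2)) (NP.+-comm (b2n ⌊ u ≟ z ⌋) _) (degs z)
    ; within = within ; start∈ = end∈ ; end∈ = start∈ }
    where open Path p

  Inc-within : ∀ {P u v Z} → Path P u v Z → ∀ z → Inc G P z → Z z ≡ true
  Inc-within {Z = Z} p z i = let (e , q , a) = inc→edge z i in inside-at Z (Path.within p e q) a

  deg-outside : ∀ {P u v Z} → Path P u v Z → ∀ z → Z z ≡ false → deg G P z ≡ 0
  deg-outside {P} {Z = Z} p z f = deg-0 {P} z off
    where
    off : ∀ e → At e z → P e ≡ false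
    off e a with split-bool (P e)
    ... | inj₂ q = q
    ... | inj₁ q = ⊥-elim (true≢false (trans (sym (inside-at Z (Path.within p e q) a)) f))

  ∪-⊆ˡ : ∀ {k} {A B : Fin k → Bool} → A ⊆ (A ∪ B)
  ∪-⊆ˡ _ = ∨-introˡ
  ∪-⊆ʳ : ∀ {k} {A B : Fin k → Bool} → B ⊆ (A ∪ B)
  ∪-⊆ʳ _ = ∨-introʳ

-- Concatenating paths, closing them to cycles, cycles versus cuts

module Cycles (G : Graph) (loopless : Loopless G) where
  open Paths G public

  -- An edge in both pieces would have both ends at `x` and be a loop. At `x` the virtual ends of
  -- both pieces disappear, and each piece then contributes one, counting its other virtual end if
  -- that is `x` too; elsewhere only one piece is present.
  path-++ : ∀ {P Q u x v Y Z} → Path P u x Y → Path Q x v Z →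
    (∀ z → Y z ≡ true → Z z ≡ true → z ≡ x) → Disjoint G P Q × Path (P ∪ Q) u v (Y ∪ Z)
  path-++ {P} {Q} {u} {x} {v} {Y} {Z} p q meet = dis , record
    { walkTo = to ; walk = walk-++ (walk-mono ∪-⊆ˡ p.walk) (walk-mono ∪-⊆ʳ q.walk)
    ; degs = dg ; within = win ; start∈ = ∨-introˡ p.start∈ ; end∈ = ∨-introʳ q.end∈ }
    where
    module p = Path p
    module q = Path q
    dis : Disjoint G P Q
    dis e i with split-bool (Q e)
    ... | inj₂ k = k
    ... | inj₁ k = ⊥-elim (loopless e (trans (only (src e) (inj₁ refl)) (sym (only (tgt e) (inj₂ refl)))))
      where
      only : ∀ z → At e z → z ≡ x
      only z a = meet z (inside-at Y (p.within e i) a) (inside-at Z (q.within e k) a)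
    to : ∀ z → Inc G (P ∪ Q) z → Walk G (P ∪ Q) u z
    to z i with inc→edge z i
    ... | e , s , a with ∨-true {P e} s
    ...   | inj₁ k = walk-mono ∪-⊆ˡ (p.walkTo z (inc e z k a))
    ...   | inj₂ k = walk-++ (walk-mono ∪-⊆ˡ p.walk) (walk-mono ∪-⊆ʳ (q.walkTo z (inc e z k a)))
    win : ∀ e → (P ∪ Q) e ≡ true → inside (Y ∪ Z) e ≡ true
    win e s with ∨-true {P e} s
    ... | inj₁ k = inside-mono Y (Y ∪ Z) (λ _ → ∨-introˡ) (p.within e k)
    ... | inj₂ k = inside-mono Z (Y ∪ Z) (λ z → ∨-introʳ {Y z}) (q.within e k)
    dg : ∀ z → (loopDeg (P ∪ Q) u v z ≡ 0) ⊎ (loopDeg (P ∪ Q) u v z ≡ 2)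
    dg z rewrite deg-∪ {P} {Q} z dis with split-bool (Y z) | split-bool (Z z)
    ... | inj₁ y | inj₁ w rewrite meet z y w = at-x (p.degs x) (q.degs x)
      where
      at-x : (loopDeg P u x x ≡ 0) ⊎ (loopDeg P u x x ≡ 2) → (loopDeg Q x v x ≡ 0) ⊎ (loopDeg Q x v x ≡ 2) →
             (deg G P x + deg G Q x + (b2n ⌊ u ≟ x ⌋ + b2n ⌊ v ≟ x ⌋) ≡ 0) ⊎ (deg G P x + deg G Q x + (b2n ⌊ u ≟ x ⌋ + b2n ⌊ v ≟ x ⌋) ≡ 2)
      at-x a b rewrite ⌊≟⌋-refl x = inj₂ (go (deg G P x) (b2n ⌊ u ≟ x ⌋) (deg G Q x) (b2n ⌊ v ≟ x ⌋) a b)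
        where
        one : ∀ k l → (k + (l + 1) ≡ 0) ⊎ (k + (l + 1) ≡ 2) → k + l ≡ 1
        one k l (inj₁ h) rewrite NP.+-comm l 1 | NP.+-suc k l with h
        ... | ()
        one k l (inj₂ h) rewrite NP.+-comm l 1 | NP.+-suc k l = NP.suc-injective h
        go : ∀ d l d' l' → (d + (l + 1) ≡ 0) ⊎ (d + (l + 1) ≡ 2) → (d' + (1 + l') ≡ 0) ⊎ (d' + (1 + l') ≡ 2) → d + d' + (l + l') ≡ 2
        go d l d' l' a b = trans
          (solve 4 (λ d l d' l' → d :+ d' :+ (l :+ l') := (d :+ l) :+ (d' :+ l')) refl d l d' l')
          (cong₂ _+_ (one d l a) (one d' l' (subst (λ k → (d' + k ≡ 0) ⊎ (d' + k ≡ 2)) (NP.+-comm 1 l') b)))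
    ... | inj₁ y | inj₂ w
      rewrite deg-outside q z w | ⌊≟⌋-≢ {x = v} {z} (λ { refl → true≢false (trans (sym q.end∈) w) })
      = subst (λ k → (k ≡ 0) ⊎ (k ≡ 2)) (trans (cong (λ k → deg G P z + (b2n ⌊ u ≟ z ⌋ + b2n k)) (⌊≟⌋-≢ {x = x} {z} (λ { refl → true≢false (trans (sym q.start∈) w) })))
                                          (cong (_+ (b2n ⌊ u ≟ z ⌋ + 0)) (sym (NP.+-identityʳ (deg G P z))))) (p.degs z)
    ... | inj₂ y | inj₁ w
      rewrite deg-outside p z y | ⌊≟⌋-≢ {x = u} {z} (λ { refl → true≢false (trans (sym p.start∈) y) })
      = subst (λ k → (k ≡ 0) ⊎ (k ≡ 2)) (cong (λ k → deg G Q z + (b2n k + b2n ⌊ v ≟ z ⌋)) (⌊≟⌋-≢ {x = x} {z} (λ { refl → true≢false (trans (sym p.end∈) y) }))) (q.degs z)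
    ... | inj₂ y | inj₂ w
      rewrite deg-outside p z y | deg-outside q z w
            | ⌊≟⌋-≢ {x = u} {z} (λ { refl → true≢false (trans (sym p.start∈) y) })
            | ⌊≟⌋-≢ {x = v} {z} (λ { refl → true≢false (trans (sym q.end∈) w) }) = inj₁ refl

  edge-path : ∀ {e u w} → Joins G e u w → Path ⟦ e ⟧ u w (⟦ u ⟧ ∪ ⟦ w ⟧)
  edge-path {e} j = spine-path (snoc [] e j (⌊≟⌋-≢ (loop j)))
    where
    loop : ∀ {u w} → Joins G e u w → u ≢ w
    loop (inj₁ (refl , refl)) p = loopless e p
    loop (inj₂ (refl , refl)) p = loopless e (sym p)

  close-path : ∀ {P u v Z e} → Path P u v Z → Joins G e v u → P e ≡ false → IsCycle G (P ∪ ⟦ e ⟧)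
  close-path {P} {u} {v} {Z} {e} p j f =
    (e , ∨-introʳ (⌊≟⌋-refl e)) , (λ x y ix iy → walk-++ (walk-sym (from x ix)) (from y iy)) , dg
    where
    open Path p
    from : ∀ x → Inc G (P ∪ ⟦ e ⟧) x → Walk G (P ∪ ⟦ e ⟧) u x
    from x i with inc→edge x i
    ... | e' , s , a with ∨-true {P e'} s
    ...   | inj₁ k = walk-mono ∪-⊆ˡ (walkTo x (inc e' x k a))
    ...   | inj₂ k rewrite sym (⌊≟⌋-true {x = e} {e'} k) with joins-ends j a
    ...     | inj₁ refl = walk-mono ∪-⊆ˡ walk
    ...     | inj₂ refl = nil
    dg : ∀ z → (deg G (P ∪ ⟦ e ⟧) z ≡ 0) ⊎ (deg G (P ∪ ⟦ e ⟧) z ≡ 2)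
    dg z rewrite deg-∪ {P} z (⟦⟧-disjoint e f) | deg-⟦⟧ e z | endCount-joins z (joins-sym j) = degs z

  cycle-even : ∀ {C} → IsCycle G C → Even C
  cycle-even {C} (_ , _ , d) v with d v
  ... | inj₁ p = trans (sym (odd-deg C v)) (cong odd p)
  ... | inj₂ p = trans (sym (odd-deg C v)) (cong odd p)

  record CycleThrough (S : ESet) (e₀ : E) : Set where
    field
      path   : Spine (src e₀) (tgt e₀)
      path⊆S : edges path ⊆ S
      e₀∉    : edges path e₀ ≡ false
    D : ESet
    D = edges path ∪ ⟦ e₀ ⟧
    isCycle : IsCycle G D
    isCycle = close-path (spine-path path) (inj₂ (refl , refl)) e₀∉
    D⊆ : S e₀ ≡ true → D ⊆ S
    D⊆ s e d with ∨-true {edges path e} d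
    ... | inj₁ p = path⊆S e p
    ... | inj₂ p rewrite sym (⌊≟⌋-true {x = e₀} {e} p) = s
    e₀∈ : D e₀ ≡ true
    e₀∈ = ∨-introʳ (⌊≟⌋-refl e₀)

  opaque
    -- Search from one end of `e₀` with `e₀` removed: either the other end is reached, or the
    -- reached set defines a cut in which `S` has no edge but possibly `e₀`.
    cycle-or-cut : ∀ S e₀ → CycleThrough S e₀ ⊎
      (∃[ X ] crosses X e₀ ≡ true × (∀ e → S e ≡ true → crosses X e ≡ true → e₀ ≡ e))
    cycle-or-cut S e₀ with reach (S ∖ ⟦ e₀ ⟧) (src e₀)
    ... | r with split-bool (Reach.Q r (tgt e₀))
    ...   | inj₁ q with Reach.spine r (tgt e₀) q
    ...     | p , t , _ = inj₁ record
      { path = p ; path⊆S = λ e i → proj₁ (∧-true (Reach.T⊆S r e (t e i))) ; e₀∉ = miss }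
      where
      miss : edges p e₀ ≡ false
      miss with split-bool (edges p e₀)
      ... | inj₂ k = k
      ... | inj₁ k = ⊥-elim (true≢false (trans (sym (⌊≟⌋-refl e₀)) (not-true (proj₂ (∧-true {S e₀} (Reach.T⊆S r e₀ (t e₀ k)))))))
    cycle-or-cut S e₀ | r | inj₂ q = inj₂ (Reach.Q r , cr , only)
      where
      cr : crosses (Reach.Q r) e₀ ≡ true
      cr rewrite Reach.root r | q = refl
      only : ∀ e → S e ≡ true → crosses (Reach.Q r) e ≡ true → e₀ ≡ e
      only e s c with e₀ ≟ e
      ... | yes p = p
      ... | no ne = ⊥-elim (true≢false (trans (sym c) (trans (cong (_xor Reach.Q r (tgt e)) (Reach.closed r e (∧-intro s (not-intro (⌊≟⌋-≢ ne))))) (xor-same (Reach.Q r (tgt e))))))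

  opaque
    cycle-through : ∀ {S} → Even S → ∀ e₀ → S e₀ ≡ true → CycleThrough S e₀
    cycle-through {S} ev e₀ s with cycle-or-cut S e₀
    ... | inj₁ c = c
    ... | inj₂ (X , c , only) with even-bridge X e₀ ev s c
    ...   | e , p , q , ne = ⊥-elim (ne (only e p q))

-- The field with three elements

pattern 0F = zero
pattern 1F = suc zero
pattern 2F = suc (suc zero)

F₃ : Set
F₃ = Fin 3

infixl 6 _+₃_
infixl 7 _*₃_

_+₃_ _*₃_ : F₃ → F₃ → F₃
0F +₃ y  = y
1F +₃ 0F = 1F
1F +₃ 1F = 2F
1F +₃ 2F = 0F
2F +₃ 0F = 2F
2F +₃ 1F = 0F
2F +₃ 2F = 1F
0F *₃ _  = 0F
1F *₃ y  = y
2F *₃ 0F = 0F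
2F *₃ 1F = 2F
2F *₃ 2F = 1F

-₃_ : F₃ → F₃
-₃ 0F = 0F
-₃ 1F = 2F
-₃ 2F = 1F

F₃Ring : CommutativeRing 0ℓ 0ℓ
F₃Ring = record
  { Carrier = F₃ ; _≈_ = _≡_ ; _+_ = _+₃_ ; _*_ = _*₃_ ; -_ = -₃_ ; 0# = 0F ; 1# = 1F
  ; isCommutativeRing = record
    { isRing = record
      { +-isAbelianGroup = record
        { isGroup = record
          { isMonoid = record
            { isSemigroup = record
              { isMagma = record { isEquivalence = isEquivalence ; ∙-cong = cong₂ _+₃_ }
              ; assoc = from-yes (all? λ x → all? λ y → all? λ z → (x +₃ y) +₃ z ≟ x +₃ (y +₃ z)) }
            ; identity = (λ _ → refl) , from-yes (all? λ x → x +₃ 0F ≟ x) }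
          ; inverse = from-yes (all? λ x → (-₃ x) +₃ x ≟ 0F) , from-yes (all? λ x → x +₃ (-₃ x) ≟ 0F)
          ; ⁻¹-cong = cong -₃_ }
        ; comm = from-yes (all? λ x → all? λ y → x +₃ y ≟ y +₃ x) }
      ; *-cong = cong₂ _*₃_
      ; *-assoc = from-yes (all? λ x → all? λ y → all? λ z → (x *₃ y) *₃ z ≟ x *₃ (y *₃ z))
      ; *-identity = (λ _ → refl) , from-yes (all? λ x → x *₃ 1F ≟ x)
      ; distrib = from-yes (all? λ x → all? λ y → all? λ z → x *₃ (y +₃ z) ≟ (x *₃ y) +₃ (x *₃ z))
                , from-yes (all? λ x → all? λ y → all? λ z → (y +₃ z) *₃ x ≟ (y *₃ x) +₃ (z *₃ x)) }
    ; *-comm = from-yes (all? λ x → all? λ y → x *₃ y ≟ y *₃ x) } }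

opaque
  -- A sum of two non-zero elements takes every value (1+1, 1+2, 2+2), a single non-zero element
  -- misses 0. This is why the 6-flow induction needs two edges leaving a vertex set.
  balance₃ : ∀ F a b → a ≢ 0F → b ≢ 0F → ∃[ x ] ∃[ y ] x ≢ 0F × y ≢ 0F × F +₃ (x *₃ a +₃ y *₃ b) ≡ 0F
  balance₃ = from-yes (all? {3} λ F → all? {3} λ a → all? {3} λ b →
    ¬? (a ≟ 0F) →-dec (¬? (b ≟ 0F) →-dec any? {3} λ x → any? {3} λ y →
      ¬? (x ≟ 0F) ×-dec (¬? (y ≟ 0F) ×-dec (F +₃ (x *₃ a +₃ y *₃ b) ≟ 0F))))

  -- Lets flows on the two sides of a bridge be matched by negating one of them.
  ±₃ : ∀ a b → a ≢ 0F → b ≢ 0F → a ≡ b ⊎ a ≡ -₃ b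
  ±₃ = from-yes (all? {3} λ a → all? {3} λ b → ¬? (a ≟ 0F) →-dec (¬? (b ≟ 0F) →-dec ((a ≟ b) ⊎-dec (a ≟ -₃ b))))

search-⊎ : ∀ {k} {P Q : Fin k → Set} → (∀ i → P i ⊎ Q i) → (∀ i → P i) ⊎ ∃ Q
search-⊎ {zero}  h = inj₁ λ ()
search-⊎ {suc k} h with h zero | search-⊎ (h ∘ suc)
... | inj₂ q | _ = inj₂ (zero , q)
... | inj₁ p | inj₂ (i , q) = inj₂ (suc i , q)
... | inj₁ p | inj₁ f = inj₁ λ { zero → p ; (suc i) → f i }

size-++ : ∀ (G : Graph) A B → coverLength G (A ++ B) ≡ coverLength G A + coverLength G B
size-++ G A B = trans (cong sum (map-++ (size G) A B)) (sum-++ (map (size G) A) (map (size G) B))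

-- Decomposing an even edge set into cycles

module Decomposition (G : Graph) (loopless : Loopless G) where
  open Cycles G loopless public

  record CycleList (C : ESet) : Set where
    field
      list   : List ESet
      cycles : All (λ D → IsCycle G D × D ⊆ C) list
      covers : ∀ e → C e ≡ true → Any (λ D → D e ≡ true) list
      length : coverLength G list ≤ size G C

  opaque
    cycle-list : ∀ {C} → Even C → CycleList C
    cycle-list {C} = go (m G) C (card-≤ C)
      where
      go : ∀ k C → card C ≤ k → Even C → CycleList C
      go k C le ev with search C
      ... | inj₂ none = record { list = [] ; cycles = [] ; covers = λ e s → ⊥-elim (true≢false (trans (sym s) (none e))) ; length = z≤n }
      ... | inj₁ (e₀ , s) = step k le
        where
        open CycleThrough (cycle-through ev e₀ s)
        D⊆C : D ⊆ C
        D⊆C = D⊆ s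
        smaller : card (C ∖ D) < card C
        smaller = card-strict (λ e p → proj₁ (∧-true p)) e₀ (trans (cong (λ b → C e₀ ∧ not b) e₀∈) (∧-zeroʳ (C e₀))) s
        step : ∀ k → card C ≤ k → CycleList C
        step zero le = ⊥-elim (<⇒≱ smaller (≤-trans le z≤n))
        step (suc k) le = record
          { list = D ∷ list
          ; cycles = (isCycle , D⊆C) ∷ All.map (λ (c , h) → c , λ e p → proj₁ (∧-true (h e p))) cycles
          ; covers = cov
          ; length = ≤-trans (NP.+-monoʳ-≤ (size G D) length)
              (card-⊎ (λ e d → D⊆C e d , trans (cong (λ b → C e ∧ not b) d) (∧-zeroʳ (C e))) (λ e p → proj₁ (∧-true p))) }
          where
          open CycleList (go k (C ∖ D) (s≤s⁻¹ (≤-trans smaller le)) (even-∖ ev (cycle-even isCycle) D⊆C))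
          cov : ∀ e → C e ≡ true → Any (λ D → D e ≡ true) (D ∷ list)
          cov e c = cases (D e) here (λ d → there (covers e (∧-intro c (not-intro d))))

-- Ring-valued flows along paths and cycles

module Flow (G : Graph) (loopless : Loopless G) (R : CommutativeRing 0ℓ 0ℓ) where
  open Cycles G loopless
  open RingSum R public
  open Boundary G R public

  -- `ι` counts the source positively, so a forward step gets -1; this makes the boundary of a path
  -- from `u` to `v` equal to `δ v` minus `δ u`.
  sign : ∀ {e v w} → Joins G e v w → Carrier
  sign (inj₁ _) = ⊖ 1#
  sign (inj₂ _) = 1#

  flow : ∀ {u v} → Spine u v → E → Carrier
  flow [] x = 0#
  flow (snoc p e j _) x = flow p x ⊕ (sign j ⊛ δ e x)

  sign-ι : ∀ {e v w} (j : Joins G e v w) z → sign j ⊛ ι e z ≈ δ w z ⊕ ⊖ δ v z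
  sign-ι {e} (inj₁ (refl , refl)) z = begin
    ⊖ 1# ⊛ ι e z ≈⟨ ≈-sym (⊖-distribˡ 1# (ι e z)) ⟩
    ⊖ (1# ⊛ ι e z) ≈⟨ -‿cong (*-identityˡ _) ⟩
    ⊖ (δ (src e) z ⊕ ⊖ δ (tgt e) z) ≈⟨ ≈-sym (⊖-⊕ _ _) ⟩
    ⊖ δ (src e) z ⊕ ⊖ ⊖ δ (tgt e) z ≈⟨ +-congˡ (-‿involutive _) ⟩
    ⊖ δ (src e) z ⊕ δ (tgt e) z ≈⟨ +-comm _ _ ⟩
    δ (tgt e) z ⊕ ⊖ δ (src e) z ∎
  sign-ι (inj₂ (refl , refl)) z = *-identityˡ _

  telescope : ∀ a b c → (b ⊕ ⊖ a) ⊕ (c ⊕ ⊖ b) ≈ c ⊕ ⊖ a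
  telescope a b c = begin
    (b ⊕ ⊖ a) ⊕ (c ⊕ ⊖ b) ≈⟨ +-cong (+-comm b (⊖ a)) (+-comm c (⊖ b)) ⟩
    (⊖ a ⊕ b) ⊕ (⊖ b ⊕ c) ≈⟨ +-assoc _ _ _ ⟩
    ⊖ a ⊕ (b ⊕ (⊖ b ⊕ c)) ≈⟨ +-congˡ (≈-sym (+-assoc _ _ _)) ⟩
    ⊖ a ⊕ ((b ⊕ ⊖ b) ⊕ c) ≈⟨ +-congˡ (+-congʳ (-‿inverseʳ b)) ⟩
    ⊖ a ⊕ (0# ⊕ c) ≈⟨ +-congˡ (+-identityˡ c) ⟩
    ⊖ a ⊕ c ≈⟨ +-comm _ _ ⟩
    c ⊕ ⊖ a ∎

  ∂-flow : ∀ {u v} (p : Spine u v) z → ∂ (flow p) z ≈ δ v z ⊕ ⊖ δ u z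
  ∂-flow [] z = ≈-trans (∂-0 z (λ _ _ → ≈-refl)) (≈-sym (-‿inverseʳ _))
  ∂-flow (snoc p e j f) z = ≈-trans (∂-⊕ (flow p) (λ x → sign j ⊛ δ e x) z)
    (≈-trans (+-cong (∂-flow p z) (≈-trans (∂-single e (sign j) z) (sign-ι j z))) (telescope _ _ _))

  Unit : Carrier → Set
  Unit x = x ≈ 1# ⊎ x ≈ ⊖ 1#

  UnitOn : ESet → (E → Carrier) → Set
  UnitOn S f = ∀ e → (S e ≡ true → Unit (f e)) × (S e ≡ false → f e ≈ 0#)

  unit-cong : ∀ {x y} → x ≈ y → Unit y → Unit x
  unit-cong h (inj₁ p) = inj₁ (≈-trans h p)
  unit-cong h (inj₂ p) = inj₂ (≈-trans h p)

  +0 : ∀ {x y} → y ≈ 0# → x ⊕ y ≈ x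
  +0 h = ≈-trans (+-congˡ h) (+-identityʳ _)

  0+ : ∀ {x y} → x ≈ 0# → x ⊕ y ≈ y
  0+ h = ≈-trans (+-congʳ h) (+-identityˡ _)

  unitOn-⊕ : ∀ {S T f g} → Disjoint G S T → UnitOn S f → UnitOn T g → UnitOn (S ∪ T) (λ e → f e ⊕ g e)
  unitOn-⊕ {S} {T} d p q e with split-bool (S e)
  ... | inj₁ s = (λ _ → unit-cong (+0 (proj₂ (q e) (d e s))) (proj₁ (p e) s))
               , (λ z → ⊥-elim (true≢false (trans (sym s) (proj₁ (∨-false {S e} z)))))
  ... | inj₂ s = (λ z → unit-cong (0+ (proj₂ (p e) s)) (proj₁ (q e) (trans (sym (cong (_∨ T e) s)) z)))
               , (λ z → ≈-trans (0+ (proj₂ (p e) s)) (proj₂ (q e) (proj₂ (∨-false {S e} z))))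

  unitOn-single : ∀ c e₀ → Unit c → UnitOn ⟦ e₀ ⟧ (λ e → c ⊛ δ e₀ e)
  unitOn-single c e₀ u e with e₀ ≟ e
  ... | yes _ = (λ _ → unit-cong (*-identityʳ c) u) , λ ()
  ... | no _ = (λ ()) , (λ _ → zeroʳ c)

  sign-unit : ∀ {e v w} (j : Joins G e v w) → Unit (sign j)
  sign-unit (inj₁ _) = inj₂ ≈-refl
  sign-unit (inj₂ _) = inj₁ ≈-refl

  flow-unit : ∀ {u v} (p : Spine u v) → UnitOn (edges p) (flow p)
  flow-unit [] e = (λ ()) , (λ _ → ≈-refl)
  flow-unit (snoc p e j f) = unitOn-⊕ (⟦⟧-disjoint e (edges-fresh p (proj₂ (joins→at j)) f)) (flow-unit p)
    (unitOn-single (sign j) e (sign-unit j))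

  module _ {S e₀} (c : CycleThrough S e₀) where
    open CycleThrough c
    circulation : E → Carrier
    circulation e = flow path e ⊕ (1# ⊛ δ e₀ e)
    circulation-∂ : ∀ z → ∂ circulation z ≈ 0#
    circulation-∂ z = ≈-trans (∂-⊕ (flow path) (λ e → 1# ⊛ δ e₀ e) z)
      (≈-trans (+-cong (∂-flow path z) (≈-trans (∂-single e₀ 1# z) (*-identityˡ _)))
        (≈-trans (telescope _ _ _) (-‿inverseʳ _)))
    circulation-unit : UnitOn D circulation
    circulation-unit = unitOn-⊕ (⟦⟧-disjoint e₀ e₀∉) (flow-unit path) (unitOn-single 1# e₀ (inj₁ ≈-refl))

  opaque
    orient : ∀ {C} → Even C → ∃[ g ] (∀ v → ∂ g v ≈ 0#) × UnitOn C g
    orient {C} = go (m G) C (card-≤ C)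
      where
      go : ∀ k C → card C ≤ k → Even C → ∃[ g ] (∀ v → ∂ g v ≈ 0#) × UnitOn C g
      go k C le ev with search C
      ... | inj₂ none = (λ _ → 0#) , (λ v → ∂-0 v (λ _ _ → ≈-refl))
                      , (λ e → (λ s → ⊥-elim (true≢false (trans (sym s) (none e)))) , (λ _ → ≈-refl))
      ... | inj₁ (e₀ , s) = step k le
        where
        ct : CycleThrough C e₀
        ct = cycle-through ev e₀ s
        open CycleThrough ct
        smaller : card (C ∖ D) < card C
        smaller = card-strict (λ e p → proj₁ (∧-true p)) e₀ (trans (cong (λ b → C e₀ ∧ not b) e₀∈) (∧-zeroʳ (C e₀))) s
        step : ∀ k → card C ≤ k → ∃[ g ] (∀ v → ∂ g v ≈ 0#) × UnitOn C g
        step zero le = ⊥-elim (<⇒≱ smaller (≤-trans le z≤n))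
        step (suc k) le with go k (C ∖ D) (s≤s⁻¹ (≤-trans smaller le)) (even-∖ ev (cycle-even isCycle) (D⊆ s))
        ... | g , cv , un = (λ e → circulation ct e ⊕ g e)
            , (λ v → ≈-trans (∂-⊕ (circulation ct) g v) (≈-trans (0+ (circulation-∂ ct v)) (cv v)))
            , (λ e → subst (λ b → (b ≡ true → Unit (circulation ct e ⊕ g e)) × (b ≡ false → circulation ct e ⊕ g e ≈ 0#)) (union e)
                 (unitOn-⊕ {D} {C ∖ D} (λ e d → trans (cong (λ b → C e ∧ not b) d) (∧-zeroʳ (C e))) (circulation-unit ct) un e))
          where
          union : ∀ e → (D ∪ (C ∖ D)) e ≡ C e
          union e = cases (D e)
            (λ d → trans (∨-introˡ {b = (C ∖ D) e} d) (sym (D⊆ s e d)))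
            (λ d → trans (cong (λ b → b ∨ (C e ∧ not b)) d) (∧-identityʳ (C e)))

  opaque
    -- Send `c v` units from `q₀` to each `v`; what accumulates at `q₀` is the total of `c`, which
    -- is zero. Over `F₃` this repairs a flow along a cycle; over the Booleans it yields a subset of
    -- a spanning tree with prescribed odd vertices.
    push : ∀ S (Q : VSet) q₀ → (∀ v → Q v ≡ true → Σ (Spine q₀ v) λ p → edges p ⊆ S) →
      ∀ (c : V → Carrier) → (∀ v → Q v ≡ false → c v ≈ 0#) → ∑ c ≈ 0# →
      ∃[ g ] (∀ e → S e ≡ false → g e ≈ 0#) × (∀ v → ∂ g v ≈ c v)
    push S Q q₀ sp c off tot = g , sup , bd
      where
      route : V → E → Carrier
      route v e with split-bool (Q v)
      ... | inj₁ q = flow (proj₁ (sp v q)) e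
      ... | inj₂ _ = 0#
      route-sup : ∀ v e → S e ≡ false → route v e ≈ 0#
      route-sup v e s with split-bool (Q v)
      ... | inj₂ _ = ≈-refl
      ... | inj₁ q = proj₂ (flow-unit (proj₁ (sp v q)) e) miss
        where
        miss : edges (proj₁ (sp v q)) e ≡ false
        miss with split-bool (edges (proj₁ (sp v q)) e)
        ... | inj₂ k = k
        ... | inj₁ k = ⊥-elim (true≢false (trans (sym (proj₂ (sp v q) e k)) s))
      route-∂ : ∀ v z → c v ⊛ ∂ (route v) z ≈ (c v ⊛ δ v z) ⊕ ⊖ (c v ⊛ δ q₀ z)
      route-∂ v z with split-bool (Q v)
      ... | inj₁ q = ≈-trans (*-congˡ (∂-flow (proj₁ (sp v q)) z)) (≈-trans (distribˡ _ _ _) (+-congˡ (≈-sym (⊖-distribʳ _ _))))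
      ... | inj₂ q = ≈-trans (≈-trans (*-congʳ (off v q)) (zeroˡ _))
        (≈-sym (≈-trans (+-cong (≈-trans (*-congʳ (off v q)) (zeroˡ _)) (≈-trans (-‿cong (≈-trans (*-congʳ (off v q)) (zeroˡ _))) -0#≈0#)) (+-identityˡ 0#)))
      g : E → Carrier
      g e = ∑ (λ v → c v ⊛ route v e)
      sup : ∀ e → S e ≡ false → g e ≈ 0#
      sup e s = ∑-0 (λ v → ≈-trans (*-congˡ (route-sup v e s)) (zeroʳ _))
      bd : ∀ z → ∂ g z ≈ c z
      bd z = begin
        ∂ g z ≈⟨ ∂-∑ (λ v e → c v ⊛ route v e) z ⟩
        ∑ (λ v → ∂ (λ e → c v ⊛ route v e) z) ≈⟨ ∑-cong (λ v → ≈-trans (∂-⊛ (c v) (route v) z) (route-∂ v z)) ⟩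
        ∑ (λ v → (c v ⊛ δ v z) ⊕ ⊖ (c v ⊛ δ q₀ z)) ≈⟨ ∑-⊕ _ _ ⟩
        ∑ (λ v → c v ⊛ δ v z) ⊕ ∑ (λ v → ⊖ (c v ⊛ δ q₀ z))
          ≈⟨ +-cong (≈-trans (∑-single z (λ j ne → ≈-trans (*-congˡ (δ-≢ (λ p → ne (sym p)))) (zeroʳ _))) (≈-trans (*-congˡ (δ-refl z)) (*-identityʳ _)))
                    (≈-trans (∑-⊖ _) (-‿cong (≈-sym (∑-⊛ (δ q₀ z) c)))) ⟩
        c z ⊕ ⊖ (∑ c ⊛ δ q₀ z) ≈⟨ +0 (≈-trans (-‿cong (≈-trans (*-congʳ tot) (zeroˡ _))) -0#≈0#) ⟩
        c z ∎

-- Maximum degree three: even sets, and two vertices on a common cycle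

module Subcubic (G : Graph) (loopless : Loopless G)
                (deg≤3 : MaxDegree3 G) where
  open Decomposition G loopless public

  -- In maximum degree three an even set is therefore a vertex-disjoint union of cycles.
  even-deg : ∀ {S} → Even S → ∀ v → (deg G S v ≡ 0) ⊎ (deg G S v ≡ 2)
  even-deg {S} ev v = small (deg G S v) (≤-trans (deg-mono v (λ _ _ → refl)) (deg≤3 v)) (trans (odd-deg S v) (ev v))
    where
    small : ∀ d → d ≤ 3 → odd d ≡ false → (d ≡ 0) ⊎ (d ≡ 2)
    small 0 _ _ = inj₁ refl
    small 2 _ _ = inj₂ refl
    small (suc (suc (suc (suc _)))) (s≤s (s≤s (s≤s ()))) _

  even-deg≤2 : ∀ {S} → Even S → ∀ v → deg G S v ≤ 2
  even-deg≤2 ev v with even-deg ev v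
  ... | inj₁ p rewrite p = z≤n
  ... | inj₂ p rewrite p = ≤-refl

  even-inc : ∀ {S} → Even S → ∀ v → Inc G S v → deg G S v ≡ 2
  even-inc ev v i with even-deg ev v
  ... | inj₁ p = ⊥-elim (NP.<-irrefl refl (subst (0 <_) p i))
  ... | inj₂ p = p

  pos? : ℕ → Bool
  pos? zero    = false
  pos? (suc _) = true

  opaque
    verts : ESet → VSet
    verts S v = pos? (deg G S v)

    verts→inc : ∀ S v → verts S v ≡ true → Inc G S v
    verts→inc S v p with deg G S v
    ... | suc _ = s≤s z≤n

    inc→verts : ∀ S v → Inc G S v → verts S v ≡ true
    inc→verts S v i with deg G S v
    inc→verts S v (s≤s z≤n) | suc _ = refl

  off-verts : ∀ S {e v} → verts S v ≡ false → At e v → S e ≡ false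
  off-verts S {e} {v} f a = cases (S e)
    (λ s → ⊥-elim (true≢false (trans (sym (inc→verts S v (inc e v s a))) f))) (λ q → q)

  edge-verts : ∀ S {e v} → S e ≡ true → At e v → verts S v ≡ true
  edge-verts S {e} {v} s a = inc→verts S v (inc e v s a)

  saturated : ∀ {X D : ESet} v → X ⊆ D → Even X → Even D → Inc G X v → ∀ d → D d ≡ true → At d v → X d ≡ true
  saturated {X} {D} v sub evX evD i d dd a = cases (X d) (λ x → x) λ x → ⊥-elim (NP.<-irrefl refl (contra x))
    where
    dis : Disjoint G X (D ∖ X)
    dis e q = trans (cong (λ b → D e ∧ not b) q) (∧-zeroʳ (D e))
    total : deg G X v + deg G (D ∖ X) v ≤ 2
    total = subst (_≤ 2) (trans (deg-cong {D} {X ∪ (D ∖ X)} v (λ e _ → union e)) (deg-∪ {X} {D ∖ X} v dis)) (even-deg≤2 evD v)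
      where
      union : ∀ e → D e ≡ (X ∪ (D ∖ X)) e
      union e = cases (X e) (λ x → trans (sub e x) (sym (∨-introˡ {b = (D ∖ X) e} x)))
        (λ x → sym (trans (cong (λ b → b ∨ (D e ∧ not b)) x) (∧-identityʳ (D e))))
    contra : X d ≡ false → 2 < 2
    contra x = ≤-trans (subst (λ k → 3 ≤ k + deg G (D ∖ X) v) (sym (even-inc evX v i))
      (s≤s (s≤s (inc {D ∖ X} d v (∧-intro dd (not-intro x)) a)))) total

  -- At each of its vertices `X` already has degree 2 and so contains both edges of `D`; hence the
  -- vertices of `X` are closed under steps along the connected set `D`.
  subcycle : ∀ {X D} → Even X → IsCycle G D → X ⊆ D → ∀ x → X x ≡ true → D ⊆ X
  subcycle {X} {D} evX cy@(_ , conn , _) sub x xx d dd =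
    saturated (src d) sub evX (cycle-even cy) (verts→inc X (src d) (trans (sym same) start)) d dd (inj₁ refl)
    where
    start : verts X (src x) ≡ true
    start = edge-verts X xx (inj₁ refl)
    pass : ∀ e → D e ≡ true → ∀ u w → At e u → At e w → verts X u ≡ true → verts X w ≡ true
    pass e de u w au aw p = edge-verts X (saturated u sub evX (cycle-even cy) (verts→inc X u p) e de au) aw
    closed : ∀ e → D e ≡ true → verts X (src e) ≡ verts X (tgt e)
    closed e de = cases (verts X (src e))
      (λ p → trans p (sym (pass e de _ _ (inj₁ refl) (inj₂ refl) p)))
      (λ p → cases (verts X (tgt e))
        (λ q → trans (pass e de _ _ (inj₂ refl) (inj₁ refl) q) (sym q)) (λ q → trans p (sym q)))
    same : verts X (src x) ≡ verts X (src d)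
    same = walk-closed (verts X) closed (conn (src x) (src d) (inc x _ (sub x xx) (inj₁ refl)) (inc d _ dd (inj₁ refl)))

  vis-inc : ∀ {u v} (p : Spine u v) z → vis p z ≡ true → (u ≡ z) ⊎ Inc G (edges p) z
  vis-inc [] z q = inj₁ (⌊≟⌋-true q)
  vis-inc (snoc {v} {w} p e j f) z q with ∨-true {vis p z} q
  ... | inj₁ r with vis-inc p z r
  ...   | inj₁ h = inj₁ h
  ...   | inj₂ h = inj₂ (inc-mono z ∪-⊆ˡ h)
  vis-inc (snoc {v} {w} p e j f) z q | inj₂ r =
    inj₂ (inc e z (∨-introʳ {edges p e} (⌊≟⌋-refl e)) (subst (At e) (⌊≟⌋-true r) (proj₂ (joins→at j))))

  -- Rerouting the cycle D, which passes through x and y, along an edge e from y to a new vertex z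
  -- and a path from z back to the first vertex w of D.
  module Reroute (S D : ESet) (cyD : IsCycle G D) (D⊆S : D ⊆ S) (x y z : V) (Dx : Inc G D x) (Dy : Inc G D y)
                 (e : E) (se : S e ≡ true) (je : Joins G e y z) (z∉ : verts D z ≡ false)
                 (ct : CycleThrough S e) where
    VD : VSet
    VD = verts D
    evD : Even D
    evD = cycle-even cyD
    y∈ : VD y ≡ true
    y∈ = inc→verts D y Dy
    S' : ESet
    S' = S ∖ touches VD
    r : Reach S' z
    r = reach S' z
    Q : VSet
    Q = Reach.Q r
    S'-off : ∀ a → S' a ≡ true → ∀ v → At a v → VD v ≡ false
    S'-off a s v at = touches-false VD (not-true (proj₂ (∧-true {S a} s))) at
    Q-off : ∀ v → Q v ≡ true → VD v ≡ false
    Q-off v q with Reach.spine r v q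
    ... | p , t , _ = trans (sym (walk-closed VD closed (walk-mono (λ a i → Reach.T⊆S r a (t a i)) (vis-walk p v (vis-end p))))) z∉
      where
      closed : ∀ a → S' a ≡ true → VD (src a) ≡ VD (tgt a)
      closed a s = trans (S'-off a s _ (inj₁ refl)) (sym (S'-off a s _ (inj₂ refl)))
    D-Q : ∀ v → VD v ≡ true → Q v ≡ false
    D-Q v d = cases (Q v) (λ q → ⊥-elim (true≢false (trans (sym d) (Q-off v q)))) (λ q → q)
    e-crosses : crosses Q e ≡ true
    e-crosses = joins-crosses Q (joins-sym je) (Reach.root r) (D-Q y y∈)
    opaque
      -- The cycle of `S` through `e` enters `Q` by `e` and must leave it by another edge.
      exit : ∃[ f ] S f ≡ true × crosses Q f ≡ true × e ≢ f
      exit with even-bridge {CycleThrough.D ct} Q e (cycle-even (CycleThrough.isCycle ct)) (CycleThrough.e₀∈ ct) e-crosses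
      ... | f , p , q , ne = f , CycleThrough.D⊆ ct se f p , q , ne
    f : E
    f = proj₁ exit
    sf : S f ≡ true
    sf = proj₁ (proj₂ exit)
    e≢f : e ≢ f
    e≢f = proj₂ (proj₂ (proj₂ exit))
    opaque
      f-ends : ∃[ q ] ∃[ w ] Joins G f q w × Q q ≡ true × Q w ≡ false
      f-ends = xor-split Q (proj₁ (proj₂ (proj₂ exit)))
    q w : V
    q = proj₁ f-ends
    w = proj₁ (proj₂ f-ends)
    jf : Joins G f q w
    jf = proj₁ (proj₂ (proj₂ f-ends))
    q∈ : Q q ≡ true
    q∈ = proj₁ (proj₂ (proj₂ (proj₂ f-ends)))
    w∉ : Q w ≡ false
    w∉ = proj₂ (proj₂ (proj₂ (proj₂ f-ends)))
    -- If `f` touched no vertex of `D`, it would be an edge of `S'`, and `Q` is closed under those.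
    w∈ : VD w ≡ true
    w∈ = cases (touches VD f) yes' (λ n → ⊥-elim (no' n))
      where
      yes' : touches VD f ≡ true → VD w ≡ true
      yes' t with touches→at VD t
      ... | v , a , d with joins-ends jf a
      ...   | inj₁ refl = ⊥-elim (true≢false (trans (sym d) (Q-off q q∈)))
      ...   | inj₂ refl = d
      no' : touches VD f ≡ false → ⊥
      no' n = true≢false (trans (sym q∈) (trans (closed-joins Q (Reach.closed r f (∧-intro sf (not-intro n))) jf) w∉))
    opaque
      to-q : Σ (Spine z q) λ p → (edges p ⊆ Reach.T r) × (vis p ⊆ Q)
      to-q = Reach.spine r q q∈
    spq : Spine z q
    spq = proj₁ to-q
    spq⊆ : edges spq ⊆ S'
    spq⊆ a i = Reach.T⊆S r a (proj₁ (proj₂ to-q) a i)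
    w-fresh : vis spq w ≡ false
    w-fresh = cases (vis spq w) (λ i → ⊥-elim (true≢false (trans (sym (proj₂ (proj₂ to-q) w i)) w∉))) (λ k → k)
    spw : Spine z w
    spw = snoc spq f jf w-fresh
    P : ESet
    P = edges spw
    P-off : ∀ a → P a ≡ true → D a ≡ false
    P-off a p with ∨-true {edges spq a} p
    ... | inj₁ i = off-verts D (S'-off a (spq⊆ a i) _ (inj₁ refl)) (inj₁ refl)
    ... | inj₂ i rewrite sym (⌊≟⌋-true {x = f} {a} i) = off-verts D (Q-off q q∈) (proj₁ (joins→at jf))
    e∉D : D e ≡ false
    e∉D = off-verts D z∉ (proj₂ (joins→at je))
    e∉P : P e ≡ false
    e∉P = cases (edges spq e) (λ i → ⊥-elim (true≢false (trans (sym y∈) (S'-off e (spq⊆ e i) y (proj₁ (joins→at je))))))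
      (λ i → trans (cong (_∨ ⟦ f ⟧ e) i) (⌊≟⌋-≢ (λ k → e≢f (sym k))))
    -- Otherwise `y` would carry two edges of `D`, the edge `e` and the edge `f`.
    y≢w : y ≢ w
    y≢w y≡w = NP.<-irrefl refl (≤-trans four (deg≤3 y))
      where
      A : ESet
      A = (D ∪ ⟦ e ⟧) ∪ ⟦ f ⟧
      f∉ : (D ∪ ⟦ e ⟧) f ≡ false
      f∉ = ∨-false-intro (off-verts D (Q-off q q∈) (proj₁ (joins→at jf))) (⌊≟⌋-≢ e≢f)
      four : 4 ≤ deg G (allEdges G) y
      four = ≤-trans (≤-reflexive′ (deg-∪ {D ∪ ⟦ e ⟧} {⟦ f ⟧} y (⟦⟧-disjoint f f∉)) (deg-∪ {D} {⟦ e ⟧} y (⟦⟧-disjoint e e∉D))) (deg-mono {A} y (λ _ _ → refl))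
        where
        ≤-reflexive′ : deg G A y ≡ deg G (D ∪ ⟦ e ⟧) y + deg G ⟦ f ⟧ y → deg G (D ∪ ⟦ e ⟧) y ≡ deg G D y + deg G ⟦ e ⟧ y → 4 ≤ deg G A y
        ≤-reflexive′ a b rewrite a | b | even-inc evD y Dy =
          s≤s (s≤s (+-mono-≤ (inc {⟦ e ⟧} e y (⌊≟⌋-refl e) (proj₁ (joins→at je)))
                             (inc {⟦ f ⟧} f y (⌊≟⌋-refl f) (subst (At f) (sym y≡w) (proj₂ (joins→at jf))))))
    -- The two candidate cycles differ in the arc of D between w and y that they use.
    module Arc (a : Spine w y) (a⊆ : edges a ⊆ D) where
      va : vis a ⊆ VD
      va v i with vis-inc a v i
      ... | inj₁ refl = w∈
      ... | inj₂ k = inc→verts D v (inc-mono v a⊆ k)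
      joined : Disjoint G P (edges a) × Path (P ∪ edges a) z y (vis spw ∪ vis a)
      joined = path-++ (spine-path spw) (spine-path a) meet
        where
        meet : ∀ v → vis spw v ≡ true → vis a v ≡ true → v ≡ w
        meet v i k with ∨-true {vis spq v} i
        ... | inj₁ l = ⊥-elim (true≢false (trans (sym (va v k)) (Q-off v (proj₂ (proj₂ to-q) v l))))
        ... | inj₂ l = sym (⌊≟⌋-true l)
      D₁ : ESet
      D₁ = (P ∪ edges a) ∪ ⟦ e ⟧
      e∉a : edges a e ≡ false
      e∉a = cases (edges a e) (λ i → ⊥-elim (true≢false (trans (sym (a⊆ e i)) e∉D))) (λ i → i)
      cy₁ : IsCycle G D₁
      cy₁ = close-path (proj₂ joined) je (∨-false-intro e∉P e∉a)
      D₁⊆S : D₁ ⊆ S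
      D₁⊆S b i with ∨-true {(P ∪ edges a) b} i
      ... | inj₂ k rewrite sym (⌊≟⌋-true {x = e} {b} k) = se
      ... | inj₁ k with ∨-true {P b} k
      ...   | inj₂ l = D⊆S b (a⊆ b l)
      ...   | inj₁ l with ∨-true {edges spq b} l
      ...     | inj₁ h = proj₁ (∧-true (spq⊆ b h))
      ...     | inj₂ h rewrite sym (⌊≟⌋-true {x = f} {b} h) = sf
      z∈₁ : Inc G D₁ z
      z∈₁ = inc e z (∨-introʳ {(P ∪ edges a) e} (⌊≟⌋-refl e)) (proj₂ (joins→at je))
      on-D : ∀ d → D d ≡ true → D₁ d ≡ edges a d
      on-D d dd = trans (cong (λ b → (b ∨ edges a d) ∨ ⟦ e ⟧ d) (cases (P d) (λ p → ⊥-elim (true≢false (trans (sym dd) (P-off d p)))) (λ p → p)))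
                   (trans (cong (edges a d ∨_) (⌊≟⌋-≢ (λ { refl → true≢false (trans (sym dd) e∉D) }))) (∨-identityʳ _))
      off-D : ∀ d → D d ≡ false → D₁ d ≡ P d ∨ ⟦ e ⟧ d
      off-D d dd = cong (_∨ ⟦ e ⟧ d) (trans (cong (P d ∨_) (cases (edges a d) (λ i → ⊥-elim (true≢false (trans (sym (a⊆ d i)) dd))) (λ i → i))) (∨-identityʳ (P d)))

    opaque
      first-arc : Σ (Spine w y) λ a → edges a ⊆ D
      first-arc with reach D w
      ... | rd with Reach.spine rd y (trans (sym (walk-closed (Reach.Q rd) (Reach.closed rd) (proj₁ (proj₂ cyD) w y (verts→inc D w w∈) Dy))) (Reach.root rd))
      ...   | a , t , _ = a , λ b i → Reach.T⊆S rd b (t b i)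
    module A₁ = Arc (proj₁ first-arc) (proj₂ first-arc)

    opaque
      -- If `y` cannot be reached from `w` off the first arc, the reached set has a cut in which the
      -- even set `D △ A₁.D₁` has the single edge `f`.
      second-arc : Σ (Spine w y) λ a → edges a ⊆ (D ∖ edges (proj₁ first-arc))
      second-arc with reach (D ∖ edges (proj₁ first-arc)) w
      ... | rd with split-bool (Reach.Q rd y)
      ...   | inj₁ yq with Reach.spine rd y yq
      ...     | a , t , _ = a , λ b i → Reach.T⊆S rd b (t b i)
      second-arc | rd | inj₂ yq = ⊥-elim (impossible (even-bridge {D △ A₁.D₁} X f (even-△ evD (cycle-even A₁.cy₁)) f∈ f-crosses))
        where
        X : VSet
        X = Reach.Q rd
        X⊆ : ∀ v → X v ≡ true → VD v ≡ true
        X⊆ v i with Reach.spine rd v i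
        ... | a , t , _ with vis-inc a v (vis-end a)
        ...   | inj₁ refl = w∈
        ...   | inj₂ k = inc→verts D v (inc-mono v (λ b j → proj₁ (∧-true (Reach.T⊆S rd b (t b j)))) k)
        X-off : ∀ v → VD v ≡ false → X v ≡ false
        X-off v d = cases (X v) (λ i → ⊥-elim (true≢false (trans (sym (X⊆ v i)) d))) (λ k → k)
        f∉D : D f ≡ false
        f∉D = P-off f (∨-introʳ {edges spq f} (⌊≟⌋-refl f))
        f∈ : (D △ A₁.D₁) f ≡ true
        f∈ rewrite A₁.off-D f f∉D | f∉D = ∨-introˡ (∨-introʳ {edges spq f} (⌊≟⌋-refl f))
        f-crosses : crosses X f ≡ true
        f-crosses = joins-crosses X (joins-sym jf) (Reach.root rd) (X-off q (Q-off q q∈))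
        nocross : ∀ b → X (src b) ≡ X (tgt b) → crosses X b ≡ true → ⊥
        nocross b h c = true≢false (trans (sym c) (trans (cong (_xor X (tgt b)) h) (xor-same (X (tgt b)))))
        impossible : ∃[ b ] (D △ A₁.D₁) b ≡ true × crosses X b ≡ true × f ≢ b → ⊥
        impossible (b , i , c , ne) = cases (D b)
          (λ d → nocross b (Reach.closed rd b (∧-intro d (not-intro (arcless d)))) c)
          (λ d → outside d (∨-true {P b} (trans (sym (trans (cong (_xor A₁.D₁ b) d) (A₁.off-D b d))) i)))
          where
          arcless : D b ≡ true → edges (proj₁ first-arc) b ≡ false
          arcless d = not-true (trans (sym (trans (cong₂ _xor_ d (A₁.on-D b d)) refl)) i)
          outside : D b ≡ false → (P b ≡ true) ⊎ (⟦ e ⟧ b ≡ true) → ⊥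
          outside d (inj₂ k) = nocross b (subst (λ b → X (src b) ≡ X (tgt b)) (⌊≟⌋-true {x = e} {b} k)
            (joins-closed X je (trans yq (sym (X-off z z∉))))) c
          outside d (inj₁ k) with ∨-true {edges spq b} k
          ... | inj₂ l = ne (⌊≟⌋-true l)
          ... | inj₁ l = nocross b (trans (X-off _ (S'-off b (spq⊆ b l) _ (inj₁ refl))) (sym (X-off _ (S'-off b (spq⊆ b l) _ (inj₂ refl))))) c
    second⊆D : edges (proj₁ second-arc) ⊆ D
    second⊆D b i = proj₁ (∧-true (proj₂ second-arc b i))
    module A₂ = Arc (proj₁ second-arc) second⊆D

    Both : ESet
    Both = A₁.D₁ △ A₂.D₁

    Both⊆D : Both ⊆ D
    Both⊆D b i = cases (D b) (λ d → d) λ d →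
      ⊥-elim (true≢false (trans (sym i) (trans (cong₂ _xor_ (A₁.off-D b d) (A₂.off-D b d)) (xor-same (P b ∨ ⟦ e ⟧ b)))))

    -- The two candidates agree off `D`, so their difference is an even subset of the cycle `D`; it
    -- contains an edge of the first arc and is thus all of `D`. Consequently every vertex of `D`,
    -- in particular `x`, lies on one of the candidates.
    D⊆Both : D ⊆ Both
    D⊆Both with vis-inc (proj₁ first-arc) y (vis-end (proj₁ first-arc))
    ... | inj₁ h = ⊥-elim (y≢w (sym h))
    ... | inj₂ h with inc→edge y h
    ...   | b , i , _ = subcycle (even-△ (cycle-even A₁.cy₁) (cycle-even A₂.cy₁)) cyD Both⊆D b witness
      where
      b∈D : D b ≡ true
      b∈D = proj₂ first-arc b i
      b∉ : edges (proj₁ second-arc) b ≡ false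
      b∉ = cases (edges (proj₁ second-arc) b)
        (λ k → ⊥-elim (true≢false (trans (sym i) (not-true (proj₂ (∧-true {D b} (proj₂ second-arc b k))))))) (λ k → k)
      witness : Both b ≡ true
      witness rewrite A₁.on-D b b∈D | A₂.on-D b b∈D | i | b∉ = refl

    reroute : ∃[ C ] IsCycle G C × C ⊆ S × Inc G C x × Inc G C z
    reroute with inc→edge x Dx
    ... | d , dd , at = cases (A₁.D₁ d)
      (λ i → A₁.D₁ , A₁.cy₁ , A₁.D₁⊆S , inc d x i at , A₁.z∈₁)
      (λ i → A₂.D₁ , A₂.cy₁ , A₂.D₁⊆S , inc d x (trans (sym (cong (_xor A₂.D₁ d) i)) (D⊆Both d dd)) at , A₂.z∈₁)

  -- A cycle through `x` and the current vertex of the walk is carried forward one edge at a time;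
  -- it is rerouted only when the next vertex is not yet on it.
  two-vertex-cycle : ∀ S → (∀ e → S e ≡ true → CycleThrough S e) → ∀ {x y} → x ≢ y → Walk G S x y →
    ∃[ C ] IsCycle G C × C ⊆ S × Inc G C x × Inc G C y
  two-vertex-cycle S nb ne nil = ⊥-elim (ne refl)
  two-vertex-cycle S nb {x} {y} ne (cons {w = z} e s j walk) = extend start walk
    where
    Good : V → Set
    Good v = ∃[ C ] IsCycle G C × C ⊆ S × Inc G C x × Inc G C v
    start : Good z
    start = D , isCycle , D⊆ s , inc e x e₀∈ (proj₁ (joins→at j)) , inc e z e₀∈ (proj₂ (joins→at j))
      where open CycleThrough (nb e s)
    extend : ∀ {v} → Good v → Walk G S v y → Good y
    extend g nil = g
    extend (C , cy , sub , cx , cv) (cons {u} {w} e s j rest) with split-bool (verts C w)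
    ... | inj₁ i = extend (C , cy , sub , cx , verts→inc C w i) rest
    ... | inj₂ i = extend (Reroute.reroute S C cy sub x u w cx cv e s j i (nb e s)) rest

-- Seymour's 6-flow theorem for a bridgeless edge set
module SixFlow (G : Graph) (loopless : Loopless G)
               (deg≤3 : MaxDegree3 G)
               (E₀ : EdgeSet G)
               (bridgeless : Bridgeless G E₀) where
  open Subcubic G loopless deg≤3
  open Flow G loopless F₃Ring

  -- The induction hypothesis for a 6-flow. Edges of `E₀` leaving `R` are half-edges: `f` must be
  -- non-zero on them, while nothing is required at their outer ends. For `R` the whole vertex set
  -- this is the theorem.
  record Psi (R : VSet) : Set where
    field
      C    : ESet
      f    : E → F₃
      C⊆   : ∀ e → C e ≡ true → E₀ e ≡ true × inside R e ≡ true
      even : Even C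
      supp : ∀ e → E₀ e ∧ touches R e ≡ false → f e ≡ 0F
      cons₃ : ∀ v → R v ≡ true → ∂ f v ≡ 0F
      nz   : ∀ e → E₀ e ≡ true → touches R e ≡ true → C e ≡ false → f e ≢ 0F

  neg-nz : ∀ x → x ≢ 0F → -₃ x ≢ 0F
  neg-nz 0F h = h
  neg-nz 1F h ()
  neg-nz 2F h ()

  negate : ∀ {R} → Psi R → Psi R
  negate p = record { C = C ; f = λ e → -₃ f e ; C⊆ = C⊆ ; even = even
    ; supp = λ e h → cong -₃_ (supp e h)
    ; cons₃ = λ v r → trans (∂-⊖ f v) (cong -₃_ (cons₃ v r))
    ; nz = λ e a b c → neg-nz (f e) (nz e a b c) }
    where open Psi p

  -- Edges between `X` and `Y` are half-edges for both parts, so they carry both flows; these are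
  -- the only places where the flows have to agree.
  glue : ∀ {R X Y} → (∀ v → R v ≡ X v ∨ Y v) → (∀ v → X v ≡ true → Y v ≡ false) →
    (p : Psi X) (q : Psi Y) →
    (∀ e → E₀ e ≡ true → touches X e ≡ true → touches Y e ≡ true → Psi.f p e ≡ Psi.f q e) → Psi R
  glue {R} {X} {Y} split dis p q match = record
    { C = p.C △ q.C ; f = f ; C⊆ = C⊆' ; even = even-△ p.even q.even ; supp = supp' ; cons₃ = cons' ; nz = nz' }
    where
    module p = Psi p
    module q = Psi q
    f : E → F₃
    f e = if touches X e then p.f e else q.f e
    X⊆R : ∀ v → X v ≡ true → R v ≡ true
    X⊆R v x = trans (split v) (∨-introˡ x)
    Y⊆R : ∀ v → Y v ≡ true → R v ≡ true
    Y⊆R v y = trans (split v) (∨-introʳ {X v} y)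
    tX : ∀ e → touches X e ≡ true → touches R e ≡ true
    tX e t with touches→at X t
    ... | v , a , x = touches-at R a (X⊆R v x)
    tY : ∀ e → touches Y e ≡ true → touches R e ≡ true
    tY e t with touches→at Y t
    ... | v , a , y = touches-at R a (Y⊆R v y)
    exclusive : ∀ e → inside X e ≡ true → inside Y e ≡ true → ⊥
    exclusive e i j = true≢false (trans (sym (inside-at Y j (inj₁ refl))) (dis _ (inside-at X {e} i (inj₁ refl))))
    C⊆' : ∀ e → p.C e xor q.C e ≡ true → E₀ e ≡ true × inside R e ≡ true
    C⊆' e h with split-bool (p.C e)
    ... | inj₁ c = proj₁ (p.C⊆ e c) , inside-mono X R X⊆R (proj₂ (p.C⊆ e c))
    ... | inj₂ c = let d = q.C⊆ e (trans (sym (cong (_xor q.C e) c)) h) in proj₁ d , inside-mono Y R Y⊆R (proj₂ d)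
    out : ∀ e → E₀ e ∧ touches R e ≡ false → E₀ e ∧ touches X e ≡ false × E₀ e ∧ touches Y e ≡ false
    out e h with E₀ e
    ... | false = refl , refl
    ... | true = cases (touches X e) (λ t → ⊥-elim (true≢false (trans (sym (tX e t)) h))) (λ k → k)
               , cases (touches Y e) (λ t → ⊥-elim (true≢false (trans (sym (tY e t)) h))) (λ k → k)
    supp' : ∀ e → E₀ e ∧ touches R e ≡ false → f e ≡ 0F
    supp' e h with touches X e in t
    ... | true = p.supp e (trans (cong (E₀ e ∧_) t) (trans (cong (E₀ e ∧_) (sym t)) (proj₁ (out e h))))
    ... | false = q.supp e (proj₂ (out e h))
    onX : ∀ e v → At e v → X v ≡ true → f e ≡ p.f e
    onX e v a x rewrite touches-at X a x = refl
    onY : ∀ e v → At e v → Y v ≡ true → f e ≡ q.f e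
    onY e v a y with touches X e in t
    ... | false = refl
    ... | true = cases (E₀ e) (λ z → match e z t (touches-at Y a y))
      (λ z → trans (p.supp e (cong (_∧ touches X e) z)) (sym (q.supp e (cong (_∧ touches Y e) z))))
    cons' : ∀ v → R v ≡ true → ∂ f v ≡ 0F
    cons' v r with ∨-true {X v} (trans (sym (split v)) r)
    ... | inj₁ x = trans (∂-local v (λ e a → onX e v a x)) (p.cons₃ v x)
    ... | inj₂ y = trans (∂-local v (λ e a → onY e v a y)) (q.cons₃ v y)
    both-off : ∀ e → p.C e xor q.C e ≡ false → p.C e ≡ false × q.C e ≡ false
    both-off e h = cases (p.C e)
      (λ c → ⊥-elim (exclusive e (proj₂ (p.C⊆ e c)) (proj₂ (q.C⊆ e (trans (sym (xor-eq h)) c)))))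
      (λ c → c , trans (sym (xor-eq h)) c)
    nz' : ∀ e → E₀ e ≡ true → touches R e ≡ true → p.C e xor q.C e ≡ false → f e ≢ 0F
    nz' e z t c with touches X e in tx
    ... | true = p.nz e z tx (proj₁ (both-off e c))
    ... | false = q.nz e z ty (proj₂ (both-off e c))
      where
      ty : touches Y e ≡ true
      ty with touches→at R t
      ... | v , a , r = touches-at Y a (trans (sym (trans (split v) (cong (_∨ Y v) (touches-false X tx a)))) r)

  empty : ∀ {R} → (∀ v → R v ≡ false) → Psi R
  empty {R} h = record { C = λ _ → false ; f = λ _ → 0F ; C⊆ = λ _ () ; even = λ v → ∂₂.∂-0 {λ _ → false} v (λ _ _ → refl)
    ; supp = λ _ _ → refl ; cons₃ = λ v r → ⊥-elim (true≢false (trans (sym r) (h v)))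
    ; nz = λ e _ t _ → ⊥-elim (untouched e t) }
    where
    untouched : ∀ e → touches R e ≡ true → ⊥
    untouched e t with touches→at R t
    ... | v , _ , r = true≢false (trans (sym r) (h v))

  cut-sum : ∀ (Q : VSet) h → ∑ (λ v → ind (Q v) *₃ ∂ h v) ≡ ∑ (λ e → h e *₃ (ind (Q (src e)) +₃ (-₃ ind (Q (tgt e)))))
  cut-sum Q h = ∂-cut (λ v → ind (Q v)) h

  cut-coeff : ∀ a b → a xor b ≡ true → ind a +₃ (-₃ ind b) ≢ 0F
  cut-coeff true  false _ ()
  cut-coeff false true  _ ()

  -- With no edge of `E₀` leaving `R`, the boundaries over `R` sum to zero, so conservation at `x`
  -- follows from conservation at the other vertices.
  isolated : ∀ {R} x → R x ≡ true → (∀ e → E₀ e ∧ crosses R e ≡ false) → Psi (R ∖ ⟦ x ⟧) → Psi R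
  isolated {R} x rx none p = record { C = C ; f = f
    ; C⊆ = λ e c → proj₁ (C⊆ e c) , inside-mono (R ∖ ⟦ x ⟧) R (λ v h → proj₁ (∧-true h)) (proj₂ (C⊆ e c))
    ; even = even ; supp = supp' ; cons₃ = cons' ; nz = λ e z t c → nz e z (touch' e z t) c }
    where
    open Psi p
    mem : ∀ v → R v ≡ true → x ≢ v → (R ∖ ⟦ x ⟧) v ≡ true
    mem v r ne = ∧-intro r (not-intro (⌊≟⌋-≢ ne))
    supp' : ∀ e → E₀ e ∧ touches R e ≡ false → f e ≡ 0F
    supp' e h = supp e (cases (E₀ e)
      (λ z → cases (touches (R ∖ ⟦ x ⟧) e)
        (λ t → ⊥-elim (true≢false (trans (sym (∧-intro z (up t))) h)))
        (λ t → trans (cong (E₀ e ∧_) t) (∧-zeroʳ (E₀ e))))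
      (λ z → cong (_∧ touches (R ∖ ⟦ x ⟧) e) z))
      where
      up : touches (R ∖ ⟦ x ⟧) e ≡ true → touches R e ≡ true
      up t with touches→at (R ∖ ⟦ x ⟧) t
      ... | v , a , r = touches-at R a (proj₁ (∧-true r))
    touch' : ∀ e → E₀ e ≡ true → touches R e ≡ true → touches (R ∖ ⟦ x ⟧) e ≡ true
    touch' e z t = go (src e ≟ x)
      where
      same : R (src e) ≡ R (tgt e)
      same = xor-eq (trans (sym (cong (_∧ crosses R e) z)) (none e))
      rs : R (src e) ≡ true
      rs with ∨-true {R (src e)} t
      ... | inj₁ k = k
      ... | inj₂ k = trans same k
      go : Dec (src e ≡ x) → touches (R ∖ ⟦ x ⟧) e ≡ true
      go (no ne) = touches-at (R ∖ ⟦ x ⟧) {e} (inj₁ refl) (mem _ rs (λ k → ne (sym k)))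
      go (yes k) = touches-at (R ∖ ⟦ x ⟧) {e} (inj₂ refl) (mem _ (trans (sym same) rs) (λ l → loopless e (trans k l)))
    total : ∑ (λ v → ind (R v) *₃ ∂ f v) ≡ 0F
    total = trans (cut-sum R f) (∑-0 term)
      where
      term : ∀ e → f e *₃ (ind (R (src e)) +₃ (-₃ ind (R (tgt e)))) ≡ 0F
      term e = cases (crosses R e)
        (λ c → cong (_*₃ (ind (R (src e)) +₃ (-₃ ind (R (tgt e)))))
          (supp' e (cong (_∧ touches R e) (cases (E₀ e) (λ z → ⊥-elim (true≢false (trans (sym (∧-intro z c)) (none e)))) (λ z → z)))))
        (λ c → trans (cong (f e *₃_) (same (R (src e)) (R (tgt e)) c)) (zeroʳ (f e)))
        where
        same : ∀ a b → a xor b ≡ false → ind a +₃ (-₃ ind b) ≡ 0F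
        same a b h rewrite xor-eq {a} {b} h = -‿inverseʳ (ind b)
    cons' : ∀ v → R v ≡ true → ∂ f v ≡ 0F
    cons' v r with x ≟ v
    ... | no ne = cons₃ v (mem v r ne)
    ... | yes refl = trans (cong (_*₃ ∂ f x) (sym (cong ind rx))) (trans (sym (∑-single x other)) total)
      where
      other : ∀ w → x ≢ w → ind (R w) *₃ ∂ f w ≡ 0F
      other w ne = cases (R w) (λ q → trans (cong (ind (R w) *₃_) (cons₃ w (mem w q ne))) (zeroʳ (ind (R w))))
        (λ q → cong (λ b → ind b *₃ ∂ f w) q)

  -- Q is a single vertex or the vertex set of a cycle D; it is split off from R in one induction step, and
  -- the free values on the two edges leaving R from Q are used to balance the flow on Q.
  record Core (R : VSet) (e₁ e₂ : E) : Set where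
    field
      Q    : VSet
      D    : ESet
      q₀   : V
      Q⊆R  : Q ⊆ R
      q₀∈  : Q q₀ ≡ true
      D⊆   : ∀ e → D e ≡ true → E₀ e ≡ true × inside Q e ≡ true
      even : Even D
      conn : ∀ v → Q v ≡ true → Σ (Spine q₀ v) λ p → edges p ⊆ D
      c₁   : crosses Q e₁ ≡ true
      c₂   : crosses Q e₂ ≡ true

  module Extend {R : VSet} {e₁ e₂ : E} (z₁ : E₀ e₁ ≡ true) (z₂ : E₀ e₂ ≡ true) (ne : e₁ ≢ e₂)
                (r₁ : crosses R e₁ ≡ true) (r₂ : crosses R e₂ ≡ true) (core : Core R e₁ e₂)
                (psi : Psi (R ∖ Core.Q core)) where
    open Core core
    module p = Psi psi
    R' : VSet
    R' = R ∖ Q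
    R'⊆R : R' ⊆ R
    R'⊆R v h = proj₁ (∧-true h)
    R'-Q : ∀ v → R' v ≡ true → Q v ≡ false
    R'-Q v h = not-true (proj₂ (∧-true {R v} h))
    Q-R' : ∀ v → Q v ≡ true → R' v ≡ false
    Q-R' v q = trans (cong (λ b → R v ∧ not b) q) (∧-zeroʳ (R v))
    -- Exactly one end of a leaving edge is in R, and it is in Q.
    leaves : ∀ e → crosses R e ≡ true → crosses Q e ≡ true → touches R' e ≡ false
    leaves e r q = ∨-false-intro (go (src e) (tgt e) r q) (go (tgt e) (src e) (trans (xor-comm (R (tgt e)) _) r) (trans (xor-comm (Q (tgt e)) _) q))
      where
      go : ∀ u w → R u xor R w ≡ true → Q u xor Q w ≡ true → R' u ≡ false
      go u w r q = cases (Q u) (Q-R' u) λ qu → cases (R u)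
        (λ ru → ⊥-elim (true≢false (trans (sym r) (cong₂ _xor_ ru (Q⊆R w (trans (sym (cong (_xor Q w) qu)) q))))))
        (λ ru → cong (_∧ not (Q u)) ru)
    t₁ : touches R' e₁ ≡ false
    t₁ = leaves e₁ r₁ c₁
    t₂ : touches R' e₂ ≡ false
    t₂ = leaves e₂ r₂ c₂
    not-inside : ∀ X e → crosses X e ≡ true → inside X e ≡ true → ⊥
    not-inside X e c i = true≢false (trans (sym c) (cong₂ _xor_ (inside-at X {e} i (inj₁ refl)) (inside-at X {e} i (inj₂ refl))))
    -- Provisional values: edges at `R'` keep the flow given by induction, other new edges get 1,
    -- and `e₁`, `e₂` wait for the values that cancel the total boundary on `Q`. What remains is
    -- pushed along `D`, where any value is allowed since `D` joins the even set.
    h₀ : E → F₃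
    h₀ e = if touches R' e then p.f e else
           if D e ∨ (⟦ e₁ ⟧ e ∨ ⟦ e₂ ⟧ e) then 0F else
           if E₀ e ∧ touches Q e then 1F else 0F
    s : E → F₃
    s e = ind (Q (src e)) +₃ (-₃ ind (Q (tgt e)))
    F₀ : F₃
    F₀ = ∑ (λ e → h₀ e *₃ s e)
    balanced : ∃[ x ] ∃[ y ] x ≢ 0F × y ≢ 0F × F₀ +₃ (x *₃ s e₁ +₃ y *₃ s e₂) ≡ 0F
    balanced = balance₃ F₀ (s e₁) (s e₂) (cut-coeff (Q (src e₁)) (Q (tgt e₁)) c₁) (cut-coeff (Q (src e₂)) (Q (tgt e₂)) c₂)
    x y : F₃
    x = proj₁ balanced
    y = proj₁ (proj₂ balanced)
    x≢0 : x ≢ 0F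
    x≢0 = proj₁ (proj₂ (proj₂ balanced))
    y≢0 : y ≢ 0F
    y≢0 = proj₁ (proj₂ (proj₂ (proj₂ balanced)))
    h : E → F₃
    h e = h₀ e +₃ (x *₃ δ e₁ e +₃ y *₃ δ e₂ e)
    h-total : ∑ (λ v → ind (Q v) *₃ ∂ h v) ≡ 0F
    h-total = trans (cut-sum Q h) (trans (∑-cong (λ e → trans (distribʳ (s e) (h₀ e) _) (cong (h₀ e *₃ s e +₃_) (distribʳ (s e) (x *₃ δ e₁ e) (y *₃ δ e₂ e)))))
      (trans (∑-⊕ (λ e → h₀ e *₃ s e) (λ e → (x *₃ δ e₁ e) *₃ s e +₃ (y *₃ δ e₂ e) *₃ s e))
      (trans (cong (F₀ +₃_) (trans (∑-⊕ (λ e → (x *₃ δ e₁ e) *₃ s e) (λ e → (y *₃ δ e₂ e) *₃ s e)) (cong₂ _+₃_ (single e₁ x) (single e₂ y))))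
        (proj₂ (proj₂ (proj₂ (proj₂ balanced)))))))
      where
      single : ∀ e₀ c → ∑ (λ e → (c *₃ δ e₀ e) *₃ s e) ≡ c *₃ s e₀
      single e₀ c = trans (∑-single e₀ (λ e ne → cong (_*₃ s e) (trans (cong (c *₃_) (δ-≢ ne)) (zeroʳ c))))
        (cong (_*₃ s e₀) (trans (cong (c *₃_) (δ-refl e₀)) (*-identityʳ c)))
    target : V → F₃
    target v = -₃ (ind (Q v) *₃ ∂ h v)
    pushed : ∃[ g ] (∀ e → D e ≡ false → g e ≡ 0F) × (∀ v → ∂ g v ≡ target v)
    pushed = push D Q q₀ conn target (λ v q → cong (λ b → -₃ (ind b *₃ ∂ h v)) q) (trans (∑-⊖ _) (cong -₃_ h-total))
    g : E → F₃
    g = proj₁ pushed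
    f : E → F₃
    f e = h e +₃ g e
    h-other : ∀ e → e₁ ≢ e → e₂ ≢ e → h e ≡ h₀ e
    h-other e n₁ n₂ = trans (cong (h₀ e +₃_) (cong₂ _+₃_ (trans (cong (x *₃_) (δ-≢ n₁)) (zeroʳ x)) (trans (cong (y *₃_) (δ-≢ n₂)) (zeroʳ y)))) (+-identityʳ (h₀ e))
    h-R' : ∀ e → touches R' e ≡ true → h e ≡ p.f e
    h-R' e t = trans (h-other e (λ { refl → true≢false (trans (sym t) t₁) }) (λ { refl → true≢false (trans (sym t) t₂) }))
      (cong (if_then p.f e else (if D e ∨ (⟦ e₁ ⟧ e ∨ ⟦ e₂ ⟧ e) then 0F else if E₀ e ∧ touches Q e then 1F else 0F)) t)
    conserve : ∀ v → R v ≡ true → ∂ f v ≡ 0F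
    conserve v r = trans (∂-⊕ h g v) (cases (Q v) inQ outQ)
      where
      inQ : Q v ≡ true → ∂ h v +₃ ∂ g v ≡ 0F
      inQ q = trans (cong (∂ h v +₃_) (trans (proj₂ (proj₂ pushed) v) (cong (λ b → -₃ (ind b *₃ ∂ h v)) q))) (-‿inverseʳ (∂ h v))
      outQ : Q v ≡ false → ∂ h v +₃ ∂ g v ≡ 0F
      outQ q = cong₂ _+₃_
        (trans (∂-local v (λ e a → h-R' e (touches-at R' a r'))) (p.cons₃ v r'))
        (trans (proj₂ (proj₂ pushed) v) (cong (λ b → -₃ (ind b *₃ ∂ h v)) q))
        where
        r' : R' v ≡ true
        r' = ∧-intro r (not-intro q)
    crossing-touches : ∀ e → crosses R e ≡ true → touches R e ≡ true
    crossing-touches e c = cases (R (src e)) (λ k → ∨-introˡ k) (λ k → ∨-introʳ {R (src e)} (trans (sym (cong (_xor R (tgt e)) k)) c))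
    support : ∀ e → E₀ e ∧ touches R e ≡ false → f e ≡ 0F
    support e off = cong₂ _+₃_ (trans (h-other e (avoid e₁ z₁ r₁) (avoid e₂ z₂ r₂)) (at-h₀ (touches R' e) refl)) (proj₁ (proj₂ pushed) e d)
      where
      avoid : ∀ e' → E₀ e' ≡ true → crosses R e' ≡ true → e' ≢ e
      avoid e' z r refl = true≢false (trans (sym (∧-intro z (crossing-touches e r))) off)
      up : ∀ X → X ⊆ R → touches X e ≡ true → touches R e ≡ true
      up X sub t with touches→at X t
      ... | v , a , r = touches-at R a (sub v r)
      no-E₀ : touches R e ≡ true → E₀ e ≡ false
      no-E₀ t = cases (E₀ e) (λ z → ⊥-elim (true≢false (trans (sym (∧-intro z t)) off))) (λ z → z)
      d : D e ≡ false
      d = cases (D e) (λ d → ⊥-elim (true≢false (trans (sym (proj₁ (D⊆ e d))) (no-E₀ (up Q Q⊆R (touches-at Q {e} (inj₁ refl) (inside-at Q {e} (proj₂ (D⊆ e d)) (inj₁ refl)))))))) (λ d → d)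
      inert : E₀ e ∧ touches Q e ≡ false
      inert = cases (touches Q e) (λ t → cong (_∧ touches Q e) (no-E₀ (up Q Q⊆R t))) (λ t → trans (cong (E₀ e ∧_) t) (∧-zeroʳ (E₀ e)))
      at-h₀ : ∀ b → touches R' e ≡ b → h₀ e ≡ 0F
      at-h₀ true t = trans (cong (if_then p.f e else _) t) (p.supp e (cong (_∧ touches R' e) (no-E₀ (up R' R'⊆R t))))
      at-h₀ false t = trans (cong (if_then p.f e else _) t) (last (D e ∨ (⟦ e₁ ⟧ e ∨ ⟦ e₂ ⟧ e)))
        where
        last : ∀ b → (if b then 0F else (if E₀ e ∧ touches Q e then 1F else 0F)) ≡ 0F
        last true = refl
        last false rewrite inert = refl
    nonzero : ∀ e → E₀ e ≡ true → touches R e ≡ true → p.C e xor D e ≡ false → f e ≢ 0F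
    nonzero e z t c = subst (_≢ 0F) (sym (trans (cong (h e +₃_) (proj₁ (proj₂ pushed) e d)) (+-identityʳ (h e)))) (cases (touches R' e) near far)
      where
      d : D e ≡ false
      d = cases (D e) (λ d → ⊥-elim (true≢false (trans (sym (inside-at Q {e} (proj₂ (D⊆ e d)) (inj₁ refl)))
            (R'-Q _ (inside-at R' {e} (proj₂ (p.C⊆ e (trans (xor-eq c) d))) (inj₁ refl)))))) (λ d → d)
      near : touches R' e ≡ true → h e ≢ 0F
      near t' = subst (_≢ 0F) (sym (h-R' e t')) (p.nz e z t' (trans (xor-eq c) d))
      h₀-special : ⟦ e₁ ⟧ e ∨ ⟦ e₂ ⟧ e ≡ true → touches R' e ≡ false → h₀ e ≡ 0F
      h₀-special sp t' rewrite t' | d | sp = refl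
      far : touches R' e ≡ false → h e ≢ 0F
      far t' = go (e₁ ≟ e) (e₂ ≟ e)
        where
        go : Dec (e₁ ≡ e) → Dec (e₂ ≡ e) → h e ≢ 0F
        go (yes refl) _ = subst (_≢ 0F) (sym (trans (cong₂ _+₃_ (h₀-special (∨-introˡ (⌊≟⌋-refl e)) t')
          (cong₂ _+₃_ (trans (cong (x *₃_) (δ-refl e)) (*-identityʳ x)) (trans (cong (y *₃_) (δ-≢ (λ k → ne (sym k)))) (zeroʳ y)))) (+-identityʳ x))) x≢0
        go (no n₁) (yes refl) = subst (_≢ 0F) (sym (cong₂ _+₃_ (h₀-special (∨-introʳ {⟦ e₁ ⟧ e} (⌊≟⌋-refl e)) t')
          (cong₂ _+₃_ (trans (cong (x *₃_) (δ-≢ n₁)) (zeroʳ x)) (trans (cong (y *₃_) (δ-refl e)) (*-identityʳ y))))) y≢0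
        go (no n₁) (no n₂) = subst (_≢ 0F) (sym (trans (h-other e n₁ n₂) one)) (λ ())
          where
          tq : touches Q e ≡ true
          tq with touches→at R t
          ... | v , a , r = touches-at Q a (cases (Q v) (λ q → q)
            (λ q → ⊥-elim (true≢false (trans (sym (∧-intro r (not-intro q))) (touches-false R' t' a)))))
          one : h₀ e ≡ 1F
          one rewrite t' | d | ⌊≟⌋-≢ n₁ | ⌊≟⌋-≢ n₂ | z | tq = refl
    result : Psi R
    result = record { C = p.C △ D ; f = f ; C⊆ = C⊆' ; even = even-△ p.even even ; supp = support ; cons₃ = conserve ; nz = nonzero }
      where
      C⊆' : ∀ e → p.C e xor D e ≡ true → E₀ e ≡ true × inside R e ≡ true
      C⊆' e c = cases (D e) (λ d → proj₁ (D⊆ e d) , inside-mono Q R Q⊆R (proj₂ (D⊆ e d)))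
        (λ d → let k = p.C⊆ e (trans (sym (xor-identityʳ (p.C e))) (trans (cong (p.C e xor_) (sym d)) c)) in
               proj₁ k , inside-mono R' R R'⊆R (proj₂ k))

  -- Covers a bridge inside `R` as well as a disconnected `R`. A bridge `e₀` is a half-edge of both
  -- parts, so both flows are non-zero there and agree up to sign.
  split-at : ∀ {R} (X : VSet) e₀ → (∀ e → E₀ e ∧ inside R e ≡ true → crosses X e ≡ true → e₀ ≡ e) →
    E₀ e₀ ≡ true → inside R e₀ ≡ true →
    (p : Psi (R ∖ X)) (q : Psi (R ∖ (R ∖ X))) → Psi R
  split-at {R} X e₀ only z i p q = cases (crosses X e₀) join free
    where
    A B : VSet
    A = R ∖ X
    B = R ∖ (R ∖ X)
    part : ∀ v → R v ≡ A v ∨ B v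
    part v with R v | X v
    ... | true | true = refl
    ... | true | false = refl
    ... | false | _ = refl
    dis : ∀ v → A v ≡ true → B v ≡ false
    dis v a with R v | X v
    ... | true | false = refl
    A→ : ∀ v → A v ≡ true → R v ≡ true × X v ≡ false
    A→ v a = proj₁ (∧-true a) , not-true (proj₂ (∧-true {R v} a))
    B→ : ∀ v → B v ≡ true → R v ≡ true × X v ≡ true
    B→ v b with R v | X v
    ... | true | true = refl , refl
    two : ∀ e → touches A e ≡ true → touches B e ≡ true → inside R e ≡ true × crosses X e ≡ true
    two e a b with ∨-true {A (src e)} a | ∨-true {B (src e)} b
    ... | inj₁ k | inj₁ l = ⊥-elim (true≢false (trans (sym (proj₂ (B→ _ l))) (proj₂ (A→ _ k))))
    ... | inj₂ k | inj₂ l = ⊥-elim (true≢false (trans (sym (proj₂ (B→ _ l))) (proj₂ (A→ _ k))))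
    ... | inj₁ k | inj₂ l = ∧-intro (proj₁ (A→ _ k)) (proj₁ (B→ _ l)) , cong₂ _xor_ (proj₂ (A→ _ k)) (proj₂ (B→ _ l))
    ... | inj₂ k | inj₁ l = ∧-intro (proj₁ (B→ _ l)) (proj₁ (A→ _ k)) , cong₂ _xor_ (proj₂ (B→ _ l)) (proj₂ (A→ _ k))
    free : crosses X e₀ ≡ false → Psi R
    free c = glue part dis p q λ e z a b → ⊥-elim (absurd e z (two e a b))
      where
      absurd : ∀ e → E₀ e ≡ true → inside R e ≡ true × crosses X e ≡ true → ⊥
      absurd e z (i , k) with only e (∧-intro z i) k
      ... | refl = true≢false (trans (sym k) c)
    join : crosses X e₀ ≡ true → Psi R
    join c = go (±₃ (Psi.f p e₀) (Psi.f q e₀) (pz {A} p tA nA) (pz {B} q tB nB))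
      where
      pz : ∀ {Y} (p : Psi Y) → touches Y e₀ ≡ true → (inside Y e₀ ≡ true → ⊥) → Psi.f p e₀ ≢ 0F
      pz p t n = Psi.nz p e₀ z t (cases (Psi.C p e₀) (λ k → ⊥-elim (n (proj₂ (Psi.C⊆ p e₀ k)))) (λ k → k))
      ends-split : (A (src e₀) ≡ true × B (tgt e₀) ≡ true) ⊎ (B (src e₀) ≡ true × A (tgt e₀) ≡ true)
      ends-split with R (src e₀) | R (tgt e₀) | X (src e₀) | X (tgt e₀)
      ... | true | true | true | false = inj₂ (refl , refl)
      ... | true | true | false | true = inj₁ (refl , refl)
      tA : touches A e₀ ≡ true
      tA with ends-split
      ... | inj₁ (a , b) = ∨-introˡ a
      ... | inj₂ (a , b) = ∨-introʳ {A (src e₀)} b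
      tB : touches B e₀ ≡ true
      tB with ends-split
      ... | inj₁ (a , b) = ∨-introʳ {B (src e₀)} b
      ... | inj₂ (a , b) = ∨-introˡ a
      nA : inside A e₀ ≡ true → ⊥
      nA i = true≢false (trans (sym c) (cong₂ _xor_ (proj₂ (A→ _ (inside-at A {e₀} i (inj₁ refl)))) (proj₂ (A→ _ (inside-at A {e₀} i (inj₂ refl))))))
      nB : inside B e₀ ≡ true → ⊥
      nB i = true≢false (trans (sym c) (cong₂ _xor_ (proj₂ (B→ _ (inside-at B {e₀} i (inj₁ refl)))) (proj₂ (B→ _ (inside-at B {e₀} i (inj₂ refl))))))
      matching : ∀ (q' : Psi B) → Psi.f p e₀ ≡ Psi.f q' e₀ → ∀ e → E₀ e ≡ true → touches A e ≡ true → touches B e ≡ true → Psi.f p e ≡ Psi.f q' e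
      matching q' h e z a b with only e (∧-intro z (proj₁ (two e a b))) (proj₂ (two e a b))
      ... | refl = h
      go : (Psi.f p e₀ ≡ Psi.f q e₀) ⊎ (Psi.f p e₀ ≡ -₃ Psi.f q e₀) → Psi R
      go (inj₁ h) = glue part dis p q (matching q h)
      go (inj₂ h) = glue part dis p (negate q) (matching (negate q) h)

  in-parts : ∀ (R X : VSet) u w → R u ≡ true → R w ≡ true → X u ≡ true → X w ≡ false →
    card (R ∖ X) < card R × card (R ∖ (R ∖ X)) < card R
  in-parts R X u w ru rw xu xw =
      card-strict (λ v h → proj₁ (∧-true h)) u (trans (cong (λ b → R u ∧ not b) xu) (∧-zeroʳ (R u))) ru
    , card-strict (λ v h → proj₁ (∧-true h)) w (trans (cong₂ (λ a b → a ∧ not (a ∧ not b)) rw xw) refl) rw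

  -- If `e₁` and `e₂` leave `R` from one vertex, that vertex is enough; otherwise a cycle inside `R`
  -- through both of their ends in `R` is needed.
  core : ∀ {R} x → R x ≡ true → (∀ v → R v ≡ true → Walk G (λ e → E₀ e ∧ inside R e) x v) →
    (∀ e → E₀ e ∧ inside R e ≡ true → CycleThrough (λ e → E₀ e ∧ inside R e) e) →
    ∀ e₁ e₂ → crosses R e₁ ≡ true → crosses R e₂ ≡ true → Core R e₁ e₂
  core {R} x rx conn nb e₁ e₂ r₁ r₂ with xor-split R r₁ | xor-split R r₂
  ... | x₁ , y₁ , j₁ , p₁ , n₁ | x₂ , y₂ , j₂ , p₂ , n₂ with x₁ ≟ x₂
  ...   | yes refl = record { Q = ⟦ x₁ ⟧ ; D = λ _ → false ; q₀ = x₁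
          ; Q⊆R = λ v h → trans (cong R (sym (⌊≟⌋-true h))) p₁ ; q₀∈ = ⌊≟⌋-refl x₁ ; D⊆ = λ _ ()
          ; even = λ v → ∂₂.∂-0 {λ _ → false} v (λ _ _ → refl)
          ; conn = λ v h → subst (λ w → Σ (Spine x₁ w) λ p → edges p ⊆ (λ _ → false)) (⌊≟⌋-true h) ([] , λ _ ())
          ; c₁ = joins-crosses ⟦ x₁ ⟧ j₁ (⌊≟⌋-refl x₁) (⌊≟⌋-≢ λ { refl → true≢false (trans (sym p₁) n₁) })
          ; c₂ = joins-crosses ⟦ x₁ ⟧ j₂ (⌊≟⌋-refl x₁) (⌊≟⌋-≢ λ { refl → true≢false (trans (sym p₂) n₂) }) }
  ...   | no ne with two-vertex-cycle (λ e → E₀ e ∧ inside R e) nb ne (walk-++ (walk-sym (conn x₁ p₁)) (conn x₂ p₂))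
  ...     | C , cy , sub , i₁ , i₂ = record { Q = verts C ; D = C ; q₀ = x₁
          ; Q⊆R = Q⊆R
          ; q₀∈ = inc→verts C x₁ i₁
          ; D⊆ = λ e d → proj₁ (∧-true (sub e d)) , inside-intro (verts C) (λ v a → edge-verts C d a)
          ; even = cycle-even cy
          ; conn = joined
          ; c₁ = joins-crosses (verts C) j₁ (inc→verts C x₁ i₁) (out y₁ n₁)
          ; c₂ = joins-crosses (verts C) j₂ (inc→verts C x₂ i₂) (out y₂ n₂) }
    where
    Q⊆R : verts C ⊆ R
    Q⊆R v h with inc→edge v (verts→inc C v h)
    ... | e , c , a = inside-at R (proj₂ (∧-true {E₀ e} (sub e c))) a
    out : ∀ y → R y ≡ false → verts C y ≡ false
    out y n = cases (verts C y) (λ i → ⊥-elim (true≢false (trans (sym (Q⊆R y i)) n))) (λ k → k)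
    joined : ∀ v → verts C v ≡ true → Σ (Spine x₁ v) λ p → edges p ⊆ C
    joined v h with reach C x₁
    ... | r with Reach.spine r v (trans (sym (walk-closed (Reach.Q r) (Reach.closed r) (proj₁ (proj₂ cy) x₁ v i₁ (verts→inc C v h)))) (Reach.root r))
    ...   | p , t , _ = p , λ e i → Reach.T⊆S r e (t e i)

  -- Induction on the size of `R`. A bridge of `E₀` inside `R`, or a missing connection, splits `R`;
  -- without an edge leaving `R` a vertex is deleted; otherwise `bridgeless` provides a second
  -- leaving edge, and a core is removed.
  psi : ∀ k R → card R ≤ k → Psi R
  psi-step : ∀ k R x → R x ≡ true → card R ≤ suc k → Psi R
  psi k R le with search R
  ... | inj₂ none = empty none
  psi zero R le | inj₁ (x , rx) = ⊥-elim (<⇒≱ (subst (_≤ card R) (cong b2n rx) (term≤sumFin (b2n ∘ R) x)) le)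
  psi (suc k) R le | inj₁ (x , rx) = psi-step k R x rx le

  psi-step k R x rx le with search-⊎ {P = λ e → E₀ e ∧ inside R e ≡ true → CycleThrough (λ e → E₀ e ∧ inside R e) e}
      {Q = λ e₀ → E₀ e₀ ∧ inside R e₀ ≡ true × (∃[ X ] crosses X e₀ ≡ true × (∀ e → E₀ e ∧ inside R e ≡ true → crosses X e ≡ true → e₀ ≡ e))} decide
    where
    decide : ∀ e₀ → (E₀ e₀ ∧ inside R e₀ ≡ true → CycleThrough (λ e → E₀ e ∧ inside R e) e₀) ⊎
      (E₀ e₀ ∧ inside R e₀ ≡ true × (∃[ X ] crosses X e₀ ≡ true × (∀ e → E₀ e ∧ inside R e ≡ true → crosses X e ≡ true → e₀ ≡ e)))
    decide e₀ with split-bool (E₀ e₀ ∧ inside R e₀)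
    ... | inj₂ n = inj₁ λ s → ⊥-elim (true≢false (trans (sym s) n))
    ... | inj₁ s with cycle-or-cut (λ e → E₀ e ∧ inside R e) e₀
    ...   | inj₁ c = inj₁ λ _ → c
    ...   | inj₂ c = inj₂ (s , c)
  ... | inj₂ (e₀ , s , X , c , only) with xor-split X c
  ...   | u , w , j , xu , xw = split-at X e₀ only (proj₁ (∧-true s)) ins
            (psi k (R ∖ X) (s≤s⁻¹ (≤-trans (proj₁ small) le))) (psi k (R ∖ (R ∖ X)) (s≤s⁻¹ (≤-trans (proj₂ small) le)))
    where
    ins : inside R e₀ ≡ true
    ins = proj₂ (∧-true {E₀ e₀} s)
    small : card (R ∖ X) < card R × card (R ∖ (R ∖ X)) < card R
    small = in-parts R X u w (inside-at R ins (proj₁ (joins→at j))) (inside-at R ins (proj₂ (joins→at j))) xu xw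
  psi-step k R x rx le | inj₁ nb with reach (λ e → E₀ e ∧ inside R e) x
  ... | r with search (R ∖ Reach.Q r)
  ...   | inj₁ (w , h) = disconnected
    where
    X : VSet
    X = Reach.Q r
    small : card (R ∖ X) < card R × card (R ∖ (R ∖ X)) < card R
    small = in-parts R X x w rx (proj₁ (∧-true h)) (Reach.root r) (not-true (proj₂ (∧-true {R w} h)))
    p : Psi (R ∖ X)
    p = psi k (R ∖ X) (s≤s⁻¹ (≤-trans (proj₁ small) le))
    q : Psi (R ∖ (R ∖ X))
    q = psi k (R ∖ (R ∖ X)) (s≤s⁻¹ (≤-trans (proj₂ small) le))
    nocross : ∀ e → E₀ e ∧ inside R e ≡ true → crosses X e ≡ true → ⊥
    nocross e s c = true≢false (trans (sym c) (trans (cong (_xor X (tgt e)) (Reach.closed r e s)) (xor-same (X (tgt e)))))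
    disconnected : Psi R
    disconnected with search (λ e → E₀ e ∧ inside R e)
    ... | inj₁ (e₀ , s) = split-at X e₀ (λ e s c → ⊥-elim (nocross e s c)) (proj₁ (∧-true s)) (proj₂ (∧-true {E₀ e₀} s)) p q
    ... | inj₂ none = glue part dis p q λ e z a b → ⊥-elim (true≢false (trans (sym (∧-intro z (both e z a b))) (none e)))
      where
      part : ∀ v → R v ≡ (R ∖ X) v ∨ (R ∖ (R ∖ X)) v
      part v with R v | X v
      ... | true | true = refl
      ... | true | false = refl
      ... | false | _ = refl
      dis : ∀ v → (R ∖ X) v ≡ true → (R ∖ (R ∖ X)) v ≡ false
      dis v a with R v | X v
      ... | true | false = refl
      both : ∀ e → E₀ e ≡ true → touches (R ∖ X) e ≡ true → touches (R ∖ (R ∖ X)) e ≡ true → inside R e ≡ true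
      both e z a b with ∨-true {(R ∖ X) (src e)} a | ∨-true {(R ∖ (R ∖ X)) (src e)} b
      ... | inj₁ h | inj₁ l = ⊥-elim (true≢false (trans (sym l) (dis _ h)))
      ... | inj₂ h | inj₂ l = ⊥-elim (true≢false (trans (sym l) (dis _ h)))
      ... | inj₁ h | inj₂ l = ∧-intro (proj₁ (∧-true {R (src e)} h)) (proj₁ (∧-true {R (tgt e)} l))
      ... | inj₂ h | inj₁ l = ∧-intro (proj₁ (∧-true {R (src e)} l)) (proj₁ (∧-true {R (tgt e)} h))
  psi-step k R x rx le | inj₁ nb | r | inj₂ conn with search (λ e → E₀ e ∧ crosses R e)
  ...   | inj₂ none = isolated x rx none (psi k (R ∖ ⟦ x ⟧) (s≤s⁻¹ (≤-trans
            (card-strict (λ v h → proj₁ (∧-true h)) x (trans (cong (λ b → R x ∧ not b) (⌊≟⌋-refl x)) (∧-zeroʳ (R x))) rx) le)))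
  ...   | inj₁ (e₁ , h₁) with bridgeless R e₁ (proj₁ (∧-true h₁)) (proj₂ (∧-true {E₀ e₁} h₁))
  ...     | e₂ , z₂ , r₂ , ne = Extend.result (proj₁ (∧-true h₁)) z₂ ne r₁ r₂ co
            (psi k (R ∖ Core.Q co) (s≤s⁻¹ (≤-trans smaller le)))
    where
    r₁ : crosses R e₁ ≡ true
    r₁ = proj₂ (∧-true {E₀ e₁} h₁)
    reachable : ∀ v → R v ≡ true → Walk G (λ e → E₀ e ∧ inside R e) x v
    reachable v rv with Reach.spine r v (cases (Reach.Q r v) (λ q → q) (λ q → ⊥-elim (true≢false (trans (sym (∧-intro rv (not-intro q))) (conn v)))))
    ... | p , t , _ = walk-mono (λ e i → Reach.T⊆S r e (t e i)) (vis-walk p v (vis-end p))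
    co : Core R e₁ e₂
    co = core x rx reachable nb e₁ e₂ r₁ r₂
    smaller : card (R ∖ Core.Q co) < card R
    smaller = card-strict (λ v h → proj₁ (∧-true h)) (Core.q₀ co)
      (trans (cong (λ b → R (Core.q₀ co) ∧ not b) (Core.q₀∈ co)) (∧-zeroʳ (R (Core.q₀ co)))) (Core.Q⊆R co _ (Core.q₀∈ co))

  opaque
    six-flow : ∃[ C ] ∃[ f ] C ⊆ E₀ × Even C × (∀ e → E₀ e ≡ false → f e ≡ 0F) ×
      (∀ v → ∂ f v ≡ 0F) × (∀ e → E₀ e ≡ true → C e ≡ false → f e ≢ 0F)
    six-flow = C , f , (λ e c → proj₁ (C⊆ e c)) , even , (λ e z → supp e (cong (_∧ true) z)) , (λ v → cons₃ v refl) , (λ e z c → nz e z refl c)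
      where open Psi (psi (n G) (λ _ → true) (card-≤ (λ _ → true)))

-- From a flow over Z₃ to three even sets covering its support twice

module Transfer (G : Graph) (R S : CommutativeRing 0ℓ 0ℓ)
  (_~_ : CommutativeRing.Carrier R → CommutativeRing.Carrier S → Set)
  (0~0 : CommutativeRing.0# R ~ CommutativeRing.0# S)
  (+~+ : ∀ {x x' y y'} → x ~ y → x' ~ y' → CommutativeRing._+_ R x x' ~ CommutativeRing._+_ S y y')
  (-~- : ∀ {x y} → x ~ y → CommutativeRing.-_ R x ~ CommutativeRing.-_ S y)
  (resp : ∀ {x x' y y'} → CommutativeRing._≈_ R x x' → CommutativeRing._≈_ S y y' → x ~ y → x' ~ y') where
  open Incidence G
  private
    module R = RingSum R
    module S = RingSum S
    module BR = Boundary G R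
    module BS = Boundary G S

  opaque
    unfolding RingSum.∑
    ∑-~ : ∀ {k} {f : Fin k → R.Carrier} {g : Fin k → S.Carrier} → (∀ i → f i ~ g i) → R.∑ f ~ S.∑ g
    ∑-~ {zero}  h = 0~0
    ∑-~ {suc k} h = +~+ (h zero) (∑-~ (h ∘ suc))

  -- Incidence coefficients are 0 and ±1, so a relation compatible with zero, sums and negation
  -- suffices. It is applied to congruence modulo 3 and modulo 2, without a reduction map on the
  -- integers.
  ∂-~ : ∀ {f g} → (∀ e → f e ~ g e) → ∀ v → BR.∂ f v ~ BS.∂ g v
  ∂-~ {f} {g} h v = ∑-~ λ e → term e ⌊ src e ≟ v ⌋ ⌊ tgt e ≟ v ⌋
    where
    times-1 : ∀ (T : CommutativeRing 0ℓ 0ℓ) → let open RingSum T in ∀ x → x ≈ x ⊛ (1# ⊕ ⊖ 0#)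
    times-1 T x = ≈-sym (≈-trans (*-congˡ (≈-trans (+-congˡ -0#≈0#) (+-identityʳ _))) (*-identityʳ x))
      where open RingSum T
    times-−1 : ∀ (T : CommutativeRing 0ℓ 0ℓ) → let open RingSum T in ∀ x → ⊖ x ≈ x ⊛ (0# ⊕ ⊖ 1#)
    times-−1 T x = ≈-sym (≈-trans (*-congˡ (+-identityˡ _)) (≈-trans (≈-sym (⊖-distribʳ x 1#)) (-‿cong (*-identityʳ x))))
      where open RingSum T
    times-0 : ∀ (T : CommutativeRing 0ℓ 0ℓ) → let open RingSum T in ∀ x y → 0# ≈ x ⊛ (y ⊕ ⊖ y)
    times-0 T x y = ≈-sym (≈-trans (*-congˡ (-‿inverseʳ y)) (zeroʳ x))
      where open RingSum T
    term : ∀ e a b → (f e R.⊛ (R.ind a R.⊕ R.⊖ R.ind b)) ~ (g e S.⊛ (S.ind a S.⊕ S.⊖ S.ind b))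
    term e true  true  = resp (times-0 R (f e) _) (times-0 S (g e) _) 0~0
    term e true  false = resp (times-1 R (f e)) (times-1 S (g e)) (h e)
    term e false true  = resp (times-−1 R (f e)) (times-−1 S (g e)) (-~- (h e))
    term e false false = resp (times-0 R (f e) _) (times-0 S (g e) _) 0~0

≡-resp : ∀ {A B : Set} {_~_ : A → B → Set} {x x' y y'} → x ≡ x' → y ≡ y' → x ~ y → x' ~ y'
≡-resp refl refl p = p

ℤRing : CommutativeRing 0ℓ 0ℓ
ℤRing = ℤP.+-*-commutativeRing

pattern -1ℤ = ℤ.-[1+ 0 ]
pattern -2ℤ = ℤ.-[1+ 1 ]

lift₃ : F₃ → ℤ
lift₃ 0F = ℤ.+ 0
lift₃ 1F = ℤ.+ 1
lift₃ 2F = -1ℤ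

liftᵇ : Bool → ℤ
liftᵇ false = ℤ.+ 0
liftᵇ true  = ℤ.+ 1

_~₃_ : ℤ → F₃ → Set
x ~₃ y = ∃[ q ] x ≡ ((q ℤ.+ q) ℤ.+ q) ℤ.+ lift₃ y

_~₂_ : ℤ → Bool → Set
x ~₂ b = ∃[ q ] x ≡ (q ℤ.+ q) ℤ.+ liftᵇ b

module _ where
  open import Data.Integer using () renaming (_+_ to _⊞_; -_ to ⊟_)
  open import Data.Integer.Tactic.RingSolver using (solve-∀)

  private
    add₃ : ∀ p q a b c k → a ⊞ b ≡ c ⊞ (k ⊞ k ⊞ k) → (p ⊞ p ⊞ p ⊞ a) ⊞ (q ⊞ q ⊞ q ⊞ b) ≡ (p ⊞ q ⊞ k) ⊞ (p ⊞ q ⊞ k) ⊞ (p ⊞ q ⊞ k) ⊞ c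
    add₃ p q a b c k h = trans (regroup p q a b) (trans (cong ((p ⊞ q) ⊞ (p ⊞ q) ⊞ (p ⊞ q) ⊞_) h) (final p q c k))
      where
      regroup : ∀ p q a b → (p ⊞ p ⊞ p ⊞ a) ⊞ (q ⊞ q ⊞ q ⊞ b) ≡ (p ⊞ q) ⊞ (p ⊞ q) ⊞ (p ⊞ q) ⊞ (a ⊞ b)
      regroup = solve-∀
      final : ∀ p q c k → (p ⊞ q) ⊞ (p ⊞ q) ⊞ (p ⊞ q) ⊞ (c ⊞ (k ⊞ k ⊞ k)) ≡ (p ⊞ q ⊞ k) ⊞ (p ⊞ q ⊞ k) ⊞ (p ⊞ q ⊞ k) ⊞ c
      final = solve-∀
    add₂ : ∀ p q a b c k → a ⊞ b ≡ c ⊞ (k ⊞ k) → (p ⊞ p ⊞ a) ⊞ (q ⊞ q ⊞ b) ≡ (p ⊞ q ⊞ k) ⊞ (p ⊞ q ⊞ k) ⊞ c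
    add₂ p q a b c k h = trans (regroup p q a b) (trans (cong ((p ⊞ q) ⊞ (p ⊞ q) ⊞_) h) (final p q c k))
      where
      regroup : ∀ p q a b → (p ⊞ p ⊞ a) ⊞ (q ⊞ q ⊞ b) ≡ (p ⊞ q) ⊞ (p ⊞ q) ⊞ (a ⊞ b)
      regroup = solve-∀
      final : ∀ p q c k → (p ⊞ q) ⊞ (p ⊞ q) ⊞ (c ⊞ (k ⊞ k)) ≡ (p ⊞ q ⊞ k) ⊞ (p ⊞ q ⊞ k) ⊞ c
      final = solve-∀
    neg₃ : ∀ p a → ⊟ (p ⊞ p ⊞ p ⊞ a) ≡ ⊟ p ⊞ ⊟ p ⊞ ⊟ p ⊞ ⊟ a
    neg₃ = solve-∀
    neg₂ : ∀ p a → ⊟ (p ⊞ p ⊞ a) ≡ (⊟ p ⊞ ⊟ a) ⊞ (⊟ p ⊞ ⊟ a) ⊞ a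
    neg₂ = solve-∀
    carry₃ : ∀ a b → ∃[ k ] lift₃ a ⊞ lift₃ b ≡ lift₃ (a +₃ b) ⊞ (k ⊞ k ⊞ k)
    carry₃ 0F 0F = ℤ.+ 0 , refl
    carry₃ 0F 1F = ℤ.+ 0 , refl
    carry₃ 0F 2F = ℤ.+ 0 , refl
    carry₃ 1F 0F = ℤ.+ 0 , refl
    carry₃ 1F 1F = ℤ.+ 1 , refl
    carry₃ 1F 2F = ℤ.+ 0 , refl
    carry₃ 2F 0F = ℤ.+ 0 , refl
    carry₃ 2F 1F = ℤ.+ 0 , refl
    carry₃ 2F 2F = -1ℤ , refl
    carry₂ : ∀ a b → ∃[ k ] liftᵇ a ⊞ liftᵇ b ≡ liftᵇ (a xor b) ⊞ (k ⊞ k)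
    carry₂ false false = ℤ.+ 0 , refl
    carry₂ false true  = ℤ.+ 0 , refl
    carry₂ true  false = ℤ.+ 0 , refl
    carry₂ true  true  = ℤ.+ 1 , refl
    minus₃ : ∀ a → ⊟ lift₃ a ≡ lift₃ (-₃ a)
    minus₃ 0F = refl
    minus₃ 1F = refl
    minus₃ 2F = refl

  ~₃-+ : ∀ {x x' y y'} → x ~₃ y → x' ~₃ y' → (x ⊞ x') ~₃ (y +₃ y')
  ~₃-+ {y = y} {y'} (p , refl) (q , refl) =
    p ⊞ q ⊞ proj₁ (carry₃ y y') , add₃ p q (lift₃ y) (lift₃ y') (lift₃ (y +₃ y')) _ (proj₂ (carry₃ y y'))

  ~₃-neg : ∀ {x y} → x ~₃ y → (⊟ x) ~₃ (-₃ y)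
  ~₃-neg {y = y} (p , refl) = ⊟ p , trans (neg₃ p (lift₃ y)) (cong (⊟ p ⊞ ⊟ p ⊞ ⊟ p ⊞_) (minus₃ y))

  ~₂-+ : ∀ {x x' y y'} → x ~₂ y → x' ~₂ y' → (x ⊞ x') ~₂ (y xor y')
  ~₂-+ {y = y} {y'} (p , refl) (q , refl) =
    p ⊞ q ⊞ proj₁ (carry₂ y y') , add₂ p q (liftᵇ y) (liftᵇ y') (liftᵇ (y xor y')) _ (proj₂ (carry₂ y y'))

  ~₂-neg : ∀ {x y} → x ~₂ y → (⊟ x) ~₂ y
  ~₂-neg {y = y} (p , refl) = ⊟ p ⊞ ⊟ liftᵇ y , neg₂ p (liftᵇ y)

  double-0 : ∀ (x : ℤ) → x ⊞ x ≡ ℤ.+ 0 → x ≡ ℤ.+ 0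
  double-0 (ℤ.+ zero) h = refl

  ~₂-0 : ∀ {b} → (ℤ.+ 0) ~₂ b → b ≡ false
  ~₂-0 {false} _ = refl
  ~₂-0 {true} (ℤ.+ zero , ())
  ~₂-0 {true} (ℤ.+ suc k , ())
  ~₂-0 {true} (ℤ.-[1+ k ] , ())

  ~₃-0 : ∀ {y} → (ℤ.+ 0) ~₃ y → y ≡ 0F
  ~₃-0 {0F} _ = refl
  ~₃-0 {1F} (ℤ.+ zero , ())
  ~₃-0 {1F} (ℤ.+ suc k , ())
  ~₃-0 {1F} (ℤ.-[1+ k ] , ())
  ~₃-0 {2F} (ℤ.+ zero , ())
  ~₃-0 {2F} (ℤ.+ suc k , h) rewrite NP.+-suc (k + suc k) k | NP.+-suc k k = case h of λ ()
  ~₃-0 {2F} (ℤ.-[1+ k ] , ())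

-- Stages of turning y ∈ Z₃ into an integer in {0, ±1, ±2} congruent to it; the flag marks the unfinished ones.
data Stage : F₃ → ℤ → Bool → Set where
  zero-done  : Stage 0F (ℤ.+ 0) false
  one-done   : Stage 1F (ℤ.+ 1) false
  one-0      : Stage 1F (ℤ.+ 0) true
  one--1     : Stage 1F -1ℤ true
  one--2     : Stage 1F -2ℤ false
  two-done   : Stage 2F -1ℤ false
  two-0      : Stage 2F (ℤ.+ 0) true
  two-1      : Stage 2F (ℤ.+ 1) true
  two-2      : Stage 2F (ℤ.+ 2) false

start-stage : ∀ y → ∃[ b ] Stage y (ℤ.+ 0) b
start-stage 0F = false , zero-done
start-stage 1F = true , one-0
start-stage 2F = true , two-0

stage-unique : ∀ {y x b c} → Stage y x b → Stage y x c → b ≡ c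
stage-unique zero-done zero-done = refl
stage-unique one-done one-done = refl
stage-unique one-0 one-0 = refl
stage-unique one--1 one--1 = refl
stage-unique one--2 one--2 = refl
stage-unique two-done two-done = refl
stage-unique two-0 two-0 = refl
stage-unique two-1 two-1 = refl
stage-unique two-2 two-2 = refl

-- The targets are two integers congruent to `y` at distance 3 (1 and -2, or -1 and 2). An
-- unfinished value lies strictly between them, so a unit step cannot overshoot, and one of the two
-- directions reaches a target.
move : ∀ {y x} → Stage y x true → ∀ t → (t ≡ ℤ.+ 1 ⊎ t ≡ -1ℤ) → ∃[ b ] Stage y (x ℤ.+ t) b
move one-0 _ (inj₁ refl) = _ , one-done
move one-0 _ (inj₂ refl) = _ , one--1
move one--1 _ (inj₁ refl) = _ , one-0
move one--1 _ (inj₂ refl) = _ , one--2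
move two-0 _ (inj₁ refl) = _ , two-1
move two-0 _ (inj₂ refl) = _ , two-done
move two-1 _ (inj₁ refl) = _ , two-2
move two-1 _ (inj₂ refl) = _ , two-0

finish : ∀ {y x} → Stage y x true → Stage y (x ℤ.+ ℤ.+ 1) false ⊎ Stage y (x ℤ.+ -1ℤ) false
finish one-0  = inj₁ one-done
finish one--1 = inj₂ one--2
finish two-0  = inj₂ two-done
finish two-1  = inj₁ two-2

-- Identifies the unfinished edges with the support of a difference of two `F₃`-flows.
residue : ∀ {y x b} → Stage y x b → ∃[ r ] x ~₃ r × (b ≡ false → y +₃ (-₃ r) ≡ 0F) × (b ≡ true → y +₃ (-₃ r) ≢ 0F)
residue zero-done = 0F , (ℤ.+ 0 , refl) , (λ _ → refl) , λ ()
residue one-done  = 1F , (ℤ.+ 0 , refl) , (λ _ → refl) , λ ()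
residue one-0     = 0F , (ℤ.+ 0 , refl) , (λ ()) , λ _ ()
residue one--1    = 2F , (ℤ.+ 0 , refl) , (λ ()) , λ _ ()
residue one--2    = 1F , (-1ℤ , refl) , (λ _ → refl) , λ ()
residue two-done  = 2F , (ℤ.+ 0 , refl) , (λ _ → refl) , λ ()
residue two-0     = 0F , (ℤ.+ 0 , refl) , (λ ()) , λ _ ()
residue two-1     = 1F , (ℤ.+ 0 , refl) , (λ ()) , λ _ ()
residue two-2     = 2F , (ℤ.+ 1 , refl) , (λ _ → refl) , λ ()

nonzero : F₃ → Bool
nonzero 0F = false
nonzero (suc _) = true

data Two : Bool → Bool → Bool → Bool → Set where
  neither : Two false false false false
  ab   : Two true true true false
  ac   : Two true true false true
  bc   : Two true false true true

module ThreeEven (G : Graph) (loopless : Loopless G) where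
  open Decomposition G loopless
  private
    module F₃F = Flow G loopless F₃Ring
    module ℤF  = Flow G loopless ℤRing
    module T₃ = Transfer G ℤRing F₃Ring _~₃_ (ℤ.+ 0 , refl) ~₃-+ ~₃-neg ≡-resp
    module T₂ = Transfer G ℤRing BoolRing _~₂_ (ℤ.+ 0 , refl) ~₂-+ ~₂-neg ≡-resp

  module _ (f : E → F₃) (f-cons : ∀ v → F₃F.∂ f v ≡ 0F) where

    record Partial : Set where
      field
        φ     : E → ℤ
        open? : ESet
        stage : ∀ e → Stage (f e) (φ e) (open? e)
        φ-cons : ∀ v → ℤF.∂ φ v ≡ ℤ.+ 0

    -- The flow `f` minus `φ` modulo 3 is conserved and is non-zero exactly on the unfinished edges,
    -- so none of these is a bridge among them.
    residual-cycle : (p : Partial) → ∀ e₀ → Partial.open? p e₀ ≡ true → CycleThrough (Partial.open? p) e₀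
    residual-cycle p e₀ o with cycle-or-cut (Partial.open? p) e₀
    ... | inj₁ c = c
    ... | inj₂ (X , cr , only) = ⊥-elim (proj₂ (proj₂ (proj₂ (residue (stage e₀)))) o
            (F₃F.∂-bridge X (λ e → f e +₃ (-₃ r e)) e₀ (λ v _ → r-cons v) cr other))
      where
      open Partial p
      r : E → F₃
      r e = proj₁ (residue (stage e))
      r-cons : ∀ v → F₃F.∂ (λ e → f e +₃ (-₃ r e)) v ≡ 0F
      r-cons v = trans (F₃F.∂-⊕ f (λ e → -₃ r e) v) (cong₂ _+₃_ (f-cons v)
        (trans (F₃F.∂-⊖ r v) (cong -₃_ (~₃-0 (subst (_~₃ F₃F.∂ r v) (φ-cons v) (T₃.∂-~ (λ e → proj₁ (proj₂ (residue (stage e)))) v))))))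
      other : ∀ e → crosses X e ≡ true → e₀ ≢ e → f e +₃ (-₃ r e) ≡ 0F
      other e c ne = proj₁ (proj₂ (proj₂ (residue (stage e)))) (cases (open? e) (λ s → ⊥-elim (ne (only e s c))) (λ s → s))

    -- One unit is sent around a cycle of unfinished edges, in the direction that finishes `e₀`. The
    -- other edges of the cycle stay between their targets and finished edges are not touched, so
    -- the number of unfinished edges drops.
    rotate : (p : Partial) → ∀ e₀ → Partial.open? p e₀ ≡ true → Σ Partial λ q → card (Partial.open? q) < card (Partial.open? p)
    rotate p e₀ o = record { φ = φ' ; open? = λ e → proj₁ (new e) ; stage = λ e → proj₁ (proj₂ (new e)) ; φ-cons = cons' }
      , card-strict (λ e → proj₂ (proj₂ (new e))) e₀ (stage-unique (proj₁ (proj₂ (new e₀))) (proj₂ (proj₂ (proj₂ turn)))) o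
      where
      open Partial p
      ct : CycleThrough open? e₀
      ct = residual-cycle p e₀ o
      open CycleThrough ct using (D; e₀∈; D⊆)
      γ : E → ℤ
      γ = ℤF.circulation ct
      neg-unit : ∀ {x} → ℤF.Unit x → ℤF.Unit (ℤ.- x)
      neg-unit (inj₁ refl) = inj₂ refl
      neg-unit (inj₂ refl) = inj₁ refl
      turn : Σ (E → ℤ) λ γ' → (∀ v → ℤF.∂ γ' v ≡ ℤ.+ 0) × ℤF.UnitOn D γ' × Stage (f e₀) (φ e₀ ℤ.+ γ' e₀) false
      turn = choose (finish (subst (Stage (f e₀) (φ e₀)) o (stage e₀))) (proj₁ (ℤF.circulation-unit ct e₀) e₀∈)
        where
        keep : Stage (f e₀) (φ e₀ ℤ.+ γ e₀) false → Σ (E → ℤ) λ γ' → (∀ v → ℤF.∂ γ' v ≡ ℤ.+ 0) × ℤF.UnitOn D γ' × Stage (f e₀) (φ e₀ ℤ.+ γ' e₀) false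
        keep s = γ , ℤF.circulation-∂ ct , ℤF.circulation-unit ct , s
        flip : Stage (f e₀) (φ e₀ ℤ.+ ℤ.- γ e₀) false → Σ (E → ℤ) λ γ' → (∀ v → ℤF.∂ γ' v ≡ ℤ.+ 0) × ℤF.UnitOn D γ' × Stage (f e₀) (φ e₀ ℤ.+ γ' e₀) false
        flip s = (λ e → ℤ.- γ e) , (λ v → trans (ℤF.∂-⊖ γ v) (cong ℤ.-_ (ℤF.circulation-∂ ct v)))
          , (λ e → (λ d → neg-unit (proj₁ (ℤF.circulation-unit ct e) d)) , (λ d → cong ℤ.-_ (proj₂ (ℤF.circulation-unit ct e) d))) , s
        choose : (Stage (f e₀) (φ e₀ ℤ.+ ℤ.+ 1) false ⊎ Stage (f e₀) (φ e₀ ℤ.+ -1ℤ) false) → ℤF.Unit (γ e₀) → Σ (E → ℤ) λ γ' → (∀ v → ℤF.∂ γ' v ≡ ℤ.+ 0) × ℤF.UnitOn D γ' × Stage (f e₀) (φ e₀ ℤ.+ γ' e₀) false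
        choose (inj₁ s) (inj₁ u) = keep (subst (λ t → Stage (f e₀) (φ e₀ ℤ.+ t) false) (sym u) s)
        choose (inj₂ s) (inj₂ u) = keep (subst (λ t → Stage (f e₀) (φ e₀ ℤ.+ t) false) (sym u) s)
        choose (inj₁ s) (inj₂ u) = flip (subst (λ t → Stage (f e₀) (φ e₀ ℤ.+ ℤ.- t) false) (sym u) s)
        choose (inj₂ s) (inj₁ u) = flip (subst (λ t → Stage (f e₀) (φ e₀ ℤ.+ ℤ.- t) false) (sym u) s)
      φ' : E → ℤ
      φ' e = φ e ℤ.+ proj₁ turn e
      new : ∀ e → ∃[ b ] Stage (f e) (φ' e) b × (b ≡ true → open? e ≡ true)
      new e = cases (D e)
        (λ d → let s = move (subst (Stage (f e) (φ e)) (D⊆ o e d) (stage e)) (proj₁ turn e) (proj₁ (proj₁ (proj₂ (proj₂ turn)) e) d) in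
               proj₁ s , proj₂ s , λ _ → D⊆ o e d)
        (λ d → open? e , subst (λ x → Stage (f e) x (open? e)) (sym (trans (cong (λ t → φ e ℤ.+ t) (proj₂ (proj₁ (proj₂ (proj₂ turn)) e) d)) (ℤP.+-identityʳ (φ e)))) (stage e) , λ b → b)
      cons' : ∀ v → ℤF.∂ φ' v ≡ ℤ.+ 0
      cons' v = trans (ℤF.∂-⊕ φ (proj₁ turn) v) (cong₂ ℤ._+_ (φ-cons v) (proj₁ (proj₂ turn) v))

    integer-flow : ∃[ φ ] (∀ e → Stage (f e) (φ e) false) × (∀ v → ℤF.∂ φ v ≡ ℤ.+ 0)
    integer-flow = run (m G) initial (card-≤ _)
      where
      initial : Partial
      initial = record { φ = λ _ → ℤ.+ 0 ; open? = λ e → proj₁ (start-stage (f e)) ; stage = λ e → proj₂ (start-stage (f e))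
                       ; φ-cons = λ v → ℤF.∂-0 {λ _ → ℤ.+ 0} v (λ _ _ → refl) }
      run : ∀ k (p : Partial) → card (Partial.open? p) ≤ k → ∃[ φ ] (∀ e → Stage (f e) (φ e) false) × (∀ v → ℤF.∂ φ v ≡ ℤ.+ 0)
      run k p le with search (Partial.open? p)
      ... | inj₂ done = Partial.φ p , (λ e → subst (Stage (f e) (Partial.φ p e)) (done e) (Partial.stage p e)) , Partial.φ-cons p
      run zero p le | inj₁ (e₀ , o) = ⊥-elim (<⇒≱ (proj₂ (rotate p e₀ o)) (≤-trans le z≤n))
      run (suc k) p le | inj₁ (e₀ , o) = run k (proj₁ (rotate p e₀ o)) (s≤s⁻¹ (≤-trans (proj₂ (rotate p e₀ o)) le))

    oddℤ : ℤ → Bool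
    oddℤ x = odd ℤ.∣ x ∣

    half : ℤ → ℤ
    half (ℤ.+ 2) = ℤ.+ 1
    half -2ℤ     = -1ℤ
    half _       = ℤ.+ 0

    stage-parity : ∀ {y x} → Stage y x false → x ~₂ oddℤ x
    stage-parity zero-done = ℤ.+ 0 , refl
    stage-parity one-done = ℤ.+ 0 , refl
    stage-parity one--2 = -1ℤ , refl
    stage-parity two-done = -1ℤ , refl
    stage-parity two-2 = ℤ.+ 1 , refl

    -- ψ = (φ + g)/2 for an orientation g of the odd part of φ
    halving : ∀ {y x} t → Stage y x false → (oddℤ x ≡ true → ℤF.Unit t) → (oddℤ x ≡ false → t ≡ ℤ.+ 0) →
      (x ℤ.+ t ≡ half (x ℤ.+ t) ℤ.+ half (x ℤ.+ t)) × (half (x ℤ.+ t) ~₂ oddℤ (half (x ℤ.+ t))) ×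
      Two (nonzero y) (oddℤ x) (oddℤ (half (x ℤ.+ t))) (oddℤ x xor oddℤ (half (x ℤ.+ t)))
    halving t zero-done u z rewrite z refl = refl , (ℤ.+ 0 , refl) , neither
    halving t one--2 u z rewrite z refl = refl , (-1ℤ , refl) , bc
    halving t two-2 u z rewrite z refl = refl , (ℤ.+ 0 , refl) , bc
    halving t one-done u z with u refl
    ... | inj₁ refl = refl , (ℤ.+ 0 , refl) , ab
    ... | inj₂ refl = refl , (ℤ.+ 0 , refl) , ac
    halving t two-done u z with u refl
    ... | inj₁ refl = refl , (ℤ.+ 0 , refl) , ac
    ... | inj₂ refl = refl , (-1ℤ , refl) , ab

    private
      Doubly : Set
      Doubly = ∃[ A ] ∃[ B ] ∃[ C ] Even A × Even B × Even C × (∀ e → Two (nonzero (f e)) (A e) (B e) (C e))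

      from-integer-flow : ∃[ φ ] (∀ e → Stage (f e) (φ e) false) × (∀ v → ℤF.∂ φ v ≡ ℤ.+ 0) → Doubly
      from-integer-flow (φ , st , φ-cons) = A , B , A △ B , evA , evB , even-△ evA evB , (λ e → proj₂ (proj₂ (halves e)))
        where
        A : ESet
        A e = oddℤ (φ e)
        evA : Even A
        evA v = ~₂-0 (subst (_~₂ ∂₂.∂ A v) (φ-cons v) (T₂.∂-~ (λ e → stage-parity (st e)) v))
        oriented : ∃[ g ] (∀ v → ℤF.∂ g v ≡ ℤ.+ 0) × ℤF.UnitOn A g
        oriented = ℤF.orient evA
        g : E → ℤ
        g = proj₁ oriented
        ψ : E → ℤ
        ψ e = half (φ e ℤ.+ g e)
        B : ESet
        B e = oddℤ (ψ e)
        halves : ∀ e → (φ e ℤ.+ g e ≡ ψ e ℤ.+ ψ e) × (ψ e ~₂ oddℤ (ψ e)) × Two (nonzero (f e)) (A e) (B e) (A e xor B e)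
        halves e = halving (g e) (st e) (proj₁ (proj₂ (proj₂ oriented) e)) (proj₂ (proj₂ (proj₂ oriented) e))
        ψ-cons : ∀ v → ℤF.∂ ψ v ≡ ℤ.+ 0
        -- Twice `ψ` is the conserved sum `φ + g`, and the integers have no 2-torsion.
        ψ-cons v = double-0 (ℤF.∂ ψ v) (trans (sym (ℤF.∂-⊕ ψ ψ v)) (trans (sym (ℤF.∂-cong (λ e → proj₁ (halves e)) v))
          (trans (ℤF.∂-⊕ φ g v) (cong₂ ℤ._+_ (φ-cons v) (proj₁ (proj₂ oriented) v)))))
        evB : Even B
        evB v = ~₂-0 (subst (_~₂ ∂₂.∂ B v) (ψ-cons v) (T₂.∂-~ (λ e → proj₁ (proj₂ (halves e))) v))

    opaque
      three-even : ∃[ A ] ∃[ B ] ∃[ C ] Even A × Even B × Even C × (∀ e → Two (nonzero (f e)) (A e) (B e) (C e))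
      three-even = from-integer-flow integer-flow

-- A cycle cover of length at most 5/3 of a bridgeless edge set

-- Averaging: if no list met the bound, each would contribute at least `suc B` to three times the
-- total.
pick-short : ∀ (G : Graph) B (Ls : List (List (EdgeSet G))) →
  3 * coverLength G (concat Ls) < Data.List.length Ls * suc B → Any (λ L → 3 * coverLength G L ≤ B) Ls
pick-short G B (L ∷ Ls) h with 3 * coverLength G L ≤? B
... | yes p = here p
... | no ¬p = there (pick-short G B Ls (NP.+-cancelˡ-< (suc B) _ _ (≤-<-trans step h)))
  where
  step : suc B + 3 * coverLength G (concat Ls) ≤ 3 * coverLength G (L ++ concat Ls)
  step rewrite size-++ G L (concat Ls) | NP.*-distribˡ-+ 3 (coverLength G L) (coverLength G (concat Ls)) =
    NP.+-monoˡ-≤ _ (NP.≰⇒> ¬p)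

coverLength-sum : ∀ (G : Graph) L → coverLength G L ≡ sumFin (λ e → sum (map (λ S → b2n (S e)) L))
coverLength-sum G [] = sym (sumFin-0 {m G})
coverLength-sum G (S ∷ L) = trans (cong (size G S +_) (coverLength-sum G L)) (sym (sumFin-+ (b2n ∘ S) _))

module Covers (G : Graph) (C A B D : EdgeSet G) where
  -- An edge of the support lies in two of `A`, `B`, `D`, hence in one of any two of them. An edge
  -- of `C` outside the support is caught by `C` or by the symmetric difference.
  six : List (List (EdgeSet G))
  six = (C ∷ A ∷ B ∷ []) ∷ (C ∷ A ∷ D ∷ []) ∷ (C ∷ B ∷ D ∷ [])
      ∷ (A ∷ B ∷ (λ e → C e xor D e) ∷ []) ∷ (A ∷ D ∷ (λ e → C e xor B e) ∷ []) ∷ (B ∷ D ∷ (λ e → C e xor A e) ∷ []) ∷ []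

  -- How often the six lists together use an edge, by membership in `C` and in the support. Outside
  -- the support an edge of `C` is met by the three copies of `C` and the three differences, 6
  -- times; a support edge is met 12 times on `C` and 10 times off it.
  weight : Bool → Bool → ℕ
  weight true  true  = 12
  weight true  false = 6
  weight false true  = 10
  weight false false = 0

  six-weight : ∀ e s → Two s (A e) (B e) (D e) →
    sum (map (λ S → b2n (S e)) (concat six)) ≡ weight (C e) s
  six-weight e s t with A e | B e | D e | C e | t
  ... | _ | _ | _ | true  | neither = refl
  ... | _ | _ | _ | false | neither = refl
  ... | _ | _ | _ | true  | ab = refl
  ... | _ | _ | _ | false | ab = refl
  ... | _ | _ | _ | true  | ac = refl
  ... | _ | _ | _ | false | ac = refl
  ... | _ | _ | _ | true  | bc = refl
  ... | _ | _ | _ | false | bc = refl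

  six-covers : ∀ e s → Two s (A e) (B e) (D e) → C e ∨ s ≡ true → All (λ L → Any (λ S → S e ≡ true) L) six
  six-covers e s t h = lem (A e) (B e) (D e) (C e) t h
    where
    two-of : ∀ {X Y Z : EdgeSet G} {b} → X e ∨ (Y e ∨ Z e) ≡ b → b ≡ true → Any (λ S → S e ≡ true) (X ∷ Y ∷ Z ∷ [])
    two-of {X} {Y} {Z} p q with ∨-true {X e} (trans p q)
    ... | inj₁ k = here k
    ... | inj₂ k with ∨-true {Y e} k
    ...   | inj₁ l = there (here l)
    ...   | inj₂ l = there (there (here l))
    lem : ∀ a b d c → Two s a b d → c ∨ s ≡ true →
      {{A e ≡ a}} → {{B e ≡ b}} → {{D e ≡ d}} → {{C e ≡ c}} → All (λ L → Any (λ S → S e ≡ true) L) six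
    lem a b d c t h {{pa}} {{pb}} {{pd}} {{pc}} =
        two-of {C} {A} {B} (cong₂ _∨_ pc (cong₂ _∨_ pa pb)) (l₁ c t h)
      ∷ two-of {C} {A} {D} (cong₂ _∨_ pc (cong₂ _∨_ pa pd)) (l₂ c t h)
      ∷ two-of {C} {B} {D} (cong₂ _∨_ pc (cong₂ _∨_ pb pd)) (l₃ c t h)
      ∷ two-of {A} {B} {λ e → C e xor D e} (cong₂ _∨_ pa (cong₂ _∨_ pb (cong₂ _xor_ pc pd))) (l₄ c t h)
      ∷ two-of {A} {D} {λ e → C e xor B e} (cong₂ _∨_ pa (cong₂ _∨_ pd (cong₂ _xor_ pc pb))) (l₅ c t h)
      ∷ two-of {B} {D} {λ e → C e xor A e} (cong₂ _∨_ pb (cong₂ _∨_ pd (cong₂ _xor_ pc pa))) (l₆ c t h)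
      ∷ []
      where
      l₁ : ∀ {s a b d} c → Two s a b d → c ∨ s ≡ true → c ∨ (a ∨ b) ≡ true
      l₁ true _ _ = refl
      l₁ false ab _ = refl
      l₁ false ac _ = refl
      l₁ false bc _ = refl
      l₂ : ∀ {s a b d} c → Two s a b d → c ∨ s ≡ true → c ∨ (a ∨ d) ≡ true
      l₂ true _ _ = refl
      l₂ false ab _ = refl
      l₂ false ac _ = refl
      l₂ false bc _ = refl
      l₃ : ∀ {s a b d} c → Two s a b d → c ∨ s ≡ true → c ∨ (b ∨ d) ≡ true
      l₃ true _ _ = refl
      l₃ false ab _ = refl
      l₃ false ac _ = refl
      l₃ false bc _ = refl
      l₄ : ∀ {s a b d} c → Two s a b d → c ∨ s ≡ true → a ∨ (b ∨ (c xor d)) ≡ true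
      l₄ true neither _ = refl
      l₄ _ ab _ = refl
      l₄ _ ac _ = refl
      l₄ _ bc _ = refl
      l₅ : ∀ {s a b d} c → Two s a b d → c ∨ s ≡ true → a ∨ (d ∨ (c xor b)) ≡ true
      l₅ true neither _ = refl
      l₅ _ ab _ = refl
      l₅ _ ac _ = refl
      l₅ _ bc _ = refl
      l₆ : ∀ {s a b d} c → Two s a b d → c ∨ s ≡ true → b ∨ (d ∨ (c xor a)) ≡ true
      l₆ true neither _ = refl
      l₆ _ ab _ = refl
      l₆ _ ac _ = refl
      l₆ _ bc _ = refl

module FiveThirds (G : Graph) (loopless : Loopless G)
               (deg≤3 : MaxDegree3 G)
               (E₀ : EdgeSet G)
               (bridgeless : Bridgeless G E₀) where
  open Decomposition G loopless
  private
    module F₃F = Flow G loopless F₃Ring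

  EvenCover : List ESet → Set
  EvenCover L = All (λ S → Even S × S ⊆ E₀) L × (∀ e → E₀ e ≡ true → Any (λ S → S e ≡ true) L)

  -- Adding multiples of an orientation g of C to the flow f makes each edge of C vanish for exactly one multiple.
  module Average (C : ESet) (C⊆ : C ⊆ E₀) (evC : Even C) (f g : E → F₃)
    (f-off : ∀ e → E₀ e ≡ false → f e ≡ 0F) (f-cons : ∀ v → F₃F.∂ f v ≡ 0F) (g-cons : ∀ v → F₃F.∂ g v ≡ 0F)
    (g-unit : F₃F.UnitOn C g) (nz : ∀ e → E₀ e ≡ true → C e ≡ false → f e ≢ 0F) where

    fⱼ : F₃ → E → F₃
    fⱼ j e = f e +₃ j *₃ g e

    fⱼ-cons : ∀ j v → F₃F.∂ (fⱼ j) v ≡ 0F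
    fⱼ-cons j v = trans (F₃F.∂-⊕ f (λ e → j *₃ g e) v) (cong₂ _+₃_ (f-cons v)
      (trans (F₃F.∂-⊛ j g v) (trans (cong (j *₃_) (g-cons v)) (F₃F.zeroʳ j))))

    A B D : F₃ → ESet
    A j = proj₁ (ThreeEven.three-even G loopless (fⱼ j) (fⱼ-cons j))
    B j = proj₁ (proj₂ (ThreeEven.three-even G loopless (fⱼ j) (fⱼ-cons j)))
    D j = proj₁ (proj₂ (proj₂ (ThreeEven.three-even G loopless (fⱼ j) (fⱼ-cons j))))
    evens : ∀ j → Even (A j) × Even (B j) × Even (D j) × (∀ e → Two (nonzero (fⱼ j e)) (A j e) (B j e) (D j e))
    evens j = proj₂ (proj₂ (proj₂ (ThreeEven.three-even G loopless (fⱼ j) (fⱼ-cons j))))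
    two : ∀ j e → Two (nonzero (fⱼ j e)) (A j e) (B j e) (D j e)
    two j = proj₂ (proj₂ (proj₂ (evens j)))

    module K (j : F₃) = Covers G C (A j) (B j) (D j)

    options : List (List ESet)
    options = K.six 0F ++ K.six 1F ++ K.six 2F

    C-off : ∀ e → E₀ e ≡ false → C e ≡ false
    C-off e z = cases (C e) (λ c → ⊥-elim (true≢false (trans (sym (C⊆ e c)) z))) (λ c → c)

    fⱼ-off : ∀ j e → E₀ e ≡ false → fⱼ j e ≡ 0F
    fⱼ-off j e z = cong₂ _+₃_ (f-off e z) (trans (cong (j *₃_) (proj₂ (g-unit e) (C-off e z))) (F₃F.zeroʳ j))

    sub : ∀ j → (A j ⊆ E₀) × (B j ⊆ E₀) × (D j ⊆ E₀)
    sub j = (λ e → proj₁ (at e)) , (λ e → proj₁ (proj₂ (at e))) , (λ e → proj₂ (proj₂ (at e)))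
      where
      nothing : ∀ {s a b d} → Two s a b d → s ≡ false → (a ≡ true → ⊥) × (b ≡ true → ⊥) × (d ≡ true → ⊥)
      nothing neither refl = (λ ()) , (λ ()) , (λ ())
      at : ∀ e → (A j e ≡ true → E₀ e ≡ true) × (B j e ≡ true → E₀ e ≡ true) × (D j e ≡ true → E₀ e ≡ true)
      at e = cases (E₀ e) (λ z → (λ _ → z) , (λ _ → z) , (λ _ → z))
        (λ z → let k = nothing (two j e) (cong nonzero (fⱼ-off j e z)) in
          (λ a → ⊥-elim (proj₁ k a)) , (λ a → ⊥-elim (proj₁ (proj₂ k) a)) , (λ a → ⊥-elim (proj₂ (proj₂ k) a)))

    covered : ∀ j e → E₀ e ≡ true → C e ∨ nonzero (fⱼ j e) ≡ true
    covered j e z = cases (C e) ∨-introˡ λ c → ∨-introʳ {C e} (pos (fⱼ j e)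
      (subst (_≢ 0F) (sym (trans (cong (f e +₃_) (trans (cong (j *₃_) (proj₂ (g-unit e) c)) (F₃F.zeroʳ j))) (F₃F.+-identityʳ (f e)))) (nz e z c)))
      where
      pos : ∀ y → y ≢ 0F → nonzero y ≡ true
      pos 0F h = ⊥-elim (h refl)
      pos (suc _) h = refl

    good : ∀ j → All EvenCover (K.six j)
    good j = (ev (C∷ ∷ A∷ ∷ B∷ ∷ [])) (λ e z → All.lookup (all e z) (here refl))
           ∷ (ev (C∷ ∷ A∷ ∷ D∷ ∷ [])) (λ e z → All.lookup (all e z) (there (here refl)))
           ∷ (ev (C∷ ∷ B∷ ∷ D∷ ∷ [])) (λ e z → All.lookup (all e z) (there (there (here refl))))
           ∷ (ev (A∷ ∷ B∷ ∷ x D∷ ∷ [])) (λ e z → All.lookup (all e z) (there (there (there (here refl)))))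
           ∷ (ev (A∷ ∷ D∷ ∷ x B∷ ∷ [])) (λ e z → All.lookup (all e z) (there (there (there (there (here refl))))))
           ∷ (ev (B∷ ∷ D∷ ∷ x A∷ ∷ [])) (λ e z → All.lookup (all e z) (there (there (there (there (there (here refl)))))))
           ∷ []
      where
      all : ∀ e → E₀ e ≡ true → All (λ L → Any (λ S → S e ≡ true) L) (K.six j)
      all e z = K.six-covers j e (nonzero (fⱼ j e)) (two j e) (covered j e z)
      ev : ∀ {L} → All (λ S → Even S × S ⊆ E₀) L → (∀ e → E₀ e ≡ true → Any (λ S → S e ≡ true) L) → EvenCover L
      ev p q = p , q
      C∷ : Even C × C ⊆ E₀
      C∷ = evC , C⊆
      A∷ : Even (A j) × A j ⊆ E₀
      A∷ = proj₁ (evens j) , proj₁ (sub j)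
      B∷ : Even (B j) × B j ⊆ E₀
      B∷ = proj₁ (proj₂ (evens j)) , proj₁ (proj₂ (sub j))
      D∷ : Even (D j) × D j ⊆ E₀
      D∷ = proj₁ (proj₂ (proj₂ (evens j))) , proj₂ (proj₂ (sub j))
      x : ∀ {S} → Even S × S ⊆ E₀ → Even (C △ S) × (C △ S) ⊆ E₀
      x {S} (p , q) = even-△ evC p , λ e h → cases (C e) (C⊆ e) (λ c → q e (trans (sym (cong (_xor S e) c)) h))

    all-good : All EvenCover options
    all-good = AllP.++⁺ (good 0F) (AllP.++⁺ (good 1F) (good 2F))

    six-length : ∀ j → coverLength G (concat (K.six j)) ≡ sumFin (λ e → K.weight j (C e) (nonzero (fⱼ j e)))
    six-length j = trans (coverLength-sum G (concat (K.six j))) (sumFin-cong (λ e → K.six-weight j e (nonzero (fⱼ j e)) (two j e)))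

    private
      w : Bool → Bool → ℕ
      w = Covers.weight G C C C C
      -- As `j` runs through `F₃`, so does `y +₃ j *₃ t`; it is zero once, giving 6 + 12 + 12. Off
      -- `C` the count is 10 + 10 + 10, so all edges of `E₀` share the bound 30.
      vanish-once : ∀ y t → (t ≡ 1F ⊎ t ≡ 2F) →
        w true (nonzero (y +₃ 0F *₃ t)) + (w true (nonzero (y +₃ 1F *₃ t)) + w true (nonzero (y +₃ 2F *₃ t))) ≡ 30
      vanish-once 0F _ (inj₁ refl) = refl
      vanish-once 0F _ (inj₂ refl) = refl
      vanish-once 1F _ (inj₁ refl) = refl
      vanish-once 1F _ (inj₂ refl) = refl
      vanish-once 2F _ (inj₁ refl) = refl
      vanish-once 2F _ (inj₂ refl) = refl
      constant : ∀ s → w false s + (w false s + w false s) ≤ 30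
      constant true = ≤-refl
      constant false = z≤n

    total : coverLength G (concat options) ≤ 30 * size G E₀
    total = ≤-trans (≤-reflexive expand) (≤-trans (sumFin-mono term) (≤-reflexive (sumFin-* 30 (b2n ∘ E₀))))
      where
      concat3 : ∀ (X Y Z : List (List ESet)) → coverLength G (concat (X ++ Y ++ Z)) ≡
        coverLength G (concat X) + (coverLength G (concat Y) + coverLength G (concat Z))
      concat3 X Y Z = trans (cong (coverLength G) (sym (concat-++ X (Y ++ Z)))) (trans (size-++ G (concat X) _)
        (cong (coverLength G (concat X) +_) (trans (cong (coverLength G) (sym (concat-++ Y Z))) (size-++ G (concat Y) _))))
      expand : coverLength G (concat options) ≡ sumFin (λ e → w (C e) (nonzero (fⱼ 0F e)) + (w (C e) (nonzero (fⱼ 1F e)) + w (C e) (nonzero (fⱼ 2F e))))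
      expand = trans (concat3 (K.six 0F) (K.six 1F) (K.six 2F)) (trans (cong₂ _+_ (six-length 0F) (cong₂ _+_ (six-length 1F) (six-length 2F)))
        (sym (trans (sumFin-+ (λ e → w (C e) (nonzero (fⱼ 0F e))) _) (cong (sumFin (λ e → w (C e) (nonzero (fⱼ 0F e))) +_) (sumFin-+ (λ e → w (C e) (nonzero (fⱼ 1F e))) _)))))
      term : ∀ e → w (C e) (nonzero (fⱼ 0F e)) + (w (C e) (nonzero (fⱼ 1F e)) + w (C e) (nonzero (fⱼ 2F e))) ≤ 30 * b2n (E₀ e)
      term e = cases (E₀ e) inside₀ outside₀
        where
        outside₀ : E₀ e ≡ false → w (C e) (nonzero (fⱼ 0F e)) + (w (C e) (nonzero (fⱼ 1F e)) + w (C e) (nonzero (fⱼ 2F e))) ≤ 30 * b2n (E₀ e)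
        outside₀ z rewrite C-off e z | fⱼ-off 0F e z | fⱼ-off 1F e z | fⱼ-off 2F e z = z≤n
        inside₀ : E₀ e ≡ true → w (C e) (nonzero (fⱼ 0F e)) + (w (C e) (nonzero (fⱼ 1F e)) + w (C e) (nonzero (fⱼ 2F e))) ≤ 30 * b2n (E₀ e)
        inside₀ z = subst (λ b → w (C e) (nonzero (fⱼ 0F e)) + (w (C e) (nonzero (fⱼ 1F e)) + w (C e) (nonzero (fⱼ 2F e))) ≤ 30 * b2n b) (sym z)
          (cases (C e) onC offC)
          where
          onC : C e ≡ true → w (C e) (nonzero (fⱼ 0F e)) + (w (C e) (nonzero (fⱼ 1F e)) + w (C e) (nonzero (fⱼ 2F e))) ≤ 30
          onC c = ≤-reflexive (trans (cong (λ b → w b (nonzero (fⱼ 0F e)) + (w b (nonzero (fⱼ 1F e)) + w b (nonzero (fⱼ 2F e)))) c)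
            (vanish-once (f e) (g e) (proj₁ (g-unit e) c)))
          offC : C e ≡ false → w (C e) (nonzero (fⱼ 0F e)) + (w (C e) (nonzero (fⱼ 1F e)) + w (C e) (nonzero (fⱼ 2F e))) ≤ 30
          offC c = subst (_≤ 30) (sym (trans (cong (λ b → w b (nonzero (fⱼ 0F e)) + (w b (nonzero (fⱼ 1F e)) + w b (nonzero (fⱼ 2F e)))) c)
            (cong₂ _+_ (same 0F) (cong₂ _+_ (same 1F) (same 2F))))) (constant (nonzero (f e)))
            where
            same : ∀ j → w false (nonzero (fⱼ j e)) ≡ w false (nonzero (f e))
            same j = cong (λ y → w false (nonzero y)) (trans (cong (f e +₃_) (trans (cong (j *₃_) (proj₂ (g-unit e) c)) (F₃F.zeroʳ j))) (F₃F.+-identityʳ (f e)))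

    -- Eighteen covers with total at most 30 times the size of `E₀`: the shortest has ratio at most
    -- 30/18 = 5/3.
    best : ∃[ L ] EvenCover L × 3 * coverLength G L ≤ 5 * size G E₀
    best = both all-good (pick-short G (5 * size G E₀) options
      (≤-<-trans (NP.*-monoʳ-≤ 3 total) (subst (_< 18 * suc (5 * size G E₀)) (sym bound) (NP.*-monoʳ-< 18 (n<1+n (5 * size G E₀))))))
      where
      bound : 3 * (30 * size G E₀) ≡ 18 * (5 * size G E₀)
      bound = trans (sym (NP.*-assoc 3 30 (size G E₀))) (NP.*-assoc 18 5 (size G E₀))
      both : ∀ {Ls} → All EvenCover Ls → Any (λ L → 3 * coverLength G L ≤ 5 * size G E₀) Ls → ∃[ L ] EvenCover L × 3 * coverLength G L ≤ 5 * size G E₀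
      both (p ∷ ps) (here h) = _ , p , h
      both (p ∷ ps) (there h) = both ps h

  split-cover : ∀ L → All (λ S → Even S × S ⊆ E₀) L →
    ∃[ F ] All (λ D → IsCycle G D × D ⊆ E₀) F ×
      (∀ e → Any (λ S → S e ≡ true) L → Any (λ D → D e ≡ true) F) × coverLength G F ≤ coverLength G L
  split-cover [] [] = [] , [] , (λ _ ()) , z≤n
  split-cover (S ∷ L) ((ev , sub) ∷ ps) with cycle-list ev | split-cover L ps
  ... | c | F , cy , cov , le = c.list ++ F
      , AllP.++⁺ (All.map (λ (k , h) → k , λ e d → sub e (h e d)) c.cycles) cy
      , (λ { e (here s) → AnyP.++⁺ˡ (c.covers e s) ; e (there a) → AnyP.++⁺ʳ c.list (cov e a) })
      , subst (_≤ size G S + coverLength G L) (sym (size-++ G c.list F)) (+-mono-≤ c.length le)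
    where module c = CycleList c

  private
    Short : List ESet → ℕ → Set
    Short F k = All (λ D → IsCycle G D × D ⊆ E₀) F × (∀ e → E₀ e ≡ true → Any (λ D → D e ≡ true) F) × 3 * coverLength G F ≤ k

    split-short : ∃[ L ] EvenCover L × 3 * coverLength G L ≤ 5 * size G E₀ → ∃[ F ] Short F (5 * size G E₀)
    split-short (L , (evs , cov) , le) with split-cover L evs
    ... | F , cy , cov' , le' = F , cy , (λ e z → cov' e (cov e z)) , ≤-trans (NP.*-monoʳ-≤ 3 le') le

    from-orientation : ∀ C f → C ⊆ E₀ → Even C → (∀ e → E₀ e ≡ false → f e ≡ 0F) → (∀ v → F₃F.∂ f v ≡ 0F) →
      (∀ e → E₀ e ≡ true → C e ≡ false → f e ≢ 0F) → (∃[ g ] (∀ v → F₃F.∂ g v ≡ 0F) × F₃F.UnitOn C g) →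
      ∃[ F ] Short F (5 * size G E₀)
    from-orientation C f C⊆ evC off cv nz (g , g-cons , g-unit) =
      split-short (Average.best C C⊆ evC f g off cv g-cons g-unit nz)

    from-flow : ∃[ C ] ∃[ f ] C ⊆ E₀ × Even C × (∀ e → E₀ e ≡ false → f e ≡ 0F) ×
      (∀ v → F₃F.∂ f v ≡ 0F) × (∀ e → E₀ e ≡ true → C e ≡ false → f e ≢ 0F) → ∃[ F ] Short F (5 * size G E₀)
    from-flow (C , f , C⊆ , evC , off , cv , nz) = from-orientation C f C⊆ evC off cv nz (F₃F.orient evC)

  opaque
    five-thirds : ∃[ F ] All (λ D → IsCycle G D × D ⊆ E₀) F ×
      (∀ e → E₀ e ≡ true → Any (λ D → D e ≡ true) F) × 3 * coverLength G F ≤ 5 * size G E₀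
    five-thirds = from-flow (SixFlow.six-flow G loopless deg≤3 E₀ bridgeless)

-- Barbells assembled from tadpoles

module Barbells (G : Graph) (loopless : Loopless G)
                (deg≤3 : MaxDegree3 G) (σ : Signature G) where
  open Subcubic G loopless deg≤3 public

  sgn : ESet → Bool
  sgn S = Σ₂.∑ (λ e → S e ∧ σ e)

  odd-negCount : ∀ S → odd (negCount G σ S) ≡ sgn S
  odd-negCount S = trans (odd-sumFin _) (Σ₂.∑-cong (λ e → odd-b2n (S e ∧ σ e)))

  negative : ∀ {C} → IsCycle G C → sgn C ≡ true → NegativeCycle G σ C
  negative {C} cy s = cy , λ d → true≢false (trans (sym s) (trans (sym (odd-negCount C)) (proj₂ (odd⇔2∣ _) d)))

  positive : ∀ {C} → IsCycle G C → sgn C ≡ false → PositiveCycle G σ C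
  positive {C} cy s = cy , proj₁ (odd⇔2∣ _) (trans (odd-negCount C) s)

  sgn-cong : ∀ {S T} → (∀ e → S e ≡ T e) → sgn S ≡ sgn T
  sgn-cong h = Σ₂.∑-cong (λ e → cong (_∧ σ e) (h e))

  sgn-△ : ∀ S T → sgn (S △ T) ≡ sgn S xor sgn T
  sgn-△ S T = trans (Σ₂.∑-cong (λ e → ∧-distribʳ-xor (σ e) (S e) (T e))) (Σ₂.∑-⊕ (λ e → S e ∧ σ e) (λ e → T e ∧ σ e))

  size-∪ : ∀ S T → size G (S ∪ T) ≤ size G S + size G T
  size-∪ S T = ≤-trans (sumFin-mono (λ e → b2n-∨ (S e) (T e))) (≤-reflexive (sumFin-+ (b2n ∘ S) (b2n ∘ T)))

  Apart : VSet → VSet → Set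
  Apart Y Z = ∀ v → Y v ≡ true → Z v ≡ false

  -- A negative cycle C with a path P leading from its only common vertex u with C to the tip x, all inside Z.
  record Tad (Z : VSet) (x : V) : Set where
    field
      C P   : ESet
      u     : V
      cycle : IsCycle G C
      neg   : sgn C ≡ true
      path  : Path P u x Z
      C-in  : ∀ e → C e ≡ true → inside Z e ≡ true
      u∈C   : Inc G C u
      sep   : ∀ z → Inc G P z → Inc G C z → z ≡ u
      tip   : Inc G C x → x ≡ u
      apart : Disjoint G C P
    body : ESet
    body = C ∪ P
    length : ℕ
    length = size G C + size G P
    C∈Z : ∀ z → Inc G C z → Z z ≡ true
    C∈Z z i with inc→edge z i
    ... | e , c , a = inside-at Z (C-in e c) a

  tad-⊆ : ∀ {Z Z' x} → Z ⊆ Z' → Tad Z x → Tad Z' x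
  tad-⊆ {Z} {Z'} h t = record { C = C ; P = P ; u = u ; cycle = cycle ; neg = neg ; path = path-⊆ h path
    ; C-in = λ e c → inside-mono Z Z' h (C-in e c) ; u∈C = u∈C ; sep = sep ; tip = tip ; apart = apart }
    where open Tad t

  bare : ∀ {D Z x} → IsCycle G D → sgn D ≡ true → Inc G D x → (∀ e → D e ≡ true → inside Z e ≡ true) → Z x ≡ true → Tad Z x
  bare {D} {Z} {x} cy s i inD zx = record { C = D ; P = λ _ → false ; u = x ; cycle = cy ; neg = s
    ; path = path-⊆ (λ v h → trans (cong Z (sym (⌊≟⌋-true h))) zx) (spine-path [])
    ; C-in = inD ; u∈C = i ; sep = λ z k _ → ⊥-elim (NP.<-irrefl refl (subst (0 <_) (deg-0 {λ _ → false} z (λ _ _ → refl)) k))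
    ; tip = λ _ → refl ; apart = λ _ _ → refl }

  extend : ∀ {Z x e w} → Tad Z x → Joins G e x w → Z w ≡ false → Tad (Z ∪ ⟦ w ⟧) w
  extend {Z} {x} {e} {w} t j f = record { C = C ; P = P ∪ ⟦ e ⟧ ; u = u ; cycle = cycle ; neg = neg
    ; path = path-⊆ shrink (proj₂ glued)
    ; C-in = λ e c → inside-mono Z (Z ∪ ⟦ w ⟧) ∪-⊆ˡ (C-in e c) ; u∈C = u∈C ; sep = sep'
    ; tip = λ i → ⊥-elim (w∉C i)
    ; apart = λ a c → ∨-false-intro (apart a c) (⌊≟⌋-≢ λ { refl → w∉C (inc e w c (proj₂ (joins→at j))) }) }
    where
    open Tad t
    w∉C : Inc G C w → ⊥
    w∉C i = true≢false (trans (sym (C∈Z w i)) f)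
    glued : Disjoint G P ⟦ e ⟧ × Path (P ∪ ⟦ e ⟧) u w (Z ∪ (⟦ x ⟧ ∪ ⟦ w ⟧))
    glued = path-++ path (edge-path j) meet
      where
      meet : ∀ z → Z z ≡ true → (⟦ x ⟧ ∪ ⟦ w ⟧) z ≡ true → z ≡ x
      meet z zz h with ∨-true {⟦ x ⟧ z} h
      ... | inj₁ k = sym (⌊≟⌋-true k)
      ... | inj₂ k = ⊥-elim (true≢false (trans (sym zz) (trans (cong Z (sym (⌊≟⌋-true k))) f)))
    shrink : (Z ∪ (⟦ x ⟧ ∪ ⟦ w ⟧)) ⊆ (Z ∪ ⟦ w ⟧)
    shrink z h with ∨-true {Z z} h
    ... | inj₁ k = ∨-introˡ k
    ... | inj₂ k with ∨-true {⟦ x ⟧ z} k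
    ...   | inj₁ l = ∨-introˡ (trans (cong Z (sym (⌊≟⌋-true l))) (Path.end∈ path))
    ...   | inj₂ l = ∨-introʳ {Z z} l
    sep' : ∀ z → Inc G (P ∪ ⟦ e ⟧) z → Inc G C z → z ≡ u
    sep' z i c with inc→edge z i
    ... | a , s , at with ∨-true {P a} s
    ...   | inj₁ k = sep z (inc a z k at) c
    ...   | inj₂ k rewrite sym (⌊≟⌋-true {x = e} {a} k) with joins-ends j at
    ...     | inj₁ refl = tip c
    ...     | inj₂ refl = ⊥-elim (w∉C c)

  path-ends : ∀ {P u v Z} → Path P u v Z → u ≢ v → IsPath G P u v
  path-ends {P} {u} {v} p ne = inj₂ (ne , (λ a b ia ib → walk-++ (walk-sym (walkTo a ia)) (walkTo b ib)) , at-u , at-v , others)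
    where
    open Path p
    one : ∀ d → (d + 1 ≡ 0) ⊎ (d + 1 ≡ 2) → d ≡ 1
    one zero (inj₂ ())
    one (suc zero) _ = refl
    one (suc (suc d)) (inj₂ h) = ⊥-elim (lem d (NP.suc-injective (NP.suc-injective h)))
      where
      lem : ∀ d → d + 1 ≡ 0 → ⊥
      lem zero ()
      lem (suc d) ()
    at-u : deg G P u ≡ 1
    at-u = one _ (subst (λ k → (deg G P u + k ≡ 0) ⊎ (deg G P u + k ≡ 2))
      (cong₂ (λ a b → b2n a + b2n b) (⌊≟⌋-refl u) (⌊≟⌋-≢ (λ h → ne (sym h)))) (degs u))
    at-v : deg G P v ≡ 1
    at-v = one _ (subst (λ k → (deg G P v + k ≡ 0) ⊎ (deg G P v + k ≡ 2))
      (cong₂ (λ a b → b2n a + b2n b) (⌊≟⌋-≢ ne) (⌊≟⌋-refl v)) (degs v))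
    others : ∀ z → z ≢ u → z ≢ v → (deg G P z ≡ 0) ⊎ (deg G P z ≡ 2)
    others z nu nv = subst (λ k → (k ≡ 0) ⊎ (k ≡ 2))
      (trans (cong₂ (λ a b → deg G P z + (b2n a + b2n b)) (⌊≟⌋-≢ (λ h → nu (sym h))) (⌊≟⌋-≢ (λ h → nv (sym h)))) (NP.+-identityʳ _)) (degs z)

  -- Prolonging `s` across `e` first makes the two paths meet in `y` only. As the regions are
  -- disjoint, the cycles share no vertex and the joining path has positive length.
  module Join {Y Z : VSet} {x y : V} {e : E} (s : Tad Y x) (t : Tad Z y) (ap : Apart Y Z) (j : Joins G e x y) where
    private
      module s = Tad s
      module t = Tad t
      ap' : Apart Z Y
      ap' v z = cases (Y v) (λ h → ⊥-elim (true≢false (trans (sym z) (ap v h)))) (λ h → h)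
      s' : Tad (Y ∪ ⟦ y ⟧) y
      s' = extend s j (ap' y (Path.end∈ t.path))
      module s' = Tad s'
      clash : ∀ z → Inc G s.C z → Z z ≡ true → ⊥
      clash z i zz = true≢false (trans (sym (s.C∈Z z i)) (ap' z zz))
      joined : Disjoint G s'.P t.P × Path (s'.P ∪ t.P) s.u t.u ((Y ∪ ⟦ y ⟧) ∪ Z)
      joined = path-++ s'.path (path-sym t.path) meet
        where
        meet : ∀ v → (Y ∪ ⟦ y ⟧) v ≡ true → Z v ≡ true → v ≡ y
        meet v h z with ∨-true {Y v} h
        ... | inj₁ k = ⊥-elim (true≢false (trans (sym z) (ap v k)))
        ... | inj₂ k = sym (⌊≟⌋-true k)
      P : ESet
      P = s'.P ∪ t.P
      disjoint-at : ∀ {A B : ESet} (X : VSet) → (∀ e → A e ≡ true → inside X e ≡ true) → (∀ z → Inc G B z → X z ≡ false) → Disjoint G A B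
      disjoint-at {A} {B} X a b f q = cases (B f) (λ h → ⊥-elim (true≢false (trans (sym (inside-at X {f} (a f q) (inj₁ refl))) (b _ (inc f _ h (inj₁ refl)))))) (λ h → h)
    barbell : ESet
    barbell = λ a → s.C a ∨ (t.C a ∨ P a)
    isBarbell : IsBarbell G σ barbell
    isBarbell = s.C , t.C , P , s.u , t.u , negative s.cycle s.neg , negative t.cycle t.neg
      , path-ends (proj₂ joined) (λ h → clash s.u s.u∈C (subst (λ v → Z v ≡ true) (sym h) (t.C∈Z t.u t.u∈C)))
      , disjoint-at Y s.C-in (λ z i → ap' z (t.C∈Z z i))
      , (λ a c → ∨-false-intro (s'.apart a c) (disjoint-at Y s.C-in (λ z i → ap' z (Inc-within t.path z i)) a c))
      , (λ a c → ∨-false-intro (sC a c) (t.apart a c))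
      , s.u∈C , t.u∈C
      , (λ z i k → ⊥-elim (clash z i (t.C∈Z z k)))
      , meetS , meetT , (λ _ → refl)
      where
      meetS : ∀ z → Inc G P z → Inc G s.C z → z ≡ s.u
      meetS z i c with inc→edge z i
      ... | a , q , at with ∨-true {s'.P a} q
      ...   | inj₁ k = s'.sep z (inc a z k at) c
      ...   | inj₂ k = ⊥-elim (clash z c (Inc-within t.path z (inc a z k at)))
      meetT : ∀ z → Inc G P z → Inc G t.C z → z ≡ t.u
      meetT z i c with inc→edge z i
      ... | a , q , at with ∨-true {s'.P a} q
      ...   | inj₂ k = t.sep z (inc a z k at) c
      ...   | inj₁ k with ∨-true {s.P a} k
      ...     | inj₁ l = ⊥-elim (true≢false (trans (sym (Inc-within s.path z (inc a z l at))) (ap' z (t.C∈Z z c))))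
      ...     | inj₂ l rewrite sym (⌊≟⌋-true {x = e} {a} l) with joins-ends j at
      ...       | inj₁ refl = ⊥-elim (true≢false (trans (sym (Path.end∈ s.path)) (ap' x (t.C∈Z x c))))
      ...       | inj₂ refl = t.tip c
      sC : Disjoint G t.C s'.P
      sC a c = cases (s'.P a) (λ k → ⊥-elim (bad k)) (λ k → k)
        where
        bad : s'.P a ≡ true → ⊥
        bad k with ∨-true {s.P a} k
        ... | inj₁ l = true≢false (trans (sym (Inc-within s.path _ (inc a _ l (inj₁ refl)))) (ap' _ (inside-at Z {a} (t.C-in a c) (inj₁ refl))))
        ... | inj₂ l = true≢false (trans (sym (Path.end∈ s.path))
              (ap' x (inside-at Z (t.C-in a c) (subst (λ b → At b x) (⌊≟⌋-true {x = e} {a} l) (proj₁ (joins→at j))))))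
    barbell-⊇ : ∀ a → (s.body a ≡ true) ⊎ ((t.body a ≡ true) ⊎ (⟦ e ⟧ a ≡ true)) → barbell a ≡ true
    barbell-⊇ a (inj₁ h) with ∨-true {s.C a} h
    ... | inj₁ k = ∨-introˡ k
    ... | inj₂ k = ∨-introʳ {s.C a} (∨-introʳ {t.C a} (∨-introˡ (∨-introˡ k)))
    barbell-⊇ a (inj₂ (inj₁ h)) with ∨-true {t.C a} h
    ... | inj₁ k = ∨-introʳ {s.C a} (∨-introˡ k)
    ... | inj₂ k = ∨-introʳ {s.C a} (∨-introʳ {t.C a} (∨-introʳ {s'.P a} k))
    barbell-⊇ a (inj₂ (inj₂ h)) = ∨-introʳ {s.C a} (∨-introʳ {t.C a} (∨-introˡ (∨-introʳ {s.P a} h)))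
    barbell-length : size G barbell ≤ s.length + t.length + 1
    barbell-length = ≤-trans (≤-trans (size-∪ s.C (t.C ∪ P)) (NP.+-monoʳ-≤ _ (≤-trans (size-∪ t.C P) (NP.+-monoʳ-≤ _
        (≤-trans (size-∪ s'.P t.P) (NP.+-monoˡ-≤ _ (≤-trans (size-∪ s.P ⟦ e ⟧) (≤-reflexive (cong (size G s.P +_) (card-⌊≟⌋ e))))))))))
      (≤-reflexive (solve 4 (λ a b c d → a :+ (b :+ ((c :+ con 1) :+ d)) := ((a :+ c) :+ (b :+ d)) :+ con 1) refl
        (size G s.C) (size G t.C) (size G s.P) (size G t.P)))

  -- A family of circuits with up to two unfinished tadpoles, together covering K at cost at most c.

  data Opt : Bool → VSet → V → Set where
    off : ∀ {Z x} → Opt false Z x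
    on  : ∀ {Z x} → Tad Z x → Opt true Z x

  bodyₒ : ∀ {b Z x} → Opt b Z x → ESet
  bodyₒ off    _ = false
  bodyₒ (on t) = Tad.body t

  lengthₒ : ∀ {b Z x} → Opt b Z x → ℕ
  lengthₒ off    = 0
  lengthₒ (on t) = Tad.length t

  opt-⊆ : ∀ {b Z Z' x} → Z ⊆ Z' → Opt b Z x → Opt b Z' x
  opt-⊆ h off    = off
  opt-⊆ h (on t) = on (tad-⊆ h t)

  opt-⊆-body : ∀ {b Z Z' x} (h : Z ⊆ Z') (o : Opt b Z x) → ∀ e → bodyₒ (opt-⊆ h o) e ≡ bodyₒ o e
  opt-⊆-body h off    e = refl
  opt-⊆-body h (on t) e = refl

  opt-⊆-length : ∀ {b Z Z' x} (h : Z ⊆ Z') (o : Opt b Z x) → lengthₒ (opt-⊆ h o) ≡ lengthₒ o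
  opt-⊆-length h off    = refl
  opt-⊆-length h (on t) = refl

  record Run (K : ESet) (l : Bool) (Y : VSet) (x : V) (r : Bool) (Z : VSet) (y : V) (c : ℕ) : Set where
    constructor mkRun
    field
      list     : List ESet
      circuits : All (IsCircuit G σ) list
      left     : Opt l Y x
      right    : Opt r Z y
      covers   : ∀ e → K e ≡ true → Any (λ S → S e ≡ true) list ⊎ (bodyₒ left e ≡ true ⊎ bodyₒ right e ≡ true)
      length   : coverLength G list + (lengthₒ left + lengthₒ right) ≤ c

  -- Regions and tips mean nothing for empty slots; quantifying over them lets a finished family be
  -- combined with any run.
  Closed : ESet → ℕ → Set
  Closed K c = ∀ {Y x Z y} → Run K false Y x false Z y c

  weaken : ∀ {K K' l Y Y' x r Z Z' y c c'} → K' ⊆ K → Y ⊆ Y' → Z ⊆ Z' → c ≤ c' → Run K l Y x r Z y c → Run K' l Y' x r Z' y c'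
  weaken k hy hz le (mkRun F ci a b cov len) = mkRun F ci (opt-⊆ hy a) (opt-⊆ hz b)
    (λ e q → fix e (cov e (k e q)))
    (≤-trans (≤-reflexive (cong (coverLength G F +_) (cong₂ _+_ (opt-⊆-length hy a) (opt-⊆-length hz b)))) (≤-trans len le))
    where
    fix : ∀ e → Any (λ S → S e ≡ true) F ⊎ (bodyₒ a e ≡ true ⊎ bodyₒ b e ≡ true) →
          Any (λ S → S e ≡ true) F ⊎ (bodyₒ (opt-⊆ hy a) e ≡ true ⊎ bodyₒ (opt-⊆ hz b) e ≡ true)
    fix e (inj₁ p) = inj₁ p
    fix e (inj₂ (inj₁ p)) = inj₂ (inj₁ (trans (opt-⊆-body hy a e) p))
    fix e (inj₂ (inj₂ p)) = inj₂ (inj₂ (trans (opt-⊆-body hz b e) p))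

  swap : ∀ {K l Y x r Z y c} → Run K l Y x r Z y c → Run K r Z y l Y x c
  swap (mkRun F ci a b cov len) = mkRun F ci b a (λ e q → [ inj₁ , [ (λ p → inj₂ (inj₂ p)) , (λ p → inj₂ (inj₁ p)) ]′ ]′ (cov e q))
    (≤-trans (≤-reflexive (cong (coverLength G F +_) (NP.+-comm (lengthₒ b) (lengthₒ a)))) len)

  nothing : Closed (λ _ → false) 0
  nothing = mkRun [] [] off off (λ _ ()) z≤n

  single-circuit : ∀ {D} → IsCircuit G σ D → Closed D (size G D)
  single-circuit {D} ci = mkRun (D ∷ []) (ci ∷ []) off off (λ e d → inj₁ (here d)) (≤-reflexive (trans (NP.+-identityʳ _) (NP.+-identityʳ _)))

  single-tad : ∀ {Z x Y y} (t : Tad Z x) → Run (Tad.body t) false Y y true Z x (Tad.length t)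
  single-tad t = mkRun [] [] off (on t) (λ e q → inj₂ (inj₂ q)) ≤-refl

  private
    Any-++ : ∀ {A B : List ESet} {e : E} → Any (λ S → S e ≡ true) A ⊎ Any (λ S → S e ≡ true) B → Any (λ S → S e ≡ true) (A ++ B)
    Any-++ (inj₁ p) = AnyP.++⁺ˡ p
    Any-++ {A} (inj₂ p) = AnyP.++⁺ʳ A p

  -- The right tadpole of the second run takes over the empty right slot of the first.
  append : ∀ {K K' l Y x Z' y' r Z y Y' x' c c'} → Run K l Y x false Z' y' c → Run K' false Y' x' r Z y c' → Run (K ∪ K') l Y x r Z y (c + c')
  append {K} {K'} {c = c} {c'} (mkRun F ci a off cov len) (mkRun F' ci' off b cov' len') = mkRun (F ++ F') (AllP.++⁺ ci ci') a b both
    (≤-trans (≤-reflexive (trans (cong (_+ (lengthₒ a + lengthₒ b)) (size-++ G F F'))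
      (solve 4 (λ f f' a b → (f :+ f') :+ (a :+ b) := (f :+ (a :+ con 0)) :+ (f' :+ (con 0 :+ b))) refl (coverLength G F) (coverLength G F') (lengthₒ a) (lengthₒ b))))
      (+-mono-≤ len len'))
    where
    both : ∀ e → K e ∨ K' e ≡ true → Any (λ S → S e ≡ true) (F ++ F') ⊎ (bodyₒ a e ≡ true ⊎ bodyₒ b e ≡ true)
    both e q with ∨-true {K e} q
    ... | inj₁ k with cov e k
    ...   | inj₁ p = inj₁ (Any-++ {F} (inj₁ p))
    ...   | inj₂ (inj₁ p) = inj₂ (inj₁ p)
    both e q | inj₂ k with cov' e k
    ...   | inj₁ p = inj₁ (Any-++ {F} (inj₂ p))
    ...   | inj₂ (inj₂ p) = inj₂ (inj₂ p)

  absorb : ∀ {K K' l Y x r Z y c c'} → Run K l Y x r Z y c → Closed K' c' → Run (K ∪ K') l Y x r Z y (c + c')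
  absorb {K} {K'} {Y = Y} {x} {Z = Z} {y} {c} {c'} (mkRun F ci a b cov len) cl = mkRun (F' ++ F) (AllP.++⁺ (Run.circuits R) ci) a b both
    (≤-trans (≤-reflexive (trans (cong (_+ (lengthₒ a + lengthₒ b)) (size-++ G F' F))
      (solve 3 (λ f f' z → (f' :+ f) :+ z := (f :+ z) :+ f') refl (coverLength G F) (coverLength G F') (lengthₒ a + lengthₒ b))))
      (+-mono-≤ len (≤-trans (m≤m+n _ _) (Run.length R))))
    where
    R : Run K' false Y x false Z y c'
    R = cl
    F' : List ESet
    F' = Run.list R
    closed-only : ∀ e → K' e ≡ true → Any (λ S → S e ≡ true) F'
    closed-only e q with Run.left R | Run.right R | Run.covers R e q
    ... | off | off | inj₁ p = p
    ... | off | off | inj₂ (inj₁ ())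
    ... | off | off | inj₂ (inj₂ ())
    both : ∀ e → K e ∨ K' e ≡ true → Any (λ S → S e ≡ true) (F' ++ F) ⊎ (bodyₒ a e ≡ true ⊎ bodyₒ b e ≡ true)
    both e q with ∨-true {K e} q
    ... | inj₂ k = inj₁ (Any-++ {F'} (inj₁ (closed-only e k)))
    ... | inj₁ k with cov e k
    ...   | inj₁ p = inj₁ (Any-++ {F'} (inj₂ p))
    ...   | inj₂ p = inj₂ p

  -- With an empty right slot only the region and tip move, free of charge; so runs with and without
  -- a pending tadpole can travel along a cycle by the same operation.
  advance : ∀ {K l Y x r Z y c e w} → Run K l Y x r Z y c → Joins G e y w → Z w ≡ false →
    Run (λ a → K a ∨ (r ∧ ⟦ e ⟧ a)) l Y x r (Z ∪ ⟦ w ⟧) w (c + b2n r)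
  advance {K} {c = c} (mkRun F ci a off cov len) j f = mkRun F ci a off
    (λ e q → cov e (trans (sym (∨-identityʳ (K e))) q)) (≤-trans len (m≤m+n c 0))
  advance {K} {c = c} {e = e₀} (mkRun F ci a (on t) cov len) j f = mkRun F ci a (on (extend t j f)) both
    (≤-trans (NP.+-monoʳ-≤ (coverLength G F) (NP.+-monoʳ-≤ (lengthₒ a) longer))
      (≤-trans (≤-reflexive (solve 3 (λ f a t → f :+ (a :+ (t :+ con 1)) := (f :+ (a :+ t)) :+ con 1) refl (coverLength G F) (lengthₒ a) t.length))
        (NP.+-monoˡ-≤ 1 len)))
    where
    module t = Tad t
    longer : Tad.length (extend t j f) ≤ t.length + 1
    longer = ≤-trans (NP.+-monoʳ-≤ (size G t.C) (≤-trans (size-∪ t.P ⟦ e₀ ⟧) (≤-reflexive (cong (size G t.P +_) (card-⌊≟⌋ e₀)))))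
      (≤-reflexive (sym (NP.+-assoc (size G t.C) _ 1)))
    both : ∀ e → K e ∨ ⟦ e₀ ⟧ e ≡ true → Any (λ S → S e ≡ true) F ⊎ (bodyₒ a e ≡ true ⊎ Tad.body (extend t j f) e ≡ true)
    both e q with ∨-true {K e} q
    ... | inj₂ k = inj₂ (inj₂ (∨-introʳ {t.C e} (∨-introʳ {t.P e} k)))
    ... | inj₁ k with cov e k
    ...   | inj₁ p = inj₁ p
    ...   | inj₂ (inj₁ p) = inj₂ (inj₁ p)
    ...   | inj₂ (inj₂ p) with ∨-true {t.C e} p
    ...     | inj₁ h = inj₂ (inj₂ (∨-introˡ h))
    ...     | inj₂ h = inj₂ (inj₂ (∨-introʳ {t.C e} (∨-introˡ h)))

  -- The right tadpoles become a barbell; the left tadpole of the second run moves to the right slot.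
  connect : ∀ {K K' l Y x Z y l' Y' x' Z' y' c c' e} → Run K l Y x true Z y c → Run K' l' Y' x' true Z' y' c' →
    Joins G e y y' → Apart Z Z' → Run ((K ∪ K') ∪ ⟦ e ⟧) l Y x l' Y' x' ((c + c') + 1)
  connect {K} {K'} {c = c} {c'} {e₀} (mkRun F ci a (on s) cov len) (mkRun F' ci' a' (on t) cov' len') j ap =
    mkRun (barbell ∷ (F ++ F')) (inj₂ isBarbell ∷ AllP.++⁺ ci ci') a a' both
      (≤-trans (NP.+-monoˡ-≤ (lengthₒ a + lengthₒ a') (NP.+-mono-≤ barbell-length (≤-reflexive (size-++ G F F'))))
        (≤-trans (≤-reflexive (solve 6 (λ s t f f' a a' → (((s :+ t) :+ con 1) :+ (f :+ f')) :+ (a :+ a') := ((f :+ (a :+ s)) :+ (f' :+ (a' :+ t))) :+ con 1) refl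
            (Tad.length s) (Tad.length t) (coverLength G F) (coverLength G F') (lengthₒ a) (lengthₒ a')))
          (NP.+-monoˡ-≤ 1 (+-mono-≤ len len'))))
    where
    open Join s t ap j
    both : ∀ e → (K e ∨ K' e) ∨ ⟦ e₀ ⟧ e ≡ true → Any (λ S → S e ≡ true) (barbell ∷ (F ++ F')) ⊎ (bodyₒ a e ≡ true ⊎ bodyₒ a' e ≡ true)
    both e q with ∨-true {K e ∨ K' e} q
    ... | inj₂ k = inj₁ (here (barbell-⊇ e (inj₂ (inj₂ k))))
    ... | inj₁ h with ∨-true {K e} h
    ...   | inj₁ k with cov e k
    ...     | inj₁ p = inj₁ (there (Any-++ {F} (inj₁ p)))
    ...     | inj₂ (inj₁ p) = inj₂ (inj₁ p)
    ...     | inj₂ (inj₂ p) = inj₁ (here (barbell-⊇ e (inj₁ p)))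
    both e q | inj₁ h | inj₂ k with cov' e k
    ...     | inj₁ p = inj₁ (there (Any-++ {F} (inj₂ p)))
    ...     | inj₂ (inj₁ p) = inj₂ (inj₂ p)
    ...     | inj₂ (inj₂ p) = inj₁ (here (barbell-⊇ e (inj₂ (inj₁ p))))

  card-snoc : ∀ {u v w} (p : Spine u v) e (j : Joins G e v w) (f : vis p w ≡ false) → card (edges (snoc p e j f)) ≡ suc (card (edges p))
  card-snoc {w = w} p e j f = trans (sumFin-cong term) (trans (sumFin-+ (b2n ∘ edges p) (b2n ∘ ⟦ e ⟧)) (trans (cong (card (edges p) +_) (card-⌊≟⌋ e)) (NP.+-comm _ 1)))
    where
    term : ∀ x → b2n (edges p x ∨ ⟦ e ⟧ x) ≡ b2n (edges p x) + b2n (⟦ e ⟧ x)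
    term x with edges p x in eq
    ... | false = refl
    ... | true rewrite ⟦⟧-disjoint {edges p} e (edges-fresh p (proj₂ (joins→at j)) f) x eq = refl

  -- Brings the tadpole of the first component met on a cycle back to the root of that cycle.
  backtrack : ∀ {K l Y x Z y c u v e} (p : Spine u v) → Run K l Y x true Z y c → Joins G e y v → Apart (vis p) Z →
    Run (K ∪ (edges p ∪ ⟦ e ⟧)) l Y x true (Z ∪ vis p) u (c + suc (card (edges p)))
  backtrack {K} {Z = Z} {c = c} {e = e} [] R j ap =
    weaken (λ a h → h) (λ _ h → h) (λ _ h → h) (≤-reflexive (cong (λ k → c + suc k) (sym (sumFin-0 {m G})))) (advance R j (ap _ (⌊≟⌋-refl _)))
  backtrack {K} {Z = Z} {c = c} {e = e} (snoc {v'} {v} p e' j' f') R j ap =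
    weaken sub (λ _ h → h) reg (≤-reflexive cost) (backtrack p (advance R j (ap v (∨-introʳ {vis p v} (⌊≟⌋-refl v)))) (joins-sym j') ap')
    where
    ap' : Apart (vis p) (Z ∪ ⟦ v ⟧)
    ap' z h = ∨-false-intro (ap z (∨-introˡ h)) (⌊≟⌋-≢ λ { refl → true≢false (trans (sym h) f') })
    sub : (K ∪ ((edges p ∪ ⟦ e' ⟧) ∪ ⟦ e ⟧)) ⊆ ((K ∪ ⟦ e ⟧) ∪ (edges p ∪ ⟦ e' ⟧))
    sub a h with ∨-true {K a} h
    ... | inj₁ k = ∨-introˡ (∨-introˡ k)
    ... | inj₂ k with ∨-true {edges p a ∨ ⟦ e' ⟧ a} k
    ...   | inj₁ l = ∨-introʳ {K a ∨ ⟦ e ⟧ a} l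
    ...   | inj₂ l = ∨-introˡ (∨-introʳ {K a} l)
    reg : ((Z ∪ ⟦ v ⟧) ∪ vis p) ⊆ (Z ∪ (vis p ∪ ⟦ v ⟧))
    reg z h with ∨-true {Z z ∨ ⟦ v ⟧ z} h
    ... | inj₂ k = ∨-introʳ {Z z} (∨-introˡ k)
    ... | inj₁ k with ∨-true {Z z} k
    ...   | inj₁ l = ∨-introˡ l
    ...   | inj₂ l = ∨-introʳ {Z z} (∨-introʳ {vis p z} l)
    cost : c + 1 + suc (card (edges p)) ≡ c + suc (card (edges (snoc p e' j' f')))
    cost rewrite card-snoc p e' j' f' = NP.+-assoc c 1 _

-- Covering an even edge set inside a connected one

module Cactus (G : Graph) (loopless : Loopless G)
              (deg≤3 : MaxDegree3 G) (σ : Signature G)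
              (W H : EdgeSet G) (H⊆W : ∀ e → H e ≡ true → W e ≡ true) (evH : Paths.Even G H) where
  open Barbells G loopless deg≤3 σ

  -- For γ: after `connect` has used one tadpole from each side, the remaining two face each other
  -- across the same edge, which is paid a second time.
  fuse : ∀ {K Y x Z y c e} → Run K true Y x true Z y c → Joins G e x y → Apart Y Z → Closed (K ∪ ⟦ e ⟧) (c + 1)
  fuse {K} {c = c} {e₀} (mkRun F ci (on s) (on t) cov len) j ap = mkRun (barbell ∷ F) (inj₂ isBarbell ∷ ci) off off both
    (≤-trans (≤-reflexive (NP.+-identityʳ _)) (≤-trans (NP.+-monoˡ-≤ (coverLength G F) barbell-length)
      (≤-trans (≤-reflexive (solve 3 (λ s t f → ((s :+ t) :+ con 1) :+ f := (f :+ (s :+ t)) :+ con 1) refl (Tad.length s) (Tad.length t) (coverLength G F)))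
        (NP.+-monoˡ-≤ 1 len))))
    where
    open Join s t ap j
    both : ∀ e → K e ∨ ⟦ e₀ ⟧ e ≡ true → Any (λ S → S e ≡ true) (barbell ∷ F) ⊎ (false ≡ true ⊎ false ≡ true)
    both e q with ∨-true {K e} q
    ... | inj₂ k = inj₁ (here (barbell-⊇ e (inj₂ (inj₂ k))))
    ... | inj₁ k with cov e k
    ...   | inj₁ p = inj₁ (there p)
    ...   | inj₂ (inj₁ p) = inj₁ (here (barbell-⊇ e (inj₁ p)))
    ...   | inj₂ (inj₂ p) = inj₁ (here (barbell-⊇ e (inj₂ (inj₁ p))))

  relocate : ∀ {K Y x Y' x' r Z y c} → Run K false Y x r Z y c → Run K false Y' x' r Z y c
  relocate (mkRun F ci off b cov len) = mkRun F ci off b cov len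

  close : ∀ {K Y x Z y c} → Run K false Y x false Z y c → Closed K c
  close (mkRun F ci off off cov len) = mkRun F ci off off cov len

  HY : VSet → ESet
  HY Y e = H e ∧ inside Y e

  par : VSet → Bool
  par Y = sgn (HY Y)

  weight : VSet → ℕ
  weight Y = card (λ e → W e ∧ inside Y e)

  HClosed : VSet → Set
  HClosed Y = ∀ e → H e ≡ true → Y (src e) ≡ Y (tgt e)

  -- Connectedness of `W` inside `Y` as an induction principle over closed sets; removing a
  -- component then needs no surgery on walks.
  Conn : VSet → V → Set
  Conn Y r = ∀ (Q : VSet) → Q r ≡ true → (∀ e → W e ≡ true → inside Y e ≡ true → Q (src e) ≡ Q (tgt e)) →
    ∀ v → Y v ≡ true → Q v ≡ true

  record Good (Y : VSet) : Set where
    field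
      hcl   : HClosed Y
      root  : V
      root∈ : Y root ≡ true
      conn  : Conn Y root

  -- If the old root were outside `Q`, connectedness applied to the complement of `Q` would exclude
  -- `r` as well.
  reroot : ∀ {Y} → Good Y → ∀ r → Y r ≡ true → Conn Y r
  reroot {Y} g r yr Q qr cl = cases (Q root) (λ q → conn Q q cl)
    (λ q → ⊥-elim (true≢false (trans (sym qr) (not-true (conn (not ∘ Q) (not-intro q) (λ e w i → cong not (cl e w i)) r yr)))))
    where open Good g

  Leaves : VSet → V → Set
  Leaves Y r = ∃[ e ] At e r × crosses Y e ≡ true

  -- The part of the induction visible from outside an odd component: one tadpole at `r` in α and β,
  -- two in γ. Prolonging all of them across one edge costs exactly the four units which `bound`
  -- grants that edge.
  record OddCov (Y : VSet) (r : V) : Set where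
    field
      {a b c} : ℕ
      α     : Run (HY Y) false Y r true Y r a
      β     : Run (HY Y) false Y r true Y r b
      γ     : Run (HY Y) true Y r true Y r c
      bound : a + b + c ≤ 4 * weight Y

  record EvCov (Y : VSet) : Set where
    field
      {a b c} : ℕ
      α     : Closed (HY Y) a
      β     : Closed (HY Y) b
      γ     : Closed (HY Y) c
      bound : a + b + c ≤ 4 * weight Y

  hy-split : ∀ {X Y} → HClosed X → X ⊆ Y → ∀ e → HY Y e ≡ HY X e xor HY (Y ∖ X) e
  hy-split {X} {Y} hx sub e = cases (H e)
    (λ h → trans (cong (_∧ inside Y e) h) (trans (go (X (src e)) (X (tgt e)) (Y (src e)) (Y (tgt e)) (hx e h) (sub (src e)) (sub (tgt e)))
       (sym (cong₂ (λ a b → (a ∧ inside X e) xor (b ∧ inside (Y ∖ X) e)) h h))))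
    (λ h → trans (cong (_∧ inside Y e) h) (sym (cong₂ (λ a b → (a ∧ inside X e) xor (b ∧ inside (Y ∖ X) e)) h h)))
    where
    go : ∀ a b c d → a ≡ b → (a ≡ true → c ≡ true) → (b ≡ true → d ≡ true) →
      c ∧ d ≡ (a ∧ b) xor ((c ∧ not a) ∧ (d ∧ not b))
    go true true c d _ p q rewrite p refl | q refl = refl
    go false false c d _ _ _ = cong₂ _∧_ (sym (∧-identityʳ c)) (sym (∧-identityʳ d))

  hy-parts : ∀ {X Y} → HClosed X → X ⊆ Y → HY Y ⊆ (HY X ∪ HY (Y ∖ X))
  hy-parts {X} {Y} hx sub e h = go (HY X e) (HY (Y ∖ X) e) (trans (sym (hy-split {X} {Y} hx sub e)) h)
    where
    go : ∀ a b → a xor b ≡ true → a ∨ b ≡ true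
    go true b _ = refl
    go false b p = p

  par-split : ∀ {X Y} → HClosed X → X ⊆ Y → par Y ≡ par X xor par (Y ∖ X)
  par-split {X} {Y} hx sub = trans (sgn-cong (hy-split {X} {Y} hx sub)) (sgn-△ (HY X) (HY (Y ∖ X)))

  -- Ensures that at most one component hangs at each vertex of a cycle, and none at the root, whose
  -- third edge leaves the region.
  third-edge : ∀ {D w e a} → deg G D w ≡ 2 → At e w → At a w → D e ≡ false → D a ≡ false → e ≡ a
  third-edge {D} {w} {e} {a} d ae aa e∉ a∉ with e ≟ a
  ... | yes p = p
  ... | no ne = ⊥-elim (NP.<-irrefl refl (≤-trans four (≤-trans (deg-mono {(D ∪ ⟦ e ⟧) ∪ ⟦ a ⟧} w (λ _ _ → refl)) (deg≤3 w))))
    where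
    four : 4 ≤ deg G ((D ∪ ⟦ e ⟧) ∪ ⟦ a ⟧) w
    four rewrite deg-∪ {D ∪ ⟦ e ⟧} {⟦ a ⟧} w (⟦⟧-disjoint a (∨-false-intro a∉ (⌊≟⌋-≢ ne))) | deg-∪ {D} {⟦ e ⟧} w (⟦⟧-disjoint e e∉) | d =
      s≤s (s≤s (+-mono-≤ (inc {⟦ e ⟧} e w (⌊≟⌋-refl e) ae) (inc {⟦ a ⟧} a w (⌊≟⌋-refl a) aa)))

  -- The core `Q₀` is either a single vertex off `H` or the vertex set of a cycle of `H`. A
  -- component of its complement is `Good`, and so is `Y` without that component, since everything
  -- else is held together by the core.
  module Comp {Y Q₀ : VSet} (gY : Good Y) (gQ : Good Q₀) (Q₀⊆Y : Q₀ ⊆ Y) where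
    Y° : VSet
    Y° = Y ∖ Q₀
    S° : ESet
    S° e = W e ∧ inside Y° e
    r : V
    r = Good.root gQ
    opaque
      comp : V → VSet
      comp y = Reach.Q (reach S° y)
      comp-root : ∀ y → comp y y ≡ true
      comp-root y = Reach.root (reach S° y)
      comp-closed° : ∀ y e → S° e ≡ true → comp y (src e) ≡ comp y (tgt e)
      comp-closed° y = Reach.closed (reach S° y)
      comp-spine : ∀ y v → comp y v ≡ true → Σ (Spine y v) λ p → (edges p ⊆ S°) × (vis p ⊆ comp y)
      comp-spine y v h with Reach.spine (reach S° y) v h
      ... | p , t , u = p , (λ e i → Reach.T⊆S (reach S° y) e (t e i)) , u
    comp-closed : ∀ y e → W e ≡ true → inside Y° e ≡ true → comp y (src e) ≡ comp y (tgt e)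
    comp-closed y e w i = comp-closed° y e (∧-intro w i)
    Y°→ : ∀ v → Y° v ≡ true → Y v ≡ true × Q₀ v ≡ false
    Y°→ v h = proj₁ (∧-true h) , not-true (proj₂ (∧-true {Y v} h))
    to-Y° : ∀ v → Y v ≡ true → Q₀ v ≡ false → Y° v ≡ true
    to-Y° v y q = ∧-intro y (not-intro q)
    hcl° : HClosed Y°
    hcl° e h = cong₂ (λ a b → a ∧ not b) (Good.hcl gY e h) (Good.hcl gQ e h)
    comp⊆ : ∀ y → Y° y ≡ true → comp y ⊆ Y°
    comp⊆ y yy v h = [ (λ p → trans (cong Y° (sym p)) yy) , (λ i → on-edge (inc→edge v i)) ]′ (vis-inc p v (vis-end p))
      where
      p : Spine y v
      p = proj₁ (comp-spine y v h)
      on-edge : ∃[ e ] edges p e ≡ true × At e v → Y° v ≡ true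
      on-edge (e , k , a) = inside-at Y° {e} (proj₂ (∧-true {W e} (proj₁ (proj₂ (comp-spine y v h)) e k))) a
    comp-Y : ∀ y → Y° y ≡ true → comp y ⊆ Y
    comp-Y y yy v h = proj₁ (Y°→ v (comp⊆ y yy v h))
    comp-Q₀ : ∀ y → Y° y ≡ true → ∀ v → Q₀ v ≡ true → comp y v ≡ false
    comp-Q₀ y yy v q = cases (comp y v) (λ h → ⊥-elim (true≢false (trans (sym q) (proj₂ (Y°→ v (comp⊆ y yy v h)))))) (λ h → h)
    exit-core : ∀ y e u d → W e ≡ true → Joins G e u d → Y° u ≡ true → Y d ≡ true → comp y u ≡ true → comp y d ≡ false → Q₀ d ≡ true
    exit-core y e u d w j uu dd cu cd = cases (Q₀ d) (λ q → q) λ q → ⊥-elim (true≢false (trans (sym cu)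
      (trans (closed-joins (comp y) (comp-closed y e w (inside-joins Y° j uu (to-Y° d dd q))) j) cd)))
    comp-hcl : ∀ y → Y° y ≡ true → HClosed (comp y)
    comp-hcl y yy e h = cases (Y° (src e))
      (λ s → comp-closed y e (H⊆W e h) (∧-intro s (trans (sym (hcl° e h)) s)))
      (λ s → trans (out (src e) s) (sym (out (tgt e) (trans (sym (hcl° e h)) s))))
      where
      out : ∀ v → Y° v ≡ false → comp y v ≡ false
      out v n = cases (comp y v) (λ k → ⊥-elim (true≢false (trans (sym (comp⊆ y yy v k)) n))) (λ k → k)
    comp-good : ∀ y → Y° y ≡ true → Good (comp y)
    comp-good y yy = record { hcl = comp-hcl y yy ; root = y ; root∈ = comp-root y ; conn = cn }
      where
      cn : Conn (comp y) y
      cn Q qy cl v h = along (comp-spine y v h)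
        where
        along : Σ (Spine y v) (λ p → (edges p ⊆ S°) × (vis p ⊆ comp y)) → Q v ≡ true
        along (p , t , u) = trans (sym (walk-closed Q (λ e i → cl e (proj₁ (∧-true (t e i))) (inside-mono (vis p) (comp y) u (edges-inside p e i)))
            (vis-walk p v (vis-end p)))) qy
    module _ (y : V) (yy : Y° y ≡ true) where
      rest : VSet
      rest = Y ∖ comp y
      Q₀⊆rest : Q₀ ⊆ rest
      Q₀⊆rest v q = ∧-intro (Q₀⊆Y v q) (not-intro (comp-Q₀ y yy v q))
      rest-good : Good rest
      rest-good = record { hcl = λ e h → cong₂ (λ a b → a ∧ not b) (Good.hcl gY e h) (comp-hcl y yy e h)
        ; root = r ; root∈ = Q₀⊆rest r (Good.root∈ gQ) ; conn = cn }
        where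
        cn : Conn rest r
        cn Q qr cl v h = cases (Q v) (λ q → q) λ q → ⊥-elim (true≢false (trans (sym (whole v (proj₁ (∧-true h))))
            (∨-false-intro q (not-true (proj₂ (∧-true {Y v} h))))))
          where
          core : ∀ v → Q₀ v ≡ true → Q v ≡ true
          core = Good.conn gQ Q qr (λ e w i → cl e w (inside-mono Q₀ rest Q₀⊆rest i))
          X : VSet
          X = Q ∪ comp y
          half : ∀ e u d → W e ≡ true → Joins G e u d → Y u ≡ true → Y d ≡ true → X u ≡ true → X d ≡ true
          half e u d w j uu dd xu = cases (comp y d) (λ k → ∨-introʳ {Q d} k) λ nd → ∨-introˡ (cases (comp y u)
            (λ k → core d (exit-core y e u d w j (comp⊆ y yy u k) dd k nd))
            (λ nu → trans (sym (closed-joins Q (cl e w (inside-joins rest j (∧-intro uu (not-intro nu)) (∧-intro dd (not-intro nd)))) j))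
              (trans (sym (∨-identityʳ (Q u))) (trans (cong (Q u ∨_) (sym nu)) xu))))
          closedX : ∀ e → W e ≡ true → inside Y e ≡ true → X (src e) ≡ X (tgt e)
          closedX e w i = iff (half e (src e) (tgt e) w (inj₁ (refl , refl)) s t) (half e (tgt e) (src e) w (inj₂ (refl , refl)) t s)
            where
            s : Y (src e) ≡ true
            s = inside-at Y {e} i (inj₁ refl)
            t : Y (tgt e) ≡ true
            t = inside-at Y {e} i (inj₂ refl)
            iff : ∀ {a b} → (a ≡ true → b ≡ true) → (b ≡ true → a ≡ true) → a ≡ b
            iff {true} f g = sym (f refl)
            iff {false} {true} f g = g refl
            iff {false} {false} f g = refl
          whole : ∀ v → Y v ≡ true → X v ≡ true
          whole = reroot gY r (Q₀⊆Y r (Good.root∈ gQ)) X (∨-introˡ qr) closedX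
      opaque
        bridge : ∃[ e ] ∃[ u ] ∃[ d ] W e ≡ true × Joins G e u d × comp y u ≡ true × Q₀ d ≡ true
        bridge = [ found , (λ none → ⊥-elim (true≢false (trans (sym (isolated none)) (comp-Q₀ y yy r (Good.root∈ gQ))))) ]′
            (search (λ e → (W e ∧ inside Y e) ∧ crosses (comp y) e))
          where
          isolated : (∀ e → (W e ∧ inside Y e) ∧ crosses (comp y) e ≡ false) → comp y r ≡ true
          isolated none = reroot gY y (proj₁ (Y°→ y yy)) (comp y) (comp-root y)
            (λ e w i → xor-eq (cases (crosses (comp y) e) (λ c → ⊥-elim (true≢false (trans (sym (∧-intro (∧-intro w i) c)) (none e)))) (λ c → c)))
            r (Q₀⊆Y r (Good.root∈ gQ))
          found : ∃[ e ] (W e ∧ inside Y e) ∧ crosses (comp y) e ≡ true →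
            ∃[ e ] ∃[ u ] ∃[ d ] W e ≡ true × Joins G e u d × comp y u ≡ true × Q₀ d ≡ true
          found (e , h) = orient-edge (xor-split (comp y) (proj₂ (∧-true {W e ∧ inside Y e} h)))
            where
            wi : W e ∧ inside Y e ≡ true
            wi = proj₁ (∧-true h)
            orient-edge : ∃[ u ] ∃[ d ] Joins G e u d × comp y u ≡ true × comp y d ≡ false →
              ∃[ e ] ∃[ u ] ∃[ d ] W e ≡ true × Joins G e u d × comp y u ≡ true × Q₀ d ≡ true
            orient-edge (u , d , j , cu , cd) = e , u , d , proj₁ (∧-true wi) , j , cu
              , exit-core y e u d (proj₁ (∧-true wi)) j (comp⊆ y yy u cu) (inside-at Y (proj₂ (∧-true {W e} wi)) (proj₂ (joins→at j))) cu cd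
      comp< : card (comp y) < card Y
      comp< = card-strict (comp-Y y yy) r (comp-Q₀ y yy r (Good.root∈ gQ)) (Q₀⊆Y r (Good.root∈ gQ))
      rest< : card rest < card Y
      rest< = card-strict (λ v h → proj₁ (∧-true h)) y (trans (cong (λ b → Y y ∧ not b) (comp-root y)) (∧-zeroʳ (Y y))) (proj₁ (Y°→ y yy))
      par-rest : par Y ≡ par (comp y) xor par rest
      par-rest = par-split {comp y} {Y} (comp-hcl y yy) (comp-Y y yy)
      cover : HY Y ⊆ (HY (comp y) ∪ HY rest)
      cover = hy-parts {comp y} {Y} (comp-hcl y yy) (comp-Y y yy)
      clash : ∀ e → inside (comp y) e ≡ true → inside rest e ≡ false
      clash e i = cases (inside rest e) (λ k → ⊥-elim (true≢false (trans (sym (inside-at (comp y) {e} i (inj₁ refl)))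
        (not-true (proj₂ (∧-true {Y (src e)} (inside-at rest {e} k (inj₁ refl)))))))) (λ k → k)
      rest⊆Y : rest ⊆ Y
      rest⊆Y v h = proj₁ (∧-true h)
      weight-split : weight (comp y) + weight rest ≤ weight Y
      weight-split = card-⊎ (λ e h → ∧-intro (proj₁ (∧-true {W e} h)) (inside-mono (comp y) Y (comp-Y y yy) (proj₂ (∧-true {W e} h)))
          , trans (cong (W e ∧_) (clash e (proj₂ (∧-true {W e} h)))) (∧-zeroʳ (W e)))
        (λ e h → ∧-intro (proj₁ (∧-true {W e} h)) (inside-mono rest Y rest⊆Y (proj₂ (∧-true {W e} h))))
      -- The edge between the component and the core lies inside neither part; its four units pay
      -- for the tadpoles that cross it.
      weight-split+1 : weight (comp y) + weight rest + 1 ≤ weight Y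
      weight-split+1 = ≤-trans (NP.+-monoˡ-≤ 1 (card-⊎ {Z = Z} left right))
        (≤-trans (≤-reflexive (cong (card Z +_) (sym (card-⌊≟⌋ κ))))
          (card-⊎ (λ e h → proj₁ (∧-true h) , not-true (proj₂ (∧-true {W e ∧ inside Y e} h))) (λ e h → subst (λ e → W e ∧ inside Y e ≡ true) (⌊≟⌋-true h) κ-in)))
        where
        κ : E
        κ = proj₁ bridge
        u d : V
        u = proj₁ (proj₂ bridge)
        d = proj₁ (proj₂ (proj₂ bridge))
        j : Joins G κ u d
        j = proj₁ (proj₂ (proj₂ (proj₂ (proj₂ bridge))))
        cu : comp y u ≡ true
        cu = proj₁ (proj₂ (proj₂ (proj₂ (proj₂ (proj₂ bridge)))))
        qd : Q₀ d ≡ true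
        qd = proj₂ (proj₂ (proj₂ (proj₂ (proj₂ (proj₂ bridge)))))
        κ-in : W κ ∧ inside Y κ ≡ true
        κ-in = ∧-intro (proj₁ (proj₂ (proj₂ (proj₂ bridge)))) (inside-joins Y j (comp-Y y yy u cu) (Q₀⊆Y d qd))
        Z : ESet
        Z e = (W e ∧ inside Y e) ∧ not (⟦ κ ⟧ e)
        left : ∀ e → W e ∧ inside (comp y) e ≡ true → Z e ≡ true × W e ∧ inside rest e ≡ false
        left e h = ∧-intro (∧-intro (proj₁ (∧-true {W e} h)) (inside-mono (comp y) Y (comp-Y y yy) i)) (not-intro (⌊≟⌋-≢ bad))
          , trans (cong (W e ∧_) (clash e i)) (∧-zeroʳ (W e))
          where
          i : inside (comp y) e ≡ true
          i = proj₂ (∧-true {W e} h)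
          bad : κ ≡ e → ⊥
          bad refl = true≢false (trans (sym (inside-at (comp y) i (proj₂ (joins→at j)))) (comp-Q₀ y yy d qd))
        right : ∀ e → W e ∧ inside rest e ≡ true → Z e ≡ true
        right e h = ∧-intro (∧-intro (proj₁ (∧-true {W e} h)) (inside-mono rest Y rest⊆Y i)) (not-intro (⌊≟⌋-≢ bad))
          where
          i : inside rest e ≡ true
          i = proj₂ (∧-true {W e} h)
          bad : κ ≡ e → ⊥
          bad refl = true≢false (trans (sym cu) (not-true (proj₂ (∧-true {Y u} (inside-at rest i (proj₁ (joins→at j)))))))

      peel-odd : ∀ {r} → EvCov (comp y) → OddCov rest r → OddCov Y r
      peel-odd {r} p q = record
        { α = weaken cov rest⊆Y rest⊆Y ≤-refl (absorb q.α p.α)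
        ; β = weaken cov rest⊆Y rest⊆Y ≤-refl (absorb q.β p.β)
        ; γ = weaken cov rest⊆Y rest⊆Y ≤-refl (absorb q.γ p.γ)
        ; bound = ≤-trans (≤-reflexive (solve 6 (λ a b c x y z → (a :+ x) :+ (b :+ y) :+ (c :+ z) := (x :+ y :+ z) :+ (a :+ b :+ c)) refl q.a q.b q.c p.a p.b p.c))
            (≤-trans (+-mono-≤ p.bound q.bound) (≤-trans (≤-reflexive (sym (NP.*-distribˡ-+ 4 (weight (comp y)) (weight rest)))) (NP.*-monoʳ-≤ 4 weight-split))) }
        where
        module p = EvCov p
        module q = OddCov q
        cov : HY Y ⊆ (HY rest ∪ HY (comp y))
        cov e h with ∨-true {HY (comp y) e} (cover e h)
        ... | inj₁ k = ∨-introʳ {HY rest e} k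
        ... | inj₂ k = ∨-introˡ k

      peel-even : EvCov (comp y) → EvCov rest → EvCov Y
      peel-even p q = record
        { α = weaken cover (λ _ h → h) (λ _ h → h) ≤-refl (absorb p.α q.α)
        ; β = weaken cover (λ _ h → h) (λ _ h → h) ≤-refl (absorb p.β q.β)
        ; γ = weaken cover (λ _ h → h) (λ _ h → h) ≤-refl (absorb p.γ q.γ)
        ; bound = ≤-trans (≤-reflexive (solve 6 (λ x y z a b c → (x :+ a) :+ (y :+ b) :+ (z :+ c) := (x :+ y :+ z) :+ (a :+ b :+ c)) refl p.a p.b p.c q.a q.b q.c))
            (≤-trans (+-mono-≤ p.bound q.bound) (≤-trans (≤-reflexive (sym (NP.*-distribˡ-+ 4 (weight (comp y)) (weight rest)))) (NP.*-monoʳ-≤ 4 weight-split))) }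
        where
        module p = EvCov p
        module q = EvCov q

      four-split : ∀ {k l} → k ≤ 4 * weight (comp y) → l ≤ 4 * weight rest → k + l + 4 ≤ 4 * weight Y
      four-split {k} {l} h h' = ≤-trans (NP.+-monoˡ-≤ 4 (+-mono-≤ h h')) (≤-trans (≤-reflexive
          (solve 2 (λ a b → con 4 :* a :+ con 4 :* b :+ con 4 := con 4 :* (a :+ b :+ con 1)) refl (weight (comp y)) (weight rest))) (NP.*-monoʳ-≤ 4 weight-split+1))

      comp-rest : Apart (comp y) rest
      comp-rest v h = trans (cong (λ b → Y v ∧ not b) h) (∧-zeroʳ (Y v))

      -- Two odd parts close each other: `e` is used once in α, once in β and twice in γ.
      join-even : ∀ {e u d} → Joins G e u d → OddCov (comp y) u → OddCov rest d → EvCov Y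
      join-even {e} {u} {d} j p q = record
        { α = close (weaken cov (λ _ h → h) (λ _ h → h) ≤-refl (connect p.α q.α j comp-rest))
        ; β = close (weaken cov (λ _ h → h) (λ _ h → h) ≤-refl (connect p.β q.β j comp-rest))
        ; γ = weaken (λ a h → ∨-introˡ {b = ⟦ e ⟧ a} (cov a h)) (λ _ h → h) (λ _ h → h) ≤-refl (fuse (connect p.γ q.γ j comp-rest) j comp-rest)
        ; bound = ≤-trans (≤-reflexive (solve 6 (λ x y z a b c → ((x :+ a) :+ con 1) :+ ((y :+ b) :+ con 1) :+ (((z :+ c) :+ con 1) :+ con 1) := (x :+ y :+ z) :+ (a :+ b :+ c) :+ con 4) refl p.a p.b p.c q.a q.b q.c))
            (four-split p.bound q.bound) }
        where
        module p = OddCov p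
        module q = OddCov q
        cov : HY Y ⊆ ((HY (comp y) ∪ HY rest) ∪ ⟦ e ⟧)
        cov a h = ∨-introˡ (cover a h)

      -- The even rest is closed by itself, and all four tadpoles of the odd component move across
      -- `e` to the new tip.
      prolong : ∀ {e u d} → Joins G e u d → rest d ≡ true → OddCov (comp y) u → EvCov rest → OddCov Y d
      prolong {e} {u} {d} j dr p q = record
        { α = relocate (weaken (cov true) (λ _ h → h) reg ≤-refl (absorb (advance p.α j d∉) q.α))
        ; β = relocate (weaken (cov true) (λ _ h → h) reg ≤-refl (absorb (advance p.β j d∉) q.β))
        ; γ = weaken cov₂ reg reg ≤-refl (absorb (swap (advance (swap (advance p.γ j d∉)) j d∉)) q.γ)
        ; bound = ≤-trans (≤-reflexive (solve 6 (λ x y z a b c → (x :+ con 1 :+ a) :+ (y :+ con 1 :+ b) :+ (z :+ con 1 :+ con 1 :+ c) := (x :+ y :+ z) :+ (a :+ b :+ c) :+ con 4) refl p.a p.b p.c q.a q.b q.c))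
            (four-split p.bound q.bound) }
        where
        module p = OddCov p
        module q = EvCov q
        d∉ : comp y d ≡ false
        d∉ = not-true (proj₂ (∧-true {Y d} dr))
        reg : (comp y ∪ ⟦ d ⟧) ⊆ Y
        reg v h with ∨-true {comp y v} h
        ... | inj₁ k = comp-Y y yy v k
        ... | inj₂ k = subst (λ v → Y v ≡ true) (⌊≟⌋-true k) (proj₁ (∧-true dr))
        cov : ∀ b → HY Y ⊆ ((λ a → HY (comp y) a ∨ (b ∧ ⟦ e ⟧ a)) ∪ HY rest)
        cov b a h with ∨-true {HY (comp y) a} (cover a h)
        ... | inj₁ k = ∨-introˡ (∨-introˡ k)
        ... | inj₂ k = ∨-introʳ {HY (comp y) a ∨ (b ∧ ⟦ e ⟧ a)} k
        cov₂ : HY Y ⊆ ((λ a → (HY (comp y) a ∨ (true ∧ ⟦ e ⟧ a)) ∨ (true ∧ ⟦ e ⟧ a)) ∪ HY rest)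
        cov₂ a h with ∨-true {HY (comp y) a} (cover a h)
        ... | inj₁ k = ∨-introˡ (∨-introˡ (∨-introˡ k))
        ... | inj₂ k = ∨-introʳ {(HY (comp y) a ∨ ⟦ e ⟧ a) ∨ ⟦ e ⟧ a} k

-- Traversing a cycle of `H` together with the components attached to it

module Chain (G : Graph) (loopless : Loopless G)
             (deg≤3 : MaxDegree3 G) (σ : Signature G)
             (W H : EdgeSet G) (H⊆W : ∀ e → H e ≡ true → W e ≡ true) (evH : Paths.Even G H) where
  open Barbells G loopless deg≤3 σ
  open Cactus G loopless deg≤3 σ W H H⊆W evH public

  ∨-elim : ∀ {A : Set} a {b} → a ∨ b ≡ true → (a ≡ true → A) → (b ≡ true → A) → A
  ∨-elim a p f g = [ f , g ]′ (∨-true {a} p)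

  ⟦⟧-subst : ∀ {k} {x y : Fin k} (X : Fin k → Bool) {b} → ⟦ x ⟧ y ≡ true → X x ≡ b → X y ≡ b
  ⟦⟧-subst X h q = trans (cong X (sym (⌊≟⌋-true h))) q

  separated : ∀ {k} {x y : Fin k} (X : Fin k → Bool) → X x ≡ true → X y ≡ false → ⟦ x ⟧ y ≡ false
  separated X p q = ⌊≟⌋-≢ λ h → true≢false (trans (sym p) (trans (cong X h) q))

  ¬-false : ∀ {b} → (b ≡ true → ⊥) → b ≡ false
  ¬-false {true}  h = ⊥-elim (h refl)
  ¬-false {false} h = refl

  clash : ∀ {A : Set} {b} → b ≡ true → b ≡ false → A
  clash p q = ⊥-elim (true≢false (trans (sym p) q))

  -- The cycle of H through r, cut open at r
  record CycleAt (r : V) : Set where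
    field
      {z}  : V
      p    : Spine r z
      e₁   : E
      j₁   : Joins G e₁ z r
      p⊆H  : edges p ⊆ H
      e₁∈H : H e₁ ≡ true
      e₁∉p : edges p e₁ ≡ false
    D : ESet
    D = edges p ∪ ⟦ e₁ ⟧
    isCycle : IsCycle G D
    isCycle = close-path (spine-path p) j₁ e₁∉p
    D⊆H : D ⊆ H
    D⊆H e d with ∨-true {edges p e} d
    ... | inj₁ k = p⊆H e k
    ... | inj₂ k = subst (λ e → H e ≡ true) (⌊≟⌋-true k) e₁∈H
    size-D : size G D ≡ suc (card (edges p))
    size-D = trans (sumFin-cong term) (trans (sumFin-+ (b2n ∘ edges p) (b2n ∘ ⟦ e₁ ⟧)) (trans (cong (card (edges p) +_) (card-⌊≟⌋ e₁)) (NP.+-comm _ 1)))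
      where
      term : ∀ x → b2n (edges p x ∨ ⟦ e₁ ⟧ x) ≡ b2n (edges p x) + b2n (⟦ e₁ ⟧ x)
      term x with edges p x in eq
      ... | false = refl
      ... | true rewrite ⟦⟧-disjoint {edges p} e₁ e₁∉p x eq = refl
    r∈D : Inc G D r
    r∈D = inc e₁ r (∨-introʳ {edges p e₁} (⌊≟⌋-refl e₁)) (proj₂ (joins→at j₁))

  private
    module Cut {e₁ r z} (j : Joins G e₁ r z) (h : H e₁ ≡ true) where
      open CycleThrough (cycle-through evH e₁ h)
      walk : ∀ {u w} → Joins G e₁ u w → Walk G (edges path) u w
      walk (inj₁ (refl , refl)) = vis-walk path _ (vis-end path)
      walk (inj₂ (refl , refl)) = walk-sym (vis-walk path _ (vis-end path))
      rr : Reach (edges path) r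
      rr = reach (edges path) r
      spine : Σ (Spine r z) λ p → (edges p ⊆ Reach.T rr) × (vis p ⊆ Reach.Q rr)
      spine = Reach.spine rr z (trans (sym (walk-closed (Reach.Q rr) (Reach.closed rr) (walk j))) (Reach.root rr))
      spine⊆ : edges (proj₁ spine) ⊆ edges path
      spine⊆ e k = Reach.T⊆S rr e (proj₁ (proj₂ spine) e k)
      cut : CycleAt r
      cut = record { p = proj₁ spine ; e₁ = e₁ ; j₁ = joins-sym j
        ; p⊆H = λ e k → path⊆S e (spine⊆ e k) ; e₁∈H = h
        ; e₁∉p = ¬-false (λ k → clash (spine⊆ e₁ k) e₀∉) }

    cycle-at′ : ∀ {r} → ∃[ e ] H e ≡ true × At e r → CycleAt r
    cycle-at′ (e₁ , h , a) = Cut.cut (proj₂ (at→joins a)) h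

  opaque
    cycle-at : ∀ r → Inc G H r → CycleAt r
    cycle-at r i = cycle-at′ (inc→edge r i)

  module CycleCore {Y : VSet} (gY : Good Y) {r : V} (ry : Y r ≡ true) (ca : CycleAt r) where
    open CycleAt ca public
    VD : VSet
    VD = verts D
    sat : ∀ {v e} → VD v ≡ true → H e ≡ true → At e v → D e ≡ true
    sat {v} {e} d h a = saturated v D⊆H (cycle-even isCycle) evH (verts→inc D v d) e h a
    gVD : Good VD
    gVD = record { hcl = hc ; root = r ; root∈ = inc→verts D r r∈D
      ; conn = λ Q qr cl v d → trans (sym (walk-closed Q (λ e k → cl e (H⊆W e (D⊆H e k)) (in-VD e k)) (proj₁ (proj₂ isCycle) r v r∈D (verts→inc D v d)))) qr }
      where
      in-VD : ∀ e → D e ≡ true → inside VD e ≡ true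
      in-VD e k = inside-intro VD (λ v a → edge-verts D k a)
      hc : HClosed VD
      hc e h = cases (VD (src e))
        (λ s → trans s (sym (edge-verts D (sat s h (inj₁ refl)) (inj₂ refl))))
        (λ s → cases (VD (tgt e)) (λ t → trans (edge-verts D (sat t h (inj₂ refl)) (inj₁ refl)) (sym t)) (λ t → trans s (sym t)))
    VD⊆Y : VD ⊆ Y
    VD⊆Y v d = trans (sym (walk-closed Y (λ e k → Good.hcl gY e (D⊆H e k)) (proj₁ (proj₂ isCycle) r v r∈D (verts→inc D v d)))) ry
    D-inside : ∀ e → D e ≡ true → inside VD e ≡ true
    D-inside e k = inside-intro VD (λ v a → edge-verts D k a)
    VD⊆vis : VD ⊆ vis p
    VD⊆vis v d = go (inc→edge v (verts→inc D v d))
      where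
      go : ∃[ e ] D e ≡ true × At e v → vis p v ≡ true
      go (e , k , a) = ∨-elim (edges p e) k (λ l → inside-at (vis p) (edges-inside p e l) a)
        (λ l → [ (λ h → trans (cong (vis p) h) (vis-end p)) , (λ h → trans (cong (vis p) h) (vis-start p)) ]′
          (joins-ends j₁ (subst (λ e → At e v) (sym (⌊≟⌋-true l)) a)))

  Children : ∀ {Y} → Good Y → ∀ {r} → Y r ≡ true → CycleAt r → Set
  Children gY ry ca = ∀ y → C.Y° y ≡ true → Leaves (C.comp y) y → (par (C.comp y) ≡ true) × OddCov (C.comp y) y
    where module C = Comp gY (CycleCore.gVD gY ry ca) (CycleCore.VD⊆Y gY ry ca)

  module Fold {Y : VSet} (gY : Good Y) {r : V} (ry : Y r ≡ true) (lv : Leaves Y r) (ca : CycleAt r)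
    (parY : par Y ≡ true) (n : Bool) (hn : sgn (CycleAt.D ca) ≡ n)
    (ih : Children gY ry ca) where
    open CycleCore gY ry ca
    open Comp gY gVD VD⊆Y hiding (r; clash)

    -- The share of `weight Y` due to the components in `Z`: their inner edges and the edges
    -- attaching them to `D`.
    φ : VSet → ℕ
    φ Z = card (λ e → (W e ∧ inside Y e) ∧ touches Z e)

    -- A negative `D` is spent once, in the barbell that X forms with the first child.
    base : ℕ
    base = if n then size G D else 0

    -- `Zp` omits `r` so that the closing edge of the cycle can finally carry the right tadpole onto
    -- `r`; left tadpoles already sit at `r`, so `U` keeps it.
    Zp U : ∀ {v} → Spine r v → VSet → VSet
    Zp q Z = (vis q ∖ ⟦ r ⟧) ∪ Z
    U q Z = vis q ∪ Z

    -- The runs after the spine q of the cycle D has been traversed from r; a child is an odd component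
    -- attached to D. B and X alternate between keeping the tadpole of a child pending along D and closing a
    -- pending tadpole with the next child, in opposite phases. Initially nothing is pending in B; in X the
    -- root waits for the first child if D is positive, and otherwise D itself forms a barbell with it.
    -- γ closes with one tadpole of each child and continues with the other.
    record Some {v} (q : Spine r v) (Z : VSet) : Set where
      field
        odd?  : Bool
        parZ  : par Z ≡ odd?
        {b x g} : ℕ
        B     : Run (HY Z) false (U q Z) r odd? (Zp q Z) v b
        X     : Run (λ e → HY Z e ∨ (n ∧ D e)) (not n) (U q Z) r (not odd?) (Zp q Z) v x
        γ     : Run (HY Z ∪ edges q) true (U q Z) r true (Zp q Z) v g
        cost  : b + x + g ≤ base + (4 * φ Z + 2 * card (edges q))

    record State {v} (q : Spine r v) : Set where
      field
        Z    : VSet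
        Z⊆   : Z ⊆ Y°
        Zcl  : ∀ e → W e ≡ true → inside Y° e ≡ true → Z (src e) ≡ Z (tgt e)
        -- The root is exempt: its third edge leaves `Y`.
        done : ∀ u → vis q u ≡ true → r ≢ u → ∀ e → W e ≡ true → inside Y e ≡ true → At e u → ∀ t → At e t →
               VD t ≡ true ⊎ Z t ≡ true
        runs : (∀ t → Z t ≡ false) ⊎ Some q Z

    relocateʳ : ∀ {K l Y x Z y Z' y' c} → Run K l Y x false Z y c → Run K l Y x false Z' y' c
    relocateʳ R = swap (relocate (swap R))

    u3 : ∀ {a b c} → a ≡ true ⊎ (b ≡ true ⊎ c ≡ true) → (a ∨ b) ∨ c ≡ true
    u3 (inj₁ p) = ∨-introˡ (∨-introˡ p)
    u3 {a} (inj₂ (inj₁ p)) = ∨-introˡ (∨-introʳ {a} p)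
    u3 {a} {b} (inj₂ (inj₂ p)) = ∨-introʳ {a ∨ b} p

    module Step {v w : V} (q : Spine r v) (e : E) (j : Joins G e v w) (f : vis q w ≡ false) (de : D e ≡ true)
                (q⊆D : edges q ⊆ D) where
      q' : Spine r w
      q' = snoc q e j f
      w∈VD : VD w ≡ true
      w∈VD = edge-verts D de (proj₂ (joins→at j))
      r≢w : r ≢ w
      r≢w h = true≢false (trans (sym (vis-start q)) (trans (cong (vis q) h) f))
      VD-Z : ∀ {Z} → Z ⊆ Y° → ∀ t → VD t ≡ true → Z t ≡ false
      VD-Z {Z} s t d = cases (Z t) (λ k → ⊥-elim (true≢false (trans (sym d) (proj₂ (Y°→ t (s t k)))))) (λ k → k)
      w∉Zp : ∀ {Z} → Z ⊆ Y° → Zp q Z w ≡ false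
      w∉Zp s = ∨-false-intro (cong (_∧ not (⟦ r ⟧ w)) f) (VD-Z s w w∈VD)
      U-mono : ∀ {Z Z'} → Z ⊆ Z' → U q Z ⊆ U q' Z'
      U-mono s t h = ∨-elim (vis q t) h (λ k → ∨-introˡ (∨-introˡ k)) (λ k → ∨-introʳ {vis q t ∨ ⟦ w ⟧ t} (s t k))
      Zp-mono : ∀ {Z Z'} → Z ⊆ Z' → (Zp q Z ∪ ⟦ w ⟧) ⊆ Zp q' Z'
      Zp-mono {Z} s t h = ∨-elim (Zp q Z t) h
        (λ k → ∨-elim ((vis q ∖ ⟦ r ⟧) t) k
          (λ l → ∨-introˡ (∧-intro (∨-introˡ (proj₁ (∧-true {vis q t} l))) (proj₂ (∧-true {vis q t} l))))
          (λ l → ∨-introʳ {(vis q' ∖ ⟦ r ⟧) t} (s t l)))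
        (λ k → ∨-introˡ (∧-intro (∨-introʳ {vis q t} k) (not-intro (⟦⟧-subst ⟦ r ⟧ k (⌊≟⌋-≢ r≢w)))))

      -- No new component at `w`. Exactly one of B and X has a pending tadpole, so the edge `e`
      -- costs one there and one in γ.
      plain : ∀ {Z} → Z ⊆ Y° → Some q Z → Some q' Z
      plain {Z} s st = record { odd? = odd? ; parZ = parZ
        ; B = weaken (λ _ → ∨-introˡ) (U-mono (λ _ h → h)) (Zp-mono (λ _ h → h)) ≤-refl (advance B j (w∉Zp s))
        ; X = weaken (λ _ → ∨-introˡ) (U-mono (λ _ h → h)) (Zp-mono (λ _ h → h)) ≤-refl (advance X j (w∉Zp s))
        ; γ = weaken covγ (U-mono (λ _ h → h)) (Zp-mono (λ _ h → h)) ≤-refl (advance γ j (w∉Zp s))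
        ; cost = bill odd? }
        where
        open Some st
        covγ : (HY Z ∪ (edges q ∪ ⟦ e ⟧)) ⊆ (λ a → (HY Z a ∨ edges q a) ∨ (true ∧ ⟦ e ⟧ a))
        covγ a h = u3 {HY Z a} ([ inj₁ , (λ k → inj₂ (∨-true k)) ]′ (∨-true {HY Z a} h))
        grow : b + x + g + 2 ≤ base + (4 * φ Z + 2 * card (edges q'))
        grow = subst (λ k → b + x + g + 2 ≤ base + (4 * φ Z + 2 * k)) (sym (card-snoc q e j f)) (≤-trans (NP.+-monoˡ-≤ 2 cost) (≤-reflexive
          (solve 3 (λ b p k → b :+ (con 4 :* p :+ con 2 :* k) :+ con 2 := b :+ (con 4 :* p :+ con 2 :* (con 1 :+ k))) refl base (φ Z) (card (edges q)))))
        bill : ∀ o → (b + b2n o) + (x + b2n (not o)) + (g + 1) ≤ base + (4 * φ Z + 2 * card (edges q'))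
        bill true = ≤-trans (≤-reflexive (solve 3 (λ b x g → (b :+ con 1) :+ (x :+ con 0) :+ (g :+ con 1) := b :+ x :+ g :+ con 2) refl b x g)) grow
        bill false = ≤-trans (≤-reflexive (solve 3 (λ b x g → (b :+ con 0) :+ (x :+ con 1) :+ (g :+ con 1) := b :+ x :+ g :+ con 2) refl b x g)) grow

      module Child {Z : VSet} (s : Z ⊆ Y°) (Zcl : ∀ e → W e ≡ true → inside Y° e ≡ true → Z (src e) ≡ Z (tgt e))
                   (κ : E) (wκ : W κ ≡ true) (y : V) (jκ : Joins G κ y w) (yy : Y° y ≡ true) (yz : Z y ≡ false) where
        Y₁ Z' : VSet
        Y₁ = comp y
        Z' = Z ∪ Y₁
        w∉Y₁ : Y₁ w ≡ false
        w∉Y₁ = comp-Q₀ y yy w w∈VD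
        child : (par Y₁ ≡ true) × OddCov Y₁ y
        child = ih y yy (κ , proj₁ (joins→at jκ) , joins-crosses Y₁ jκ (comp-root y) w∉Y₁)
        open OddCov (proj₂ child) renaming (α to α₁; β to β₁; γ to γ₁; a to a₁; b to b₁; c to c₁; bound to bound₁)
        Z-Y₁ : ∀ t → Y₁ t ≡ true → Z t ≡ false
        Z-Y₁ t h = go (comp-spine y t h)
          where
          go : Σ (Spine y t) (λ p → (edges p ⊆ S°) × (vis p ⊆ comp y)) → Z t ≡ false
          go (p , u , _) = trans (sym (walk-closed Z (λ e i → Zcl e (proj₁ (∧-true (u e i))) (proj₂ (∧-true {W e} (u e i)))) (vis-walk p t (vis-end p)))) yz
        Z⊆Z' : Z ⊆ Z'
        Z⊆Z' _ = ∨-introˡ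
        Y₁⊆Z' : Y₁ ⊆ Z'
        Y₁⊆Z' t = ∨-introʳ {Z t}
        s' : Z' ⊆ Y°
        s' t h = ∨-elim (Z t) h (s t) (comp⊆ y yy t)
        Zcl' : ∀ e → W e ≡ true → inside Y° e ≡ true → Z' (src e) ≡ Z' (tgt e)
        Zcl' e w i = cong₂ _∨_ (Zcl e w i) (comp-closed y e w i)
        hcl-Z : HClosed Z
        hcl-Z e h = cases (Y° (src e))
          (λ k → Zcl e (H⊆W e h) (∧-intro k (trans (sym (hcl° e h)) k)))
          (λ k → trans (out (src e) k) (sym (out (tgt e) (trans (sym (hcl° e h)) k))))
          where
          out : ∀ v → Y° v ≡ false → Z v ≡ false
          out v m = cases (Z v) (λ k → ⊥-elim (true≢false (trans (sym (s v k)) m))) (λ k → k)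
        covZ : ∀ a → HY Z' a ≡ true → HY Z a ≡ true ⊎ HY Y₁ a ≡ true
        covZ a h = go (∨-true {Z (src a)} (inside-at Z' {a} (proj₂ (∧-true {H a} h)) (inj₁ refl)))
          where
          ha : H a ≡ true
          ha = proj₁ (∧-true h)
          go : Z (src a) ≡ true ⊎ Y₁ (src a) ≡ true → HY Z a ≡ true ⊎ HY Y₁ a ≡ true
          go (inj₁ k) = inj₁ (∧-intro ha (∧-intro k (trans (sym (hcl-Z a ha)) k)))
          go (inj₂ k) = inj₂ (∧-intro ha (∧-intro k (trans (sym (comp-hcl y yy a ha)) k)))
        par' : par Z' ≡ par Z xor true
        par' = trans (par-split {Y₁} {Z'} (comp-hcl y yy) Y₁⊆Z') (trans (cong₂ _xor_ (proj₁ child) (sgn-cong (λ e → cong (H e ∧_) (cong₂ _∧_ (minus (src e)) (minus (tgt e))))))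
          (xor-comm true (par Z)))
          where
          minus : ∀ v → (Z' ∖ Y₁) v ≡ Z v
          minus v = cases (Y₁ v) (λ k → trans (cong (λ b → (Z v ∨ Y₁ v) ∧ not b) k) (trans (∧-zeroʳ _) (sym (Z-Y₁ v k))))
            (λ k → trans (cong (λ b → (Z v ∨ b) ∧ not b) k) (trans (∧-identityʳ _) (∨-identityʳ _)))
        Y₁w⊆ : (Y₁ ∪ ⟦ w ⟧) ⊆ Zp q' Z'
        Y₁w⊆ t h = ∨-elim (Y₁ t) h (λ k → ∨-introʳ {(vis q' ∖ ⟦ r ⟧) t} (Y₁⊆Z' t k)) (λ k → Zp-mono Z⊆Z' t (∨-introʳ {Zp q Z t} k))
        apart-vis : Apart (vis q) (Y₁ ∪ ⟦ w ⟧)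
        apart-vis t h = ∨-false-intro (comp-Q₀ y yy t (vis⊆VD t h)) (separated (not ∘ vis q) (not-intro f) (cong not h))
          where
          vis⊆VD : vis q ⊆ VD
          vis⊆VD t h = [ (λ k → trans (cong VD (sym k)) (inc→verts D r r∈D)) , (λ i → inc→verts D t (inc-mono t q⊆D i)) ]′ (vis-inc q t h)
        apart-Zp : Apart (Zp q Z) (Y₁ ∪ ⟦ w ⟧)
        apart-Zp t h = ∨-elim ((vis q ∖ ⟦ r ⟧) t) h (λ k → apart-vis t (proj₁ (∧-true k)))
          (λ k → ∨-false-intro (¬-false (λ l → clash k (Z-Y₁ t l))) (separated (not ∘ Z) (not-intro (VD-Z s w w∈VD)) (cong not k)))
        K₁ : ESet
        K₁ a = HY Y₁ a ∨ (true ∧ ⟦ κ ⟧ a)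
        α₂ : Run K₁ false Y₁ y true (Y₁ ∪ ⟦ w ⟧) w (a₁ + 1)
        α₂ = advance α₁ jκ w∉Y₁
        β₂ : Run K₁ false Y₁ y true (Y₁ ∪ ⟦ w ⟧) w (b₁ + 1)
        β₂ = advance β₁ jκ w∉Y₁
        γ₂ : Run (λ a → K₁ a ∨ (true ∧ ⟦ κ ⟧ a)) true (Y₁ ∪ ⟦ w ⟧) w true (Y₁ ∪ ⟦ w ⟧) w (c₁ + 1 + 1)
        γ₂ = swap (advance (swap (advance γ₁ jκ w∉Y₁)) jκ w∉Y₁)
        φ-step : φ Z + (weight Y₁ + 1) ≤ φ Z'
        φ-step = ≤-trans (NP.+-monoʳ-≤ (φ Z) (≤-trans (≤-reflexive (cong (weight Y₁ +_) (sym (card-⌊≟⌋ κ))))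
            (card-⊎ {Z = T₁} (λ a h → ∨-introˡ h , ⌊≟⌋-≢ (λ k → notκ a h k)) (λ a h → ∨-introʳ {W a ∧ inside Y₁ a} h))))
          (card-⊎ (λ a h → ∧-intro (proj₁ (∧-true h)) (up a (proj₂ (∧-true {W a ∧ inside Y a} h))) , notT a (proj₂ (∧-true {W a ∧ inside Y a} h))) inT)
          where
          T₁ : ESet
          T₁ a = (W a ∧ inside Y₁ a) ∨ ⟦ κ ⟧ a
          notκ : ∀ a → W a ∧ inside Y₁ a ≡ true → κ ≡ a → ⊥
          notκ a h k = clash (inside-at Y₁ {a} (proj₂ (∧-true {W a} h)) (subst (λ e → At e w) k (proj₂ (joins→at jκ)))) w∉Y₁
          up : ∀ a → touches Z a ≡ true → touches Z' a ≡ true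
          up a t = go (touches→at Z t)
            where
            go : ∃[ v ] At a v × Z v ≡ true → touches Z' a ≡ true
            go (v , k , z) = touches-at Z' k (∨-introˡ z)
          notT : ∀ a → touches Z a ≡ true → T₁ a ≡ false
          notT a t = cases (T₁ a) (λ h → ⊥-elim (bad (touches→at Z t) (∨-true {W a ∧ inside Y₁ a} h))) (λ h → h)
            where
            bad : (∃[ v ] At a v × Z v ≡ true) → (W a ∧ inside Y₁ a ≡ true) ⊎ (⟦ κ ⟧ a ≡ true) → ⊥
            bad (v , k , z) (inj₁ h) = true≢false (trans (sym z) (Z-Y₁ v (inside-at Y₁ (proj₂ (∧-true {W a} h)) k)))
            bad (v , k , z) (inj₂ h) = [ (λ l → clash z (trans (cong Z l) yz)) , (λ l → clash z (trans (cong Z l) (VD-Z s w w∈VD))) ]′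
              (joins-ends jκ (subst (λ e → At e v) (sym (⌊≟⌋-true h)) k))
          inT : ∀ a → T₁ a ≡ true → (W a ∧ inside Y a) ∧ touches Z' a ≡ true
          inT a h = ∨-elim (W a ∧ inside Y₁ a) h
            (λ k → ∧-intro (∧-intro (proj₁ (∧-true {W a} k)) (inside-mono Y₁ Y (comp-Y y yy) (proj₂ (∧-true {W a} k))))
                (touches-at Z' {a} (inj₁ refl) (Y₁⊆Z' _ (inside-at Y₁ {a} (proj₂ (∧-true {W a} k)) (inj₁ refl)))))
            (λ k → ⟦⟧-subst (λ a → (W a ∧ inside Y a) ∧ touches Z' a) k
                (∧-intro (∧-intro wκ (inside-joins Y jκ (proj₁ (Y°→ y yy)) (VD⊆Y w w∈VD))) (touches-at Z' (proj₁ (joins→at jκ)) (Y₁⊆Z' y (comp-root y)))))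
        four : a₁ + b₁ + c₁ + 4 + 4 * φ Z ≤ 4 * φ Z'
        four = ≤-trans (NP.+-monoˡ-≤ (4 * φ Z) (NP.+-monoˡ-≤ 4 bound₁)) (≤-trans (≤-reflexive
            (solve 2 (λ k p → con 4 :* k :+ con 4 :+ con 4 :* p := con 4 :* (p :+ (k :+ con 1))) refl (weight Y₁) (φ Z))) (NP.*-monoʳ-≤ 4 φ-step))

        first : (∀ t → Z t ≡ false) → Some q' Z'
        first empty = record { odd? = true ; parZ = trans par' (cong (_xor true) parZ0)
          ; B = relocate (weaken (λ a h → ∨-introˡ (only a h)) (λ _ h → h) Y₁w⊆ ≤-refl α₂)
          ; X = firstX n hn ; γ = weaken covγ reg Y₁w⊆ ≤-refl (swap (backtrack q γ₂ (joins-sym j) apart-vis))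
          ; cost = bill }
          where
          only : ∀ a → HY Z' a ≡ true → HY Y₁ a ≡ true
          only a h = [ (λ k → clash (inside-at Z {a} (proj₂ (∧-true {H a} k)) (inj₁ refl)) (empty (src a))) , (λ k → k) ]′ (covZ a h)
          parZ0 : par Z ≡ false
          parZ0 = trans (sgn-cong (λ e → trans (cong (λ b → H e ∧ (b ∧ Z (tgt e))) (empty (src e))) (∧-zeroʳ (H e)))) (Σ₂.∑-0 (λ _ → refl))
          reg : ((Y₁ ∪ ⟦ w ⟧) ∪ vis q) ⊆ U q' Z'
          reg t h = ∨-elim ((Y₁ ∪ ⟦ w ⟧) t) h
            (λ k → ∨-elim (Y₁ t) k (λ l → ∨-introʳ {vis q' t} (Y₁⊆Z' t l)) (λ l → ∨-introˡ (∨-introʳ {vis q t} l)))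
            (λ k → ∨-introˡ (∨-introˡ k))
          covγ : (HY Z' ∪ edges q') ⊆ ((λ a → K₁ a ∨ (true ∧ ⟦ κ ⟧ a)) ∪ (edges q ∪ ⟦ e ⟧))
          covγ a h = ∨-elim (HY Z' a) h (λ k → ∨-introˡ (∨-introˡ (∨-introˡ (only a k)))) (λ k → ∨-introʳ {K₁ a ∨ (true ∧ ⟦ κ ⟧ a)} k)
          len : ℕ
          len = card (edges q)
          firstX : ∀ n → sgn D ≡ n → Run (λ a → HY Z' a ∨ (n ∧ D a)) (not n) (U q' Z') r false (Zp q' Z') w
            (b₁ + 1 + ((if n then size G D else 0) + suc len))
          firstX false _ = relocateʳ (swap (weaken cov (λ _ h → h) reg ≤-refl (backtrack q β₂ (joins-sym j) apart-vis)))
            where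
            cov : (λ a → HY Z' a ∨ false) ⊆ (K₁ ∪ (edges q ∪ ⟦ e ⟧))
            cov a h = ∨-elim (HY Z' a) h (λ k → ∨-introˡ (∨-introˡ (only a k))) (λ ())
          firstX true h = relocate (relocateʳ (weaken cov (λ _ h → h) (λ _ h → h) cheap
              (connect (single-tad {Y = VD} {y = w} (bare isCycle h (verts→inc D w w∈VD) D-inside w∈VD)) β₁ (joins-sym jκ) apartD)))
            where
            apartD : Apart VD Y₁
            apartD t k = comp-Q₀ y yy t k
            cov : (λ a → HY Z' a ∨ D a) ⊆ (((D ∪ (λ _ → false)) ∪ HY Y₁) ∪ ⟦ κ ⟧)
            cov a h = ∨-elim (HY Z' a) h (λ k → u3 {D a ∨ false} (inj₂ (inj₁ (only a k)))) (λ k → u3 {D a ∨ false} (inj₁ (∨-introˡ k)))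
            cheap : (size G D + size G (λ _ → false)) + b₁ + 1 ≤ b₁ + 1 + (size G D + suc len)
            cheap = ≤-trans (≤-reflexive (trans (cong (λ k → (size G D + k) + b₁ + 1) (sumFin-0 {m G})) (solve 2 (λ d b → d :+ con 0 :+ b :+ con 1 := b :+ con 1 :+ d) refl (size G D) b₁)))
              (NP.+-monoʳ-≤ (b₁ + 1) (m≤m+n _ _))
          bill : (a₁ + 1) + (b₁ + 1 + (base + suc len)) + (c₁ + 1 + 1 + suc len) ≤ base + (4 * φ Z' + 2 * card (edges q'))
          bill = subst (λ k → (a₁ + 1) + (b₁ + 1 + (base + suc len)) + (c₁ + 1 + 1 + suc len) ≤ base + (4 * φ Z' + 2 * k)) (sym (card-snoc q e j f)) (≤-trans (≤-reflexive (solve 5 (λ a b c k l → (a :+ con 1) :+ (b :+ con 1 :+ (k :+ (con 1 :+ l))) :+ (c :+ con 1 :+ con 1 :+ (con 1 :+ l))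
              := k :+ ((a :+ b :+ c :+ con 4) :+ con 2 :* (con 1 :+ l))) refl a₁ b₁ c₁ base len))
            (NP.+-monoʳ-≤ base (NP.+-monoˡ-≤ (2 * suc len) (≤-trans (m≤m+n _ (4 * φ Z)) four))))

        module _ (st : Some q Z) where
          open Some st
          γ-next : Run (HY Z' ∪ edges q') true (U q' Z') r true (Zp q' Z') w ((g + (c₁ + 1 + 1)) + 1)
          γ-next = weaken cov (U-mono Z⊆Z') Y₁w⊆ ≤-refl (connect γ γ₂ j apart-Zp)
            where
            cov : (HY Z' ∪ (edges q ∪ ⟦ e ⟧)) ⊆ (((HY Z ∪ edges q) ∪ (λ a → K₁ a ∨ (true ∧ ⟦ κ ⟧ a))) ∪ ⟦ e ⟧)
            cov a h = u3 {HY Z a ∨ edges q a} (∨-elim (HY Z' a) h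
              (λ k → [ (λ l → inj₁ (∨-introˡ l)) , (λ l → inj₂ (inj₁ (∨-introˡ (∨-introˡ l)))) ]′ (covZ a k))
              (λ k → ∨-elim (edges q a) k (λ l → inj₁ (∨-introʳ {HY Z a} l)) (λ l → inj₂ (inj₂ l))))
          joinK : ∀ {K : ESet} (T : ESet) → (∀ a → T a ≡ true → HY Z' a ≡ true ⊎ K a ≡ true) → (∀ a → HY Z a ≡ true → K a ≡ true) → T ⊆ ((K ∪ K₁) ∪ ⟦ e ⟧)
          joinK {K} T t hz a h = u3 {K a} ([ (λ k → [ (λ l → inj₁ (hz a l)) , (λ l → inj₂ (inj₁ (∨-introˡ l))) ]′ (covZ a k)) , inj₁ ]′ (t a h))
          appK : ∀ {K : ESet} (T : ESet) → (∀ a → T a ≡ true → HY Z' a ≡ true ⊎ K a ≡ true) → (∀ a → HY Z a ≡ true → K a ≡ true) → T ⊆ (K ∪ K₁)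
          appK {K} T t hz a h = [ (λ k → [ (λ l → ∨-introˡ (hz a l)) , (λ l → ∨-introʳ {K a} (∨-introˡ l)) ]′ (covZ a k)) , ∨-introˡ ]′ (t a h)
          KX : ESet
          KX a = HY Z a ∨ (n ∧ D a)
          TX : ∀ a → HY Z' a ∨ (n ∧ D a) ≡ true → HY Z' a ≡ true ⊎ KX a ≡ true
          TX a h = ∨-elim (HY Z' a) h inj₁ (λ k → inj₂ (∨-introʳ {HY Z a} k))
          grow : b + x + g + (a₁ + b₁ + c₁ + 6) ≤ base + (4 * φ Z' + 2 * card (edges q'))
          grow = subst (λ k → b + x + g + (a₁ + b₁ + c₁ + 6) ≤ base + (4 * φ Z' + 2 * k)) (sym (card-snoc q e j f)) (≤-trans (NP.+-monoˡ-≤ (a₁ + b₁ + c₁ + 6) cost) (≤-trans (≤-reflexive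
              (solve 4 (λ k p l t → k :+ (con 4 :* p :+ con 2 :* l) :+ (t :+ con 6) := k :+ ((t :+ con 4 :+ con 4 :* p) :+ con 2 :* (con 1 :+ l))) refl base (φ Z) (card (edges q)) (a₁ + b₁ + c₁)))
            (NP.+-monoʳ-≤ base (NP.+-monoˡ-≤ _ four))))
          -- The run that has a pending tadpole closes it with the new child, the other run takes
          -- over the child's tadpole. The added 6 is `κ` once in B, once in X and twice in γ, then
          -- `e` once in B or X and once in γ.
          next : ∀ o → odd? ≡ o → Some q' Z'
          next true o = record { odd? = false ; parZ = trans par' (cong (_xor true) (trans parZ o))
            ; B = relocateʳ (weaken (joinK (HY Z') (λ _ → inj₁) (λ _ h → h)) (U-mono Z⊆Z') (λ _ h → h) ≤-refl (connect B' α₂ j apart-Zp))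
            ; X = weaken (appK (λ a → HY Z' a ∨ (n ∧ D a)) TX (λ _ → ∨-introˡ)) (U-mono Z⊆Z') Y₁w⊆ ≤-refl (append X' β₂)
            ; γ = γ-next
            ; cost = ≤-trans (≤-reflexive (solve 6 (λ b x g a₁ b₁ c₁ → ((b :+ (a₁ :+ con 1)) :+ con 1) :+ (x :+ (b₁ :+ con 1)) :+ ((g :+ (c₁ :+ con 1 :+ con 1)) :+ con 1) := b :+ x :+ g :+ (a₁ :+ b₁ :+ c₁ :+ con 6)) refl b x g a₁ b₁ c₁)) grow }
            where
            B' : Run (HY Z) false (U q Z) r true (Zp q Z) v b
            B' = subst (λ o → Run (HY Z) false (U q Z) r o (Zp q Z) v b) o B
            X' : Run KX (not n) (U q Z) r false (Zp q Z) v x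
            X' = subst (λ o → Run KX (not n) (U q Z) r (not o) (Zp q Z) v x) o X
          next false o = record { odd? = true ; parZ = trans par' (cong (_xor true) (trans parZ o))
            ; B = weaken (appK (HY Z') (λ _ → inj₁) (λ _ h → h)) (U-mono Z⊆Z') Y₁w⊆ ≤-refl (append B' α₂)
            ; X = relocateʳ (weaken (joinK (λ a → HY Z' a ∨ (n ∧ D a)) TX (λ _ → ∨-introˡ)) (U-mono Z⊆Z') (λ _ h → h) ≤-refl (connect X' β₂ j apart-Zp))
            ; γ = γ-next
            ; cost = ≤-trans (≤-reflexive (solve 6 (λ b x g a₁ b₁ c₁ → (b :+ (a₁ :+ con 1)) :+ ((x :+ (b₁ :+ con 1)) :+ con 1) :+ ((g :+ (c₁ :+ con 1 :+ con 1)) :+ con 1) := b :+ x :+ g :+ (a₁ :+ b₁ :+ c₁ :+ con 6)) refl b x g a₁ b₁ c₁)) grow }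
            where
            B' : Run (HY Z) false (U q Z) r false (Zp q Z) v b
            B' = subst (λ o → Run (HY Z) false (U q Z) r o (Zp q Z) v b) o B
            X' : Run KX (not n) (U q Z) r true (Zp q Z) v x
            X' = subst (λ o → Run KX (not n) (U q Z) r (not o) (Zp q Z) v x) o X

    fold : ∀ {v} (q : Spine r v) → edges q ⊆ D → State q
    fold [] _ = record { Z = λ _ → false ; Z⊆ = λ _ () ; Zcl = λ _ _ _ → refl
      ; done = λ u h ne → ⊥-elim (ne (⌊≟⌋-true h)) ; runs = inj₁ (λ _ → refl) }
    fold (snoc {v} {w} q e j f) sub = advance-state (fold q (λ a h → sub a (∨-introˡ h)))
      where
      module S = Step q e j f (sub e (∨-introʳ {edges q e} (⌊≟⌋-refl e))) (λ a h → sub a (∨-introˡ h))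
      advance-state : State q → State (snoc q e j f)
      advance-state st = [ child , plain ]′ (search (λ a → (W a ∧ inside Y a) ∧ ((⟦ src a ⟧ w ∨ ⟦ tgt a ⟧ w) ∧ touches (Y° ∖ Z) a)))
        where
        open State st
        at-w : ∀ a → At a w → ⟦ src a ⟧ w ∨ ⟦ tgt a ⟧ w ≡ true
        at-w a (inj₁ refl) = ∨-introˡ (⌊≟⌋-refl (src a))
        at-w a (inj₂ refl) = ∨-introʳ {⟦ src a ⟧ w} (⌊≟⌋-refl (tgt a))
        plain : (∀ a → (W a ∧ inside Y a) ∧ ((⟦ src a ⟧ w ∨ ⟦ tgt a ⟧ w) ∧ touches (Y° ∖ Z) a) ≡ false) → State (snoc q e j f)
        plain absent = record { Z = Z ; Z⊆ = Z⊆ ; Zcl = Zcl ; done = done'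
          ; runs = [ inj₁ , (λ s → inj₂ (S.plain Z⊆ s)) ]′ runs }
          where
          done' : ∀ u → (vis q ∪ ⟦ w ⟧) u ≡ true → r ≢ u → ∀ a → W a ≡ true → inside Y a ≡ true → At a u → ∀ t → At a t → VD t ≡ true ⊎ Z t ≡ true
          done' u h ne a wa i au t at = ∨-elim (vis q u) h (λ k → done u k ne a wa i au t at)
            (λ k → cases (VD t) inj₁ λ nd → inj₂ (cases (Z t) (λ z → z) λ nz →
              clash (∧-intro (∧-intro wa i) (∧-intro (at-w a (subst (At a) (sym (⌊≟⌋-true k)) au))
                (touches-at (Y° ∖ Z) at (∧-intro (to-Y° t (inside-at Y i at) nd) (not-intro nz))))) (absent a)))
        child : ∃[ a ] (W a ∧ inside Y a) ∧ ((⟦ src a ⟧ w ∨ ⟦ tgt a ⟧ w) ∧ touches (Y° ∖ Z) a) ≡ true → State (snoc q e j f)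
        child (κ , h) = go (touches→at (Y° ∖ Z) touch)
          where
          wκ : W κ ≡ true
          wκ = proj₁ (∧-true (proj₁ (∧-true {W κ ∧ inside Y κ} h)))
          touch : touches (Y° ∖ Z) κ ≡ true
          touch = proj₂ (∧-true {⟦ src κ ⟧ w ∨ ⟦ tgt κ ⟧ w} (proj₂ (∧-true {W κ ∧ inside Y κ} h)))
          κw : At κ w
          κw = ∨-elim (⟦ src κ ⟧ w) (proj₁ (∧-true (proj₂ (∧-true {W κ ∧ inside Y κ} h)))) (λ k → inj₁ (⌊≟⌋-true k)) (λ k → inj₂ (⌊≟⌋-true k))
          go : ∃[ y ] At κ y × (Y° ∖ Z) y ≡ true → State (snoc q e j f)
          go (y , κy , yn) = record { Z = C.Z' ; Z⊆ = C.s' ; Zcl = C.Zcl' ; done = done'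
            ; runs = inj₂ ([ C.first , (λ s → C.next s (Some.odd? s) refl) ]′ runs) }
            where
            yy : Y° y ≡ true
            yy = proj₁ (∧-true {Y° y} yn)
            y≢w : y ≢ w
            y≢w h = clash S.w∈VD (trans (cong VD (sym h)) (proj₂ (Y°→ y yy)))
            jκ : Joins G κ y w
            jκ = ends-join κy κw
              where
              ends-join : At κ y → At κ w → Joins G κ y w
              ends-join (inj₁ p) (inj₁ p') = ⊥-elim (y≢w (trans (sym p) p'))
              ends-join (inj₁ p) (inj₂ p') = inj₁ (p , p')
              ends-join (inj₂ p) (inj₁ p') = inj₂ (p' , p)
              ends-join (inj₂ p) (inj₂ p') = ⊥-elim (y≢w (trans (sym p) p'))
            module C = S.Child Z⊆ Zcl κ wκ y jκ yy (not-true (proj₂ (∧-true {Y° y} yn)))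
            κ∉D : D κ ≡ false
            κ∉D = off-verts D (proj₂ (Y°→ y yy)) κy
            done' : ∀ u → (vis q ∪ ⟦ w ⟧) u ≡ true → r ≢ u → ∀ a → W a ≡ true → inside Y a ≡ true → At a u → ∀ t → At a t → VD t ≡ true ⊎ C.Z' t ≡ true
            done' u h ne a wa i au t at = old-or-new (∨-true {vis q u} h)
              where
              old-or-new : (vis q u ≡ true) ⊎ (⟦ w ⟧ u ≡ true) → VD t ≡ true ⊎ C.Z' t ≡ true
              old-or-new (inj₁ k) = [ inj₁ , (λ z → inj₂ (∨-introˡ z)) ]′ (done u k ne a wa i au t at)
              old-or-new (inj₂ k) = cases (D a) (λ d → inj₁ (edge-verts D d at)) λ nd →
                third (third-edge {D} (even-inc (cycle-even isCycle) w (verts→inc D w S.w∈VD)) κw (subst (At a) (sym (⌊≟⌋-true k)) au) κ∉D nd)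
                where
                third : κ ≡ a → VD t ≡ true ⊎ C.Z' t ≡ true
                third h = [ (λ k → inj₂ (trans (cong C.Z' k) (C.Y₁⊆Z' y (comp-root y)))) , (λ k → inj₁ (trans (cong VD k) S.w∈VD)) ]′
                  (joins-ends jκ (subst (λ e → At e t) (sym h) at))

-- Closing the traversal, and the induction over odd and even regions

module CactusCover (G : Graph) (loopless : Loopless G)
             (deg≤3 : MaxDegree3 G) (σ : Signature G)
             (W H : EdgeSet G) (H⊆W : ∀ e → H e ≡ true → W e ≡ true) (evH : Paths.Even G H) where
  open Barbells G loopless deg≤3 σ
  open Chain G loopless deg≤3 σ W H H⊆W evH public

  hy-empty : ∀ {Z} → (∀ t → Z t ≡ false) → ∀ e → HY Z e ≡ false
  hy-empty {Z} z e = trans (cong (λ b → H e ∧ (b ∧ Z (tgt e))) (z (src e))) (∧-zeroʳ (H e))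

  par-empty : ∀ {Z} → (∀ e → HY Z e ≡ false) → par Z ≡ false
  par-empty {Z} z = trans (sgn-cong z) (Σ₂.∑-0 (λ _ → refl))

  iff : ∀ {a b} → (a ≡ true → b ≡ true) → (b ≡ true → a ≡ true) → a ≡ b
  iff {true} f g = sym (f refl)
  iff {false} {true} f g = g refl
  iff {false} {false} f g = refl

  leaves-⊆ : ∀ {X Y} → X ⊆ Y → ∀ r → X r ≡ true → Leaves Y r → Leaves X r
  leaves-⊆ {X} {Y} sub r xr (e , a , c) = e , a , go (at→joins a)
    where
    go : ∃[ t ] Joins G e r t → crosses X e ≡ true
    go (t , j) = joins-crosses X j xr (¬-false λ xt → clash c (trans (cong (_xor Y (tgt e)) (joins-closed Y j (trans (sub r xr) (sym (sub t xt))))) (xor-same (Y (tgt e)))))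

  module Finish {Y : VSet} (gY : Good Y) {r : V} (ry : Y r ≡ true) (lv : Leaves Y r) (ca : CycleAt r)
    (parY : par Y ≡ true) (n : Bool) (hn : sgn (CycleAt.D ca) ≡ n)
    (ih : Children gY ry ca) where
    open CycleCore gY ry ca
    open Comp gY gVD VD⊆Y hiding (r; clash)
    open Fold gY ry lv ca parY n hn ih

    opaque
      final : State p
      final = fold p (λ _ → ∨-introˡ)
    open State final

    Z-VD : ∀ t → VD t ≡ true → Z t ≡ false
    Z-VD t d = ¬-false (λ z → clash d (proj₂ (Y°→ t (Z⊆ t z))))

    not-crossing : ∀ e → D e ≡ true → crosses Y e ≡ true → ⊥
    not-crossing e d c = clash c (cong₂ _xor_ (VD⊆Y _ (edge-verts D d (inj₁ refl))) (VD⊆Y _ (edge-verts D d (inj₂ refl))))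

    -- The set is closed under edges of `W` inside `Y`: `done` handles the vertices of `D` other
    -- than `r`, and the only edge at `r` off `D` leaves `Y`.
    exhausted : ∀ v → Y v ≡ true → VD v ∨ Z v ≡ true
    exhausted = reroot gY r ry (λ v → VD v ∨ Z v) (∨-introˡ (inc→verts D r r∈D)) closed
      where
      ahead : ∀ e → W e ≡ true → inside Y e ≡ true → ∀ u t → Joins G e u t → VD u ∨ Z u ≡ true → VD t ∨ Z t ≡ true
      ahead e w i u t j h = ∨-elim (VD u) h fromD fromZ
        where
        yt : Y t ≡ true
        yt = inside-at Y i (proj₂ (joins→at j))
        fromZ : Z u ≡ true → VD t ∨ Z t ≡ true
        fromZ z = cases (VD t) ∨-introˡ λ nd → ∨-introʳ {VD t}
          (trans (sym (closed-joins Z (Zcl e w (inside-joins Y° j (Z⊆ u z) (to-Y° t yt nd))) j)) z)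
        fromD : VD u ≡ true → VD t ∨ Z t ≡ true
        fromD d = cases (D e) (λ de → ∨-introˡ (edge-verts D de (proj₂ (joins→at j)))) λ nde → at-root nde (r ≟ u)
          where
          at-root : D e ≡ false → Dec (r ≡ u) → VD t ∨ Z t ≡ true
          at-root nde (no ne) = [ ∨-introˡ , ∨-introʳ {VD t} ]′ (done u (VD⊆vis u d) ne e w i (proj₁ (joins→at j)) t (proj₂ (joins→at j)))
          at-root nde (yes eq) = ⊥-elim (clash (proj₂ (proj₂ lv)) (trans (cong (crosses Y) same)
              (cong₂ _xor_ (inside-at Y {e} i (inj₁ refl)) (inside-at Y {e} i (inj₂ refl)))))
            where
            same : proj₁ lv ≡ e
            same = third-edge {D} (even-inc (cycle-even isCycle) r r∈D) (proj₁ (proj₂ lv)) (subst (At e) (sym eq) (proj₁ (joins→at j)))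
              (¬-false (λ k → not-crossing _ k (proj₂ (proj₂ lv)))) nde
      closed : ∀ e → W e ≡ true → inside Y e ≡ true → VD (src e) ∨ Z (src e) ≡ VD (tgt e) ∨ Z (tgt e)
      closed e w i = iff (ahead e w i _ _ (inj₁ (refl , refl))) (ahead e w i _ _ (inj₂ (refl , refl)))

    hy-Y : ∀ e → HY Y e ≡ true → D e ≡ true ⊎ HY Z e ≡ true
    hy-Y e h = ∨-elim (VD (src e)) (exhausted _ (inside-at Y {e} (proj₂ (∧-true {H e} h)) (inj₁ refl)))
        (λ d → inj₁ (sat d he (inj₁ refl)))
        (λ z → inj₂ (∧-intro he (∧-intro z (trans (sym (Zcl e (H⊆W e he) (∧-intro (Z⊆ _ z) (trans (sym (hcl° e he)) (Z⊆ _ z))))) z))))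
      where
      he : H e ≡ true
      he = proj₁ (∧-true h)

    hy-D : ∀ e → HY Y e ≡ (D △ HY Z) e
    hy-D e = cases (D e)
      (λ d → trans (∧-intro (D⊆H e d) (inside-mono VD Y VD⊆Y (D-inside e d)))
        (sym (cong₂ _xor_ d (¬-false (λ h → clash (inside-at Z {e} (proj₂ (∧-true {H e} h)) (inj₁ refl)) (Z-VD _ (edge-verts D d (inj₁ refl))))))))
      (λ d → trans (iff (λ h → [ (λ k → clash k d) , (λ k → k) ]′ (hy-Y e h))
          (λ h → ∧-intro (proj₁ (∧-true {H e} h)) (inside-mono Z Y (λ v z → proj₁ (Y°→ v (Z⊆ v z))) (proj₂ (∧-true {H e} h)))))
        (sym (cong (_xor HY Z e) d)))

    par-D : n xor par Z ≡ true
    par-D = trans (cong (_xor par Z) (sym hn)) (trans (sym (sgn-△ D (HY Z))) (trans (sym (sgn-cong hy-D)) parY))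

    vis⊆Y : vis p ⊆ Y
    vis⊆Y t h = [ (λ k → trans (cong Y (sym k)) ry) , (λ i → VD⊆Y t (inc→verts D t (inc-mono t (λ _ → ∨-introˡ) i))) ]′ (vis-inc p t h)
    Z⊆Y : Z ⊆ Y
    Z⊆Y t z = proj₁ (Y°→ t (Z⊆ t z))
    U⊆Y : U p Z ⊆ Y
    U⊆Y t h = ∨-elim (vis p t) h (vis⊆Y t) (Z⊆Y t)
    Zp⊆Y : (Zp p Z ∪ ⟦ r ⟧) ⊆ Y
    Zp⊆Y t h = ∨-elim (Zp p Z t) h (λ k → ∨-elim ((vis p ∖ ⟦ r ⟧) t) k (λ l → vis⊆Y t (proj₁ (∧-true l))) (Z⊆Y t)) (λ k → ⟦⟧-subst Y k ry)
    r∉Zp : Zp p Z r ≡ false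
    r∉Zp = ∨-false-intro (trans (cong (λ b → vis p r ∧ not b) (⌊≟⌋-refl r)) (∧-zeroʳ (vis p r))) (Z-VD r (inc→verts D r r∈D))

    room : 4 * size G D + 4 * φ Z ≤ 4 * weight Y
    room = ≤-trans (≤-reflexive (sym (NP.*-distribˡ-+ 4 (size G D) (φ Z)))) (NP.*-monoʳ-≤ 4 (card-⊎
      (λ e d → ∧-intro (H⊆W e (D⊆H e d)) (inside-mono VD Y VD⊆Y (D-inside e d))
        , trans (cong ((W e ∧ inside Y e) ∧_) (∨-false-intro (Z-VD _ (edge-verts D d (inj₁ refl))) (Z-VD _ (edge-verts D d (inj₂ refl))))) (∧-zeroʳ (W e ∧ inside Y e)))
      (λ e h → proj₁ (∧-true h))))

    covγ : HY Y ⊆ (λ a → (HY Z a ∨ edges p a) ∨ (true ∧ ⟦ e₁ ⟧ a))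
    covγ a h = u3 {HY Z a} ([ (λ d → inj₂ (∨-true d)) , inj₁ ]′ (hy-Y a h))

    finish-γ : ∀ {g} → Run (HY Z ∪ edges p) true (U p Z) r true (Zp p Z) z g → Run (HY Y) true Y r true Y r (g + 1)
    finish-γ R = weaken covγ U⊆Y Zp⊆Y ≤-refl (advance R j₁ r∉Zp)

    -- The children are odd in total, so B still has a pending tadpole, while X has kept the first
    -- child's tadpole at `r`. Adding `D` to both as a circuit and `e₁` to B and γ fills the budget
    -- of four per edge of `D`.
    positive-case : (s : Some p Z) → n ≡ false → Some.odd? s ≡ true → OddCov Y r
    positive-case s hn0 o = record
      { α = relocate (weaken cov₁ (λ _ h → h) Zp⊆Y ≤-refl (absorb (advance B' j₁ r∉Zp) C))
      ; β = relocate (swap (weaken cov₂ U⊆Y (λ _ h → h) ≤-refl (absorb X' C)))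
      ; γ = finish-γ γ
      ; bound = ≤-trans (≤-reflexive (solve 4 (λ b x g d → (b :+ con 1 :+ d) :+ (x :+ d) :+ (g :+ con 1) := (b :+ x :+ g) :+ (con 2 :+ con 2 :* d)) refl b x g (size G D)))
          (≤-trans (NP.+-monoˡ-≤ _ cost) (≤-trans (≤-reflexive total) room)) }
      where
      open Some s
      C : Closed D (size G D)
      C = single-circuit (inj₁ (positive isCycle (trans hn hn0)))
      B' : Run (HY Z) false (U p Z) r true (Zp p Z) z b
      B' = subst (λ o → Run (HY Z) false (U p Z) r o (Zp p Z) z b) o B
      X' : Run (λ e → HY Z e ∨ (n ∧ D e)) true (U p Z) r false (Zp p Z) z x
      X' = subst (λ k → Run (λ e → HY Z e ∨ (n ∧ D e)) true (U p Z) r k (Zp p Z) z x) (cong not o)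
        (subst (λ k → Run (λ e → HY Z e ∨ (n ∧ D e)) k (U p Z) r (not odd?) (Zp p Z) z x) (cong not hn0) X)
      cov₁ : HY Y ⊆ ((λ a → HY Z a ∨ (true ∧ ⟦ e₁ ⟧ a)) ∪ D)
      cov₁ a h = [ (λ d → ∨-introʳ {HY Z a ∨ ⟦ e₁ ⟧ a} d) , (λ k → ∨-introˡ (∨-introˡ k)) ]′ (hy-Y a h)
      cov₂ : HY Y ⊆ ((λ a → HY Z a ∨ (n ∧ D a)) ∪ D)
      cov₂ a h = [ (λ d → ∨-introʳ {HY Z a ∨ (n ∧ D a)} d) , (λ k → ∨-introˡ (∨-introˡ k)) ]′ (hy-Y a h)
      total : base + (4 * φ Z + 2 * card (edges p)) + (2 + 2 * size G D) ≡ 4 * size G D + 4 * φ Z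
      total = trans (cong₂ (λ m k → (if m then size G D else 0) + (4 * φ Z + 2 * card (edges p)) + (2 + 2 * k)) hn0 size-D)
        (trans (solve 2 (λ f l → (con 4 :* f :+ con 2 :* l) :+ (con 2 :+ con 2 :* (con 1 :+ l)) := con 4 :* (con 1 :+ l) :+ con 4 :* f) refl (φ Z) (card (edges p)))
          (cong (λ k → 4 * k + 4 * φ Z) (sym size-D)))

    bare-D : n ≡ true → Tad Y r
    bare-D h = bare isCycle (trans hn h) r∈D (λ e d → inside-mono VD Y VD⊆Y (D-inside e d)) ry

    bare-length : (h : n ≡ true) → Tad.length (bare-D h) ≡ size G D
    bare-length h = trans (cong (size G D +_) (sumFin-0 {m G})) (NP.+-identityʳ _)

    -- B has closed all children, so `D` itself is the tadpole of α; X ends with a pending tadpole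
    -- and has already used `D` in a barbell. Again `D` is paid twice and its arcs twice.
    negative-case : (s : Some p Z) → n ≡ true → Some.odd? s ≡ false → OddCov Y r
    negative-case s hn1 o = record
      { α = weaken cov₁ (λ _ h → h) (λ _ h → h) ≤-refl (append (relocate B') (single-tad {Y = Y} {y = r} (bare-D hn1)))
      ; β = relocate (weaken cov₂ (λ _ h → h) Zp⊆Y ≤-refl (advance X' j₁ r∉Zp))
      ; γ = finish-γ γ
      ; bound = ≤-trans (≤-reflexive (trans (cong (λ d → (b + d) + (x + 1) + (g + 1)) (bare-length hn1))
            (solve 4 (λ b x g d → (b :+ d) :+ (x :+ con 1) :+ (g :+ con 1) := (b :+ x :+ g) :+ (con 2 :+ d)) refl b x g (size G D))))
          (≤-trans (NP.+-monoˡ-≤ _ cost) (≤-trans (≤-reflexive total) room)) }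
      where
      open Some s
      B' : Run (HY Z) false (U p Z) r false (Zp p Z) z b
      B' = subst (λ o → Run (HY Z) false (U p Z) r o (Zp p Z) z b) o B
      X' : Run (λ e → HY Z e ∨ (n ∧ D e)) false (U p Z) r true (Zp p Z) z x
      X' = subst (λ k → Run (λ e → HY Z e ∨ (n ∧ D e)) false (U p Z) r k (Zp p Z) z x) (cong not o)
        (subst (λ k → Run (λ e → HY Z e ∨ (n ∧ D e)) k (U p Z) r (not odd?) (Zp p Z) z x) (cong not hn1) X)
      cov₁ : HY Y ⊆ (HY Z ∪ (D ∪ (λ _ → false)))
      cov₁ a h = [ (λ d → ∨-introʳ {HY Z a} (∨-introˡ d)) , (λ k → ∨-introˡ k) ]′ (hy-Y a h)
      cov₂ : HY Y ⊆ (λ a → (HY Z a ∨ (n ∧ D a)) ∨ (true ∧ ⟦ e₁ ⟧ a))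
      cov₂ a h = u3 {HY Z a} ([ (λ d → inj₂ (inj₁ (∧-intro hn1 d))) , inj₁ ]′ (hy-Y a h))
      total : base + (4 * φ Z + 2 * card (edges p)) + (2 + size G D) ≡ 4 * size G D + 4 * φ Z
      total = trans (cong₂ (λ m k → (if m then k else 0) + (4 * φ Z + 2 * card (edges p)) + (2 + k)) hn1 size-D)
        (trans (solve 2 (λ f l → (con 1 :+ l) :+ (con 4 :* f :+ con 2 :* l) :+ (con 2 :+ (con 1 :+ l)) := con 4 :* (con 1 :+ l) :+ con 4 :* f) refl (φ Z) (card (edges p)))
          (cong (λ k → 4 * k + 4 * φ Z) (sym size-D)))

    -- The base of the recursion: `D` is the tadpole once in α, once in β and twice in γ.
    leaf-case : (∀ t → Z t ≡ false) → n ≡ true → OddCov Y r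
    leaf-case empty hn1 = record
      { α = weaken cov (λ _ h → h) (λ _ h → h) ≤-refl (single-tad t)
      ; β = weaken cov (λ _ h → h) (λ _ h → h) ≤-refl (single-tad t)
      ; γ = mkRun [] [] (on t) (on t) (λ e h → inj₂ (inj₁ (cov e h))) ≤-refl
      ; bound = ≤-trans (≤-reflexive (trans (cong (λ d → d + d + (d + d)) (bare-length hn1))
            (solve 1 (λ d → d :+ d :+ (d :+ d) := con 4 :* d) refl (size G D)))) (≤-trans (m≤m+n _ _) room) }
      where
      t : Tad Y r
      t = bare-D hn1
      cov : HY Y ⊆ Tad.body t
      cov e h = [ ∨-introˡ , (λ k → clash k (hy-empty {Z} empty e)) ]′ (hy-Y e h)

    result : OddCov Y r
    result = [ (λ empty → leaf-case empty (trans (sym (xor-identityʳ n)) (trans (cong (n xor_) (sym (par-empty {Z} (hy-empty {Z} empty)))) par-D))) , some ]′ runs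
      where
      some : Some p Z → OddCov Y r
      some s = cases n (λ h → negative-case s h (not-true (subst (λ k → k xor Some.odd? s ≡ true) h (trans (cong (n xor_) (sym (Some.parZ s))) par-D))))
        (λ h → positive-case s h (subst (λ k → k xor Some.odd? s ≡ true) h (trans (cong (n xor_) (sym (Some.parZ s))) par-D)))

  -- If `r` is off `H`, the core is `r` alone. Otherwise it is the cycle at `r`, and even components
  -- are peeled off until only odd ones remain, as the traversal requires.
  odd-cover : ∀ k Y → card Y ≤ k → Good Y → par Y ≡ true → ∀ r → Y r ≡ true → Leaves Y r → OddCov Y r
  -- No root is prescribed: any cycle of `H` serves as core, and the edge joining an odd component
  -- to it is the leaving edge that `odd-cover` demands on both sides.
  even-cover : ∀ k Y → card Y ≤ k → Good Y → par Y ≡ false → EvCov Y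

  odd-cover zero Y le gY pY r ry lv = ⊥-elim (<⇒≱ (subst (_≤ card Y) (cong b2n ry) (term≤sumFin (b2n ∘ Y) r)) le)
  odd-cover (suc k) Y le gY pY r ry lv = cases (verts H r) on-H off-H
    where
    peel : ∀ {Q₀} (gQ : Good Q₀) (sub : Q₀ ⊆ Y) → Q₀ r ≡ true → ∀ y (yy : Comp.Y° gY gQ sub y ≡ true) → par (Comp.comp gY gQ sub y) ≡ false → OddCov Y r
    peel gQ sub qr y yy h = C.peel-odd y yy (even-cover k (C.comp y) (s≤s⁻¹ (≤-trans (C.comp< y yy) le)) (C.comp-good y yy) h)
        (odd-cover k (C.rest y yy) (s≤s⁻¹ (≤-trans (C.rest< y yy) le)) (C.rest-good y yy)
          (trans (sym (trans (C.par-rest y yy) (cong (_xor par (C.rest y yy)) h))) pY)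
          r (C.Q₀⊆rest y yy r qr) (leaves-⊆ (C.rest⊆Y y yy) r (C.Q₀⊆rest y yy r qr) lv))
      where module C = Comp gY gQ sub
    off-H : verts H r ≡ false → OddCov Y r
    off-H nh = [ grow , (λ none → clash pY (par-empty {Y} (no-H none))) ]′ (search C.Y°)
      where
      gQ : Good ⟦ r ⟧
      gQ = record { hcl = λ e h → trans (away e h (inj₁ refl)) (sym (away e h (inj₂ refl))) ; root = r ; root∈ = ⌊≟⌋-refl r
        ; conn = λ Q qr cl v h → ⟦⟧-subst Q h qr }
        where
        away : ∀ e → H e ≡ true → ∀ {v} → At e v → ⟦ r ⟧ v ≡ false
        away e h a = separated (not ∘ verts H) (not-intro nh) (cong not (edge-verts H h a))
      sub : ⟦ r ⟧ ⊆ Y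
      sub v h = ⟦⟧-subst Y h ry
      module C = Comp gY gQ sub
      no-H : (∀ v → C.Y° v ≡ false) → ∀ e → HY Y e ≡ false
      no-H none e = ¬-false λ h → clash (∧-intro (inside-at Y {e} (proj₂ (∧-true {H e} h)) (inj₁ refl))
        (not-intro (separated (not ∘ verts H) (not-intro nh) (cong not (edge-verts H (proj₁ (∧-true h)) (inj₁ refl)))))) (none (src e))
      grow : ∃[ y ] C.Y° y ≡ true → OddCov Y r
      grow (y , yy) = cases (par (C.comp y)) odd-part (peel gQ sub (⌊≟⌋-refl r) y yy)
        where
        odd-part : par (C.comp y) ≡ true → OddCov Y r
        odd-part h = go (C.bridge y yy)
          where
          go : ∃[ e ] ∃[ u ] ∃[ d ] W e ≡ true × Joins G e u d × C.comp y u ≡ true × ⟦ r ⟧ d ≡ true → OddCov Y r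
          go (e , u , d , w , j , cu , qd) = subst (OddCov Y) (sym (⌊≟⌋-true qd)) (C.prolong y yy j (C.Q₀⊆rest y yy d qd)
            (odd-cover k (C.comp y) (s≤s⁻¹ (≤-trans (C.comp< y yy) le)) (C.comp-good y yy) h u cu
              (e , proj₁ (joins→at j) , joins-crosses (C.comp y) j cu (C.comp-Q₀ y yy d qd)))
            (even-cover k (C.rest y yy) (s≤s⁻¹ (≤-trans (C.rest< y yy) le)) (C.rest-good y yy)
              (not-true (trans (sym (trans (C.par-rest y yy) (cong (_xor par (C.rest y yy)) h))) pY))))
    on-H : verts H r ≡ true → OddCov Y r
    on-H hr = [ (λ (y , h) → peel gVD VD⊆Y (inc→verts D r r∈D) y (proj₁ (∧-true h)) (not-true (proj₂ (∧-true {C.Y° y} h)))) , all-odd ]′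
        (search (λ y → C.Y° y ∧ not (par (C.comp y))))
      where
      ca : CycleAt r
      ca = cycle-at r (verts→inc H r hr)
      open CycleCore gY ry ca
      module C = Comp gY gVD VD⊆Y
      all-odd : (∀ y → C.Y° y ∧ not (par (C.comp y)) ≡ false) → OddCov Y r
      all-odd none = Finish.result gY ry lv ca pY (sgn D) refl ih
        where
        is-odd : ∀ y → C.Y° y ≡ true → par (C.comp y) ≡ true
        is-odd y yy = cases (par (C.comp y)) (λ h → h) (λ h → clash (∧-intro yy (not-intro h)) (none y))
        ih : ∀ y → C.Y° y ≡ true → Leaves (C.comp y) y → (par (C.comp y) ≡ true) × OddCov (C.comp y) y
        ih y yy l = is-odd y yy , odd-cover k (C.comp y) (s≤s⁻¹ (≤-trans (C.comp< y yy) le)) (C.comp-good y yy) (is-odd y yy) y (C.comp-root y) l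

  even-cover zero Y le gY pY = ⊥-elim (<⇒≱ (subst (_≤ card Y) (cong b2n (Good.root∈ gY)) (term≤sumFin (b2n ∘ Y) (Good.root gY))) le)
  even-cover (suc k) Y le gY pY = [ has-H , no-H ]′ (search (HY Y))
    where
    no-H : (∀ e → HY Y e ≡ false) → EvCov Y
    no-H none = record { α = empty ; β = empty ; γ = empty ; bound = z≤n }
      where
      empty : Closed (HY Y) 0
      empty = weaken (λ e h → clash h (none e)) (λ _ h → h) (λ _ h → h) ≤-refl nothing
    has-H : ∃[ e ] HY Y e ≡ true → EvCov Y
    has-H (e₀ , h₀) = [ split , whole ]′ (search C.Y°)
      where
      r : V
      r = src e₀
      ry : Y r ≡ true
      ry = inside-at Y {e₀} (proj₂ (∧-true {H e₀} h₀)) (inj₁ refl)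
      ca : CycleAt r
      ca = cycle-at r (inc e₀ r (proj₁ (∧-true h₀)) (inj₁ refl))
      open CycleCore gY ry ca
      module C = Comp gY gVD VD⊆Y
      split : ∃[ y ] C.Y° y ≡ true → EvCov Y
      split (y , yy) = cases (par (C.comp y)) (λ h → odd-parts h (C.bridge y yy)) even-parts
        where
        small₁ : card (C.comp y) ≤ k
        small₁ = s≤s⁻¹ (≤-trans (C.comp< y yy) le)
        small₂ : card (C.rest y yy) ≤ k
        small₂ = s≤s⁻¹ (≤-trans (C.rest< y yy) le)
        even-parts : par (C.comp y) ≡ false → EvCov Y
        even-parts h = C.peel-even y yy (even-cover k (C.comp y) small₁ (C.comp-good y yy) h)
          (even-cover k (C.rest y yy) small₂ (C.rest-good y yy) (trans (sym (trans (C.par-rest y yy) (cong (_xor par (C.rest y yy)) h))) pY))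
        odd-parts : par (C.comp y) ≡ true → ∃[ e ] ∃[ u ] ∃[ d ] W e ≡ true × Joins G e u d × C.comp y u ≡ true × VD d ≡ true → EvCov Y
        odd-parts h (e , u , d , w , j , cu , qd) = C.join-even y yy j
          (odd-cover k (C.comp y) small₁ (C.comp-good y yy) h u cu (e , proj₁ (joins→at j) , joins-crosses (C.comp y) j cu (C.comp-Q₀ y yy d qd)))
          (odd-cover k (C.rest y yy) small₂ (C.rest-good y yy) (not-not (trans (sym (trans (C.par-rest y yy) (cong (_xor par (C.rest y yy)) h))) pY)) d (C.Q₀⊆rest y yy d qd)
            (e , proj₂ (joins→at j) , joins-crosses (C.rest y yy) (joins-sym j) (C.Q₀⊆rest y yy d qd) (C.comp-rest y yy u cu)))
          where
          not-not : ∀ {b} → not b ≡ false → b ≡ true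
          not-not {true} _ = refl
      whole : (∀ v → C.Y° v ≡ false) → EvCov Y
      whole none = record { α = closed ; β = closed ; γ = closed
        ; bound = ≤-trans (≤-reflexive (solve 1 (λ d → d :+ d :+ d := con 3 :* d) refl (size G D))) (≤-trans (NP.*-monoˡ-≤ (size G D) (NP.n≤1+n 3)) (NP.*-monoʳ-≤ 4
            (card-mono (λ e d → ∧-intro (H⊆W e (D⊆H e d)) (inside-mono VD Y VD⊆Y (D-inside e d)))))) }
        where
        Y⊆VD : Y ⊆ VD
        Y⊆VD v yv = cases (VD v) (λ d → d) (λ d → clash (∧-intro yv (not-intro d)) (none v))
        hy-D : ∀ e → HY Y e ≡ D e
        hy-D e = iff (λ h → sat (Y⊆VD _ (inside-at Y {e} (proj₂ (∧-true {H e} h)) (inj₁ refl))) (proj₁ (∧-true h)) (inj₁ refl))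
          (λ d → ∧-intro (D⊆H e d) (inside-mono VD Y VD⊆Y (D-inside e d)))
        closed : Closed (HY Y) (size G D)
        closed = weaken (λ e h → trans (sym (hy-D e)) h) (λ _ h → h) (λ _ h → h) ≤-refl
          (single-circuit (inj₁ (positive isCycle (trans (sym (sgn-cong hy-D)) pY))))

  opaque
    -- The cheapest of the three covers costs at most a third of their total.
    cactus-cover : V → (∀ u v → Walk G W u v) → sgn H ≡ false →
      ∃[ F ] All (IsCircuit G σ) F × (∀ e → H e ≡ true → Any (λ C → C e ≡ true) F) × 3 * coverLength G F ≤ 4 * size G W
    cactus-cover r₀ conn s = best (even-cover (n G) (λ _ → true) (card-≤ {n G} (λ _ → true)) good (trans (sgn-cong (λ e → ∧-identityʳ (H e))) s))
      where
      good : Good (λ _ → true)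
      good = record { hcl = λ _ _ → refl ; root = r₀ ; root∈ = refl
        ; conn = λ Q q cl v _ → trans (sym (walk-closed Q (λ e w → cl e w refl) (conn r₀ v))) q }
      Short : List ESet → Set
      Short F = All (IsCircuit G σ) F × (∀ e → H e ≡ true → Any (λ C → C e ≡ true) F) × 3 * coverLength G F ≤ 4 * size G W
      use : ∀ {c} → Closed (HY (λ _ → true)) c → 3 * c ≤ 4 * size G W → ∃[ F ] Short F
      use {c} cl le = go cl
        where
        go : Run (HY (λ _ → true)) false (λ _ → true) r₀ false (λ _ → true) r₀ c → ∃[ F ] Short F
        go (mkRun F ci off off cov len) = F , ci , (λ e h → only (cov e (∧-intro h refl))) , ≤-trans (NP.*-monoʳ-≤ 3 (≤-trans (m≤m+n _ 0) len)) le
          where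
          only : ∀ {A : Set} → A ⊎ (false ≡ true ⊎ false ≡ true) → A
          only (inj₁ a) = a
          only (inj₂ (inj₁ ()))
          only (inj₂ (inj₂ ()))
      best : EvCov (λ _ → true) → ∃[ F ] Short F
      best ev = pick (3 * a ≤? 4 * size G W) (3 * b ≤? 4 * size G W) (3 * c ≤? 4 * size G W)
        where
        open EvCov ev
        total : a + b + c ≤ 4 * size G W
        total = ≤-trans bound (≤-reflexive (cong (4 *_) (sumFin-cong (λ e → cong b2n (∧-identityʳ (W e))))))
        pick : Dec (3 * a ≤ 4 * size G W) → Dec (3 * b ≤ 4 * size G W) → Dec (3 * c ≤ 4 * size G W) → ∃[ F ] Short F
        pick (yes p) _ _ = use α p
        pick _ (yes p) _ = use β p
        pick _ _ (yes p) = use γ p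
        pick (no x) (no y) (no z) = ⊥-elim (<⇒≱ (NP.+-mono-< (NP.+-mono-< (NP.≰⇒> x) (NP.≰⇒> y)) (NP.≰⇒> z))
          (≤-trans (≤-reflexive (solve 3 (λ a b c → con 3 :* a :+ con 3 :* b :+ con 3 :* c := con 3 :* (a :+ b :+ c)) refl a b c))
            (≤-trans (NP.*-monoʳ-≤ 3 total) (≤-reflexive (solve 1 (λ w → con 3 :* w := w :+ w :+ w) refl (4 * size G W))))))

-- Signatures and switching

handshake : ∀ (G : Graph) → Cubic G → 3 * n G ≡ 2 * m G
handshake G cub = trans (trans (sym (sumFin-const (n G) 3)) (sumFin-cong (λ v → sym (cub v))))
  (trans (sumFin-swap (λ v e → endCount G e v)) (trans (sumFin-cong two) (sumFin-const (m G) 2)))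
  where
  sumFin-const : ∀ k c → sumFin {k} (λ _ → c) ≡ c * k
  sumFin-const zero c = sym (NP.*-zeroʳ c)
  sumFin-const (suc k) c = trans (cong (c +_) (sumFin-const k c)) (sym (NP.*-suc c k))
  two : ∀ e → sumFin (λ v → endCount G e v) ≡ 2
  two e = trans (sumFin-+ (λ v → b2n ⌊ proj₁ (ends G e) ≟ v ⌋) _) (cong₂ _+_ (card-⌊≟⌋ (proj₁ (ends G e))) (card-⌊≟⌋ (proj₂ (ends G e))))

-- Cuts and loops in a 2-edge-connected cubic graph

module Basic (G : Graph) (cub : Cubic G) (conn : TwoEdgeConnected G) where
  open Paths G

  opaque
    two-crossing : ∀ (X : VSet) e → crosses X e ≡ true → ∃[ f ] crosses X f ≡ true × e ≢ f
    two-crossing X e c with search (λ f → crosses X f ∧ not (⟦ e ⟧ f))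
    ... | inj₁ (f , h) = f , proj₁ (∧-true h) , λ { refl → true≢false (trans (sym (⌊≟⌋-refl e)) (not-true (proj₂ (∧-true {crosses X e} h)))) }
    ... | inj₂ none = ⊥-elim (true≢false (trans (sym c) (trans (cong (_xor X (tgt e)) same) (xor-same (X (tgt e))))))
      where
      closed : ∀ f → deleteEdge G e f ≡ true → X (src f) ≡ X (tgt f)
      closed f d = xor-eq (cases (crosses X f) (λ k → ⊥-elim (true≢false (trans (sym (∧-intro k (not-intro (off d)))) (none f)))) (λ k → k))
        where
        off : (if ⌊ e ≟ f ⌋ then false else true) ≡ true → ⌊ e ≟ f ⌋ ≡ false
        off h with ⌊ e ≟ f ⌋
        ... | false = refl
      same : X (src e) ≡ X (tgt e)
      same = walk-closed X closed (proj₂ conn e (src e) (tgt e))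

  opaque
    -- Degree parity forces a proper edge at `v` beside the loop, and 2-edge-connectivity a second
    -- one; with the loop counted twice this exceeds three.
    loopless : Loopless G
    loopless e l = NP.<-irrefl refl (≤-trans four (≤-reflexive (cub v)))
      where
      v : V
      v = src e
      star : VSet
      star = ⟦ v ⟧
      count : ∀ f → odd (endCount G f v) ≡ true → crosses star f ≡ true × 0 < endCount G f v
      count f h with v ≟ src f | v ≟ tgt f | src f ≟ v | tgt f ≟ v
      ... | yes _ | no _ | yes _ | no _ = refl , s≤s z≤n
      ... | no _ | yes _ | no _ | yes _ = refl , s≤s z≤n
      ... | yes p | _ | no q | _ = ⊥-elim (q (sym p))
      ... | no p | _ | yes q | _ = ⊥-elim (p (sym q))
      ... | _ | yes p | _ | no q = ⊥-elim (q (sym p))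
      ... | _ | no p | _ | yes q = ⊥-elim (p (sym q))
      ... | yes _ | yes _ | yes _ | yes _ = ⊥-elim (true≢false (sym h))
      ... | no _ | no _ | no _ | no _ = ⊥-elim (true≢false (sym h))
      cross-pos : ∀ f → crosses star f ≡ true → 0 < endCount G f v
      cross-pos f c with xor-split star c
      ... | u , w , j , p , _ = endCount-at f v (subst (At f) (sym (⌊≟⌋-true p)) (proj₁ (joins→at j)))
      first : ∃[ f ] crosses star f ≡ true
      first with search (crosses star)
      ... | inj₁ x = x
      ... | inj₂ none = ⊥-elim (true≢false (trans (cong odd (sym (cub v))) (trans (odd-sumFin (λ f → endCount G f v)) (Σ₂.∑-0 even))))
        where
        even : ∀ f → odd (endCount G f v) ≡ false
        even f = cases (odd (endCount G f v)) (λ h → ⊥-elim (true≢false (trans (sym (proj₁ (count f h))) (none f)))) (λ h → h)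
      second : ∃[ g ] crosses star g ≡ true × proj₁ first ≢ g
      second = two-crossing star (proj₁ first) (proj₂ first)
      e-no-cross : crosses star e ≡ false
      e-no-cross = trans (cong (_xor star (tgt e)) (cong star l)) (xor-same (star (tgt e)))
      e≢ : ∀ f → crosses star f ≡ true → e ≢ f
      e≢ f c refl = true≢false (trans (sym c) e-no-cross)
      loop-two : endCount G e v ≡ 2
      loop-two rewrite ⌊≟⌋-refl (src e) | sym l | ⌊≟⌋-refl (src e) = refl
      f g : E
      f = proj₁ first
      g = proj₁ second
      four : 4 ≤ deg G (allEdges G) v
      four = ≤-trans (≤-trans (+-mono-≤ (+-mono-≤ (≤-reflexive (sym (trans (deg-⟦⟧ e v) loop-two))) (subst (0 <_) (sym (deg-⟦⟧ f v)) (cross-pos f (proj₂ first))))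
          (subst (0 <_) (sym (deg-⟦⟧ g v)) (cross-pos g (proj₁ (proj₂ second)))))
        (≤-reflexive (sym (trans (deg-∪ {⟦ e ⟧ ∪ ⟦ f ⟧} {⟦ g ⟧} v (⟦⟧-disjoint g (∨-false-intro (⌊≟⌋-≢ (e≢ g (proj₁ (proj₂ second)))) (⌊≟⌋-≢ (proj₂ (proj₂ second))))))
          (cong (_+ deg G ⟦ g ⟧ v) (deg-∪ {⟦ e ⟧} {⟦ f ⟧} v (⟦⟧-disjoint f (⌊≟⌋-≢ (e≢ f (proj₂ first))))))))))
        (deg-mono {(⟦ e ⟧ ∪ ⟦ f ⟧) ∪ ⟦ g ⟧} v (λ _ _ → refl))

module Switching (G : Graph) (loopless : Loopless G) (deg≤3 : MaxDegree3 G) where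
  open Subcubic G loopless deg≤3
  private
    module B (σ : Signature G) = Barbells G loopless deg≤3 σ

  -- Switching changes the sign sum by the number of edges of `C` in a cut, which `∂-cut` shows to
  -- be even.
  sgn-switch : ∀ {σ τ} → SwitchStep G σ τ → ∀ {C} → IsCycle G C → B.sgn τ C ≡ B.sgn σ C
  sgn-switch {σ} {τ} (X , h) {C} cy = trans (Σ₂.∑-cong (λ e → trans (cong (C e ∧_) (h e)) (∧-distribˡ-xor (C e) (σ e) (crosses X e))))
    (trans (Σ₂.∑-⊕ (λ e → C e ∧ σ e) (λ e → C e ∧ crosses X e))
      (trans (cong (B.sgn σ C xor_) (trans (sym (∂₂.∂-cut X C)) (Σ₂.∑-0 (λ v → trans (cong (X v ∧_) (cycle-even cy v)) (∧-zeroʳ (X v))))))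
        (xor-identityʳ _)))

  sgn-negative : ∀ {σ C} → NegativeCycle G σ C → B.sgn σ C ≡ true
  sgn-negative {σ} {C} (_ , nd) = cases (B.sgn σ C) (λ h → h)
    (λ h → ⊥-elim (nd (proj₁ (odd⇔2∣ _) (trans (B.odd-negCount σ C) h))))

  sgn-positive : ∀ {σ C} → PositiveCycle G σ C → B.sgn σ C ≡ false
  sgn-positive {σ} {C} (_ , d) = trans (sym (B.odd-negCount σ C)) (proj₂ (odd⇔2∣ _) d)

  circuit-switch : ∀ {σ τ} → SwitchStep G σ τ → ∀ {C} → IsCircuit G τ C → IsCircuit G σ C
  circuit-switch {σ} {τ} s (inj₁ p@(cy , _)) = inj₁ (B.positive σ cy (trans (sym (sgn-switch {σ} {τ} s cy)) (sgn-positive {τ} p)))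
  circuit-switch {σ} {τ} s (inj₂ (C₁ , C₂ , P , u , v , n₁ , n₂ , rest)) = inj₂ (C₁ , C₂ , P , u , v , neg n₁ , neg n₂ , rest)
    where
    neg : ∀ {C} → NegativeCycle G τ C → NegativeCycle G σ C
    neg p@(cy , _) = B.negative σ cy (trans (sym (sgn-switch {σ} {τ} s cy)) (sgn-negative {τ} p))

  circuit-equivalent : ∀ {σ τ} → Equivalent G σ τ → ∀ {C} → IsCircuit G τ C → IsCircuit G σ C
  circuit-equivalent ε c = c
  circuit-equivalent {σ} (_◅_ {j = ρ} s st) c = circuit-switch {σ} {ρ} s (circuit-equivalent st c)

module CycleEdges (G : Graph) (loopless : Loopless G) (S : EdgeSet G) where
  open Cycles G loopless

  opaque
    on-cycle : ESet
    on-cycle e = [ (λ _ → true) , (λ _ → false) ]′ (cycle-or-cut S e)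

    on-cycle-true : ∀ e → on-cycle e ≡ true → CycleThrough S e
    on-cycle-true e h with cycle-or-cut S e
    ... | inj₁ c = c

    on-cycle-false : ∀ e → on-cycle e ≡ false →
      ∃[ X ] crosses X e ≡ true × (∀ f → S f ≡ true → crosses X f ≡ true → e ≡ f)
    on-cycle-false e h with cycle-or-cut S e
    ... | inj₂ c = c

-- Combining the two covers for a minimal signature

module Assembly (G : Graph) (cub : Cubic G) (conn : TwoEdgeConnected G) (r₀ : Fin (n G)) (τ : Signature G)
  (minimal : ∀ X → negCount G τ (allEdges G) ≤ negCount G (switch G X τ) (allEdges G))
  (even-τ : 2 ∣ negCount G τ (allEdges G)) where
  open Basic G cub conn
  deg≤3 : MaxDegree3 G
  deg≤3 v = ≤-reflexive (cub v)
  open Barbells G loopless deg≤3 τ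

  S₀ : ESet
  S₀ e = not (τ e)

  -- Switching at X cannot reduce the number of negative edges.
  cut-half : ∀ X → card (λ e → τ e ∧ crosses X e) ≤ card (λ e → crosses X e ∧ not (τ e))
  cut-half X = NP.+-cancelˡ-≤ (card (λ e → τ e ∧ not (crosses X e))) _ _ (≤-trans (≤-reflexive whole) (≤-trans (minimal X) (≤-reflexive switched)))
    where
    whole : card (λ e → τ e ∧ not (crosses X e)) + card (λ e → τ e ∧ crosses X e) ≡ negCount G τ (allEdges G)
    whole = trans (sym (sumFin-+ (λ e → b2n (τ e ∧ not (crosses X e))) _)) (sumFin-cong (λ e → go (τ e) (crosses X e)))
      where
      go : ∀ t c → b2n (t ∧ not c) + b2n (t ∧ c) ≡ b2n t
      go true true = refl
      go true false = refl
      go false _ = refl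
    switched : negCount G (switch G X τ) (allEdges G) ≡ card (λ e → τ e ∧ not (crosses X e)) + card (λ e → crosses X e ∧ not (τ e))
    switched = trans (sumFin-cong (λ e → go (τ e) (crosses X e))) (sumFin-+ (λ e → b2n (τ e ∧ not (crosses X e))) _)
      where
      go : ∀ t c → b2n (t xor c) ≡ b2n (t ∧ not c) + b2n (c ∧ not t)
      go true true = refl
      go true false = refl
      go false true = refl
      go false false = refl

  opaque
    tree : Reach S₀ r₀
    tree = reach S₀ r₀

  open Reach tree

  -- No positive edge leaves the reached set, hence by `cut-half` no negative edge does either, and
  -- the graph is connected.
  spanning : ∀ v → Q v ≡ true
  spanning v = trans (sym (walk-closed Q no-cross (proj₁ conn r₀ v))) root
    where
    no-negative : card (λ e → τ e ∧ crosses Q e) ≡ 0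
    no-negative = NP.n≤0⇒n≡0 (≤-trans (cut-half Q) (≤-reflexive (trans (sumFin-cong (λ e → cong b2n (uncut e))) (sumFin-0 {m G}))))
      where
      uncut : ∀ e → crosses Q e ∧ not (τ e) ≡ false
      uncut e = cases (S₀ e) (λ s → trans (cong (_∧ not (τ e)) (trans (cong (_xor Q (tgt e)) (closed e s)) (xor-same (Q (tgt e))))) refl)
        (λ s → trans (cong (crosses Q e ∧_) s) (∧-zeroʳ (crosses Q e)))
    no-cross : ∀ e → allEdges G e ≡ true → Q (src e) ≡ Q (tgt e)
    no-cross e _ = cases (τ e)
      (λ t → xor-eq (cases (crosses Q e) (λ c → ⊥-elim (NP.<-irrefl refl (subst (1 ≤_) no-negative (subst (_≤ card (λ e → τ e ∧ crosses Q e)) (cong b2n (∧-intro t c)) (term≤sumFin (λ e → b2n (τ e ∧ crosses Q e)) e))))) (λ c → c)))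
      (λ t → closed e (not-intro t))

  W : ESet
  W = T ∪ τ

  W-connected : ∀ u v → Walk G W u v
  W-connected u v = walk-++ (walk-sym (from u)) (from v)
    where
    from : ∀ v → Walk G W r₀ v
    from v = let s = spine v (spanning v) in walk-mono (λ e i → ∨-introˡ (proj₁ (proj₂ s) e i)) (vis-walk (proj₁ s) v (vis-end (proj₁ s)))

  private
    module F₂ = Flow G loopless BoolRing

  opaque
    -- A join in the tree for the vertices of odd negative degree; it exists because boundaries have
    -- total zero.
    joining : ∃[ g ] (∀ e → T e ≡ false → g e ≡ false) × (∀ v → ∂₂.∂ g v ≡ ∂₂.∂ τ v)
    joining = F₂.push T Q r₀ (λ v q → proj₁ (spine v q) , proj₁ (proj₂ (spine v q))) (∂₂.∂ τ)
      (λ v q → ⊥-elim (true≢false (trans (sym (spanning v)) q)))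
      (trans (∂₂.∂-cut (λ _ → true) τ) (Σ₂.∑-0 (λ e → ∧-zeroʳ (τ e))))

  H : ESet
  H = τ △ proj₁ joining

  evH : Even H
  evH v = trans (∂₂.∂-⊕ τ (proj₁ joining) v) (trans (cong (∂₂.∂ τ v xor_) (proj₂ (proj₂ joining) v)) (xor-same (∂₂.∂ τ v)))

  H⊆W : H ⊆ W
  H⊆W e h = cases (T e) ∨-introˡ λ t → ∨-introʳ {T e}
    (trans (sym (trans (cong (τ e xor_) (proj₁ (proj₂ joining) e t)) (xor-identityʳ (τ e)))) h)

  τ⊆H : τ ⊆ H
  τ⊆H e t = cong₂ _xor_ t (proj₁ (proj₂ joining) e (cases (T e) (λ k → ⊥-elim (true≢false (trans (sym (T⊆S e k)) (cong not t)))) (λ k → k)))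

  -- Tree edges are positive, so the negative edges of `H` are all those of `τ`, even in number.
  sgn-H : sgn H ≡ false
  sgn-H = trans all-negative (trans (sym (odd-negCount (allEdges G))) (proj₂ (odd⇔2∣ (negCount G τ (allEdges G))) even-τ))
    where
    absorb-∧ : ∀ {a b} → (b ≡ true → a ≡ true) → a ∧ b ≡ b
    absorb-∧ {a} {true}  h = trans (∧-identityʳ a) (h refl)
    absorb-∧ {a} {false} h = ∧-zeroʳ a
    all-negative : sgn H ≡ sgn (allEdges G)
    all-negative = Σ₂.∑-cong {f = λ e → H e ∧ τ e} {g = τ} (λ e → absorb-∧ {H e} (τ⊆H e))

  opaque
    signed-part : ∃[ F ] All (IsCircuit G τ) F × (∀ e → H e ≡ true → Any (λ C → C e ≡ true) F) × 3 * coverLength G F ≤ 4 * size G W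
    signed-part = CactusCover.cactus-cover G loopless deg≤3 τ W H H⊆W evH r₀ W-connected sgn-H

  open CycleEdges G loopless S₀

  E₀ : ESet
  E₀ e = S₀ e ∧ on-cycle e

  -- A cycle of positive edges through `e` witnesses `on-cycle` for each of its own edges, so it
  -- stays inside `E₀`.
  bridgeless : Bridgeless G E₀
  bridgeless X e h c = go (even-bridge X e (cycle-even isCycle) e₀∈ c)
    where
    open CycleThrough (on-cycle-true e (proj₂ (∧-true {S₀ e} h)))
    D⊆E₀ : D ⊆ E₀
    D⊆E₀ f d = ∧-intro sf (cases (on-cycle f) (λ k → k) (λ k → ⊥-elim (cut (on-cycle-false f k))))
      where
      sf : S₀ f ≡ true
      sf = D⊆ (proj₁ (∧-true h)) f d
      cut : ∃[ Y ] crosses Y f ≡ true × (∀ g → S₀ g ≡ true → crosses Y g ≡ true → f ≡ g) → ⊥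
      cut (Y , cy , only) = alone (even-bridge Y f (cycle-even isCycle) d cy)
        where
        alone : ∃[ g ] D g ≡ true × crosses Y g ≡ true × f ≢ g → ⊥
        alone (g , dg , cg , ne) = ne (only g (D⊆ (proj₁ (∧-true h)) g dg) cg)
    go : ∃[ f ] D f ≡ true × crosses X f ≡ true × e ≢ f → ∃[ f ] E₀ f ≡ true × crosses X f ≡ true × e ≢ f
    go (f , d , cf , ne) = f , D⊆E₀ f d , cf , ne

  -- A bridge of the positive part forms a cut with exactly one negative edge, so the even set H contains it.
  bridge∈H : ∀ e → on-cycle e ≡ false → S₀ e ≡ true → H e ≡ true
  bridge∈H e b s = cases (H e) (λ h → h) λ he → ⊥-elim (contra he (on-cycle-false e b))
    where
    contra : H e ≡ false → ∃[ X ] crosses X e ≡ true × (∀ f → S₀ f ≡ true → crosses X f ≡ true → e ≡ f) → ⊥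
    contra he (X , c , only) = second (two-crossing X e c)
      where
      negative-crossing : ∀ f → crosses X f ≡ true → e ≢ f → τ f ≡ true
      negative-crossing f cf ne = cases (τ f) (λ t → t) (λ t → ⊥-elim (ne (only f (not-intro t) cf)))
      -- The only positive edge in this cut is `e`; a second negative edge would contradict
      -- minimality.
      one : card (λ f → τ f ∧ crosses X f) ≤ 1
      one = ≤-trans (cut-half X) (≤-trans (card-mono {Y = ⟦ e ⟧} (λ f h → subst (λ f → ⟦ e ⟧ f ≡ true) (only f (proj₂ (∧-true {crosses X f} h)) (proj₁ (∧-true h))) (⌊≟⌋-refl e)))
        (≤-reflexive (card-⌊≟⌋ e)))
      second : ∃[ f ] crosses X f ≡ true × e ≢ f → ⊥
      second (f , cf , ne) = third (even-bridge X f evH (τ⊆H f tf) cf)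
        where
        tf : τ f ≡ true
        tf = negative-crossing f cf ne
        -- Evenness of `H` asks for a partner of `f` in the cut. Were `e` outside `H`, the partner
        -- would be another negative edge.
        third : ∃[ g ] H g ≡ true × crosses X g ≡ true × f ≢ g → ⊥
        third (g , hg , cg , f≢g) = <⇒≱ (n<1+n 1) (≤-trans two one)
          where
          e≢g : e ≢ g
          e≢g refl = true≢false (trans (sym hg) he)
          in-cut : ∀ a → crosses X a ≡ true → e ≢ a → τ a ∧ crosses X a ≡ true
          in-cut a ca na = ∧-intro (negative-crossing a ca na) ca
          two : 2 ≤ card (λ f → τ f ∧ crosses X f)
          two = ≤-trans (≤-reflexive (sym (cong₂ _+_ (card-⌊≟⌋ f) (card-⌊≟⌋ g)))) (card-⊎ {X = ⟦ f ⟧} {⟦ g ⟧} {λ a → τ a ∧ crosses X a}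
            (λ a h → subst (λ a → (τ a ∧ crosses X a ≡ true) × ⟦ g ⟧ a ≡ false) (⌊≟⌋-true h) (in-cut f cf ne , ⌊≟⌋-≢ (λ k → f≢g (sym k))))
            (λ a h → subst (λ a → τ a ∧ crosses X a ≡ true) (⌊≟⌋-true h) (in-cut g cg e≢g)))

  opaque
    positive-part : ∃[ F ] All (λ D → IsCycle G D × D ⊆ E₀) F × (∀ e → E₀ e ≡ true → Any (λ D → D e ≡ true) F) × 3 * coverLength G F ≤ 5 * size G E₀
    positive-part = FiveThirds.five-thirds G loopless deg≤3 E₀ bridgeless

  positive-circuit : ∀ {D} → IsCycle G D × D ⊆ E₀ → IsCircuit G τ D
  positive-circuit {D} (cy , sub) = inj₁ (positive cy (Σ₂.∑-0 vanish))
    where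
    vanish : ∀ e → D e ∧ τ e ≡ false
    vanish e = cases (D e) (λ d → trans (cong (_∧ τ e) d) (not-true (proj₁ (∧-true (sub e d))))) (λ d → cong (_∧ τ e) d)

  cover : ∃[ F ] All (IsCircuit G τ) F × (∀ e → Any (λ C → C e ≡ true) F) × 9 * coverLength G F < 23 * m G
  cover = F₁ ++ F₂' , AllP.++⁺ (proj₁ (proj₂ signed-part)) (All.map positive-circuit (proj₁ (proj₂ positive-part))) , covers , short
    where
    F₁ F₂' : List ESet
    F₁ = proj₁ signed-part
    F₂' = proj₁ positive-part
    covers : ∀ e → Any (λ C → C e ≡ true) (F₁ ++ F₂')
    covers e = cases (τ e) (λ t → left (τ⊆H e t)) λ t → cases (on-cycle e)
        (λ k → AnyP.++⁺ʳ F₁ (proj₁ (proj₂ (proj₂ positive-part)) e (∧-intro (not-intro t) k)))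
        (λ k → left (bridge∈H e k (not-intro t)))
      where
      left : H e ≡ true → Any (λ C → C e ≡ true) (F₁ ++ F₂')
      left h = AnyP.++⁺ˡ (proj₁ (proj₂ (proj₂ signed-part)) e h)
    ν t : ℕ
    ν = card τ
    t = card T
    le₁ : 3 * coverLength G F₁ ≤ 4 * (t + ν)
    le₁ = ≤-trans (proj₂ (proj₂ (proj₂ signed-part))) (NP.*-monoʳ-≤ 4 (size-∪ T τ))
    le₂ : 3 * coverLength G F₂' ≤ 5 * size G E₀
    le₂ = proj₂ (proj₂ (proj₂ positive-part))
    disjoint : size G E₀ + ν ≤ m G
    disjoint = ≤-trans (card-⊎ {Y = τ} {Z = λ _ → true} (λ e h → refl , not-true (proj₁ (∧-true h))) (λ _ _ → refl)) (card-≤ (λ _ → true))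
    t<n : suc t ≤ n G
    t<n = ≤-trans small (card-≤ Q)
    short : 9 * coverLength G (F₁ ++ F₂') < 23 * m G
    short = begin-strict
      9 * coverLength G (F₁ ++ F₂')                       ≡⟨ cong (9 *_) (size-++ G F₁ F₂') ⟩
      9 * (coverLength G F₁ + coverLength G F₂')          ≡⟨ solve 2 (λ a b → con 9 :* (a :+ b) := con 3 :* (con 3 :* a) :+ con 3 :* (con 3 :* b)) refl (coverLength G F₁) (coverLength G F₂') ⟩
      3 * (3 * coverLength G F₁) + 3 * (3 * coverLength G F₂') ≤⟨ +-mono-≤ (NP.*-monoʳ-≤ 3 le₁) (NP.*-monoʳ-≤ 3 le₂) ⟩
      -- Raising the coefficient of `ν` from 12 to 15 lets the negative edges and `E₀`, which are
      -- disjoint, be charged together against `m G`.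
      3 * (4 * (t + ν)) + 3 * (5 * size G E₀)             ≤⟨ m≤m+n _ (3 * ν) ⟩
      3 * (4 * (t + ν)) + 3 * (5 * size G E₀) + 3 * ν     ≡⟨ solve 3 (λ t v s → con 3 :* (con 4 :* (t :+ v)) :+ con 3 :* (con 5 :* s) :+ con 3 :* v := con 12 :* t :+ con 15 :* (s :+ v)) refl t ν (size G E₀) ⟩
      12 * t + 15 * (size G E₀ + ν)                       ≤⟨ NP.+-monoʳ-≤ (12 * t) (NP.*-monoʳ-≤ 15 disjoint) ⟩
      -- Strictness comes from the tree having fewer edges than vertices.
      12 * t + 15 * m G                                   <⟨ NP.+-monoˡ-< (15 * m G) (NP.*-monoʳ-< 12 t<n) ⟩
      12 * n G + 15 * m G                                 ≡⟨ cong (_+ 15 * m G) (trans (NP.*-assoc 4 3 (n G)) (trans (cong (4 *_) (handshake G cub)) (sym (NP.*-assoc 4 2 (m G))))) ⟩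
      8 * m G + 15 * m G                                  ≡⟨ sym (NP.*-distribʳ-+ (m G) 8 15) ⟩
      23 * m G                                            ∎
      where
      open NP.≤-Reasoning

theorem3p2 : (G : Graph) (σ : Signature G) →
    0 < n G → Cubic G → TwoEdgeConnected G →
    (∃[ k ] (IsNegativeness G σ k × 2 ∣ k)) →
    ∃[ F ] (IsCircuitCover G σ F × 9 * coverLength G F < 23 * m G)
theorem3p2 G σ pos cub conn (k , ((τ , eq , count) , least) , 2∣k) =
  proj₁ cover , (All.map (Switching.circuit-equivalent G loopless deg≤3 eq) (proj₁ (proj₂ cover)) , proj₁ (proj₂ (proj₂ cover)))
  , proj₂ (proj₂ (proj₂ cover))
  where
  first-vertex : ∀ {k} → 0 < k → Fin k
  first-vertex (s≤s _) = zero
  open Basic G cub conn using (loopless)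
  open Assembly G cub conn (first-vertex pos) τ
    (λ X → subst (_≤ negCount G (switch G X τ) (allEdges G)) (sym count) (least (switch G X τ) (eq ◅◅ ((X , λ _ → refl) ◅ ε))))
    (subst (2 ∣_) (sym count) 2∣k)
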